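{- Let $n \geq 2$ be an integer such that $N = 2n+1$ is a prime number. Let $\alpha_{0}, \tilde{\alpha}_{1}, \dots, \tilde{\alpha}_{n-2}, \beta$ be integers such that $\beta \geq 0$. Set $\theta_{m} = 1-\exp(2\pi i m/N)$ for $m = 1, 2, \dots, 2n$. Assume that $\alpha_{0}(\alpha_{0}+1)$ is prime to $N$. Then the polynomial \[ t^{2}\Big(\alpha_{0}t^{n-1} + \sum_{j = 1}^{n-2} \tilde{\alpha}_{j} t^{n-1-j}x^{j} + N^{\beta}x^{n-1}\Big)\Big((\alpha_{0}+1)t^{n-1}+\sum_{j = 1}^{n-2} \tilde{\alpha}_{j} t^{n-1-j}x^{j} + N^{\beta}x^{n-1}\Big) - \prod_{m = 1}^{2n} \Big(x+\sum_{j = 1}^{2n-1} \theta_{m}^{j}y_{j}\Big) \] in the variables $t, x, y_1, \dots, y_{2n-1}$ (here $i=\sqrt{ -1}$) has no non-trivial roots in $\mathbb{Q}$, i.e. its only zero in $\mathbb{Q}^{2n+1}$ is $(0,\dots,0)$. -}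

module Defs where

open import Function using (_∘_)
open import Data.Bool using (if_then_else_)
open import Data.Nat as ℕ using (ℕ; zero; suc; _∸_; _≡ᵇ_)
open import Data.Nat.DivMod using (_mod_)
open import Data.Fin using (Fin; toℕ; zero; suc)
open import Data.Integer as ℤ using (ℤ)
open import Data.Product using (Σ)
open import Relation.Binary.PropositionalEquality using (_≡_)
open import Data.Rational using (ℚ; 0ℚ; 1ℚ; _+_; _*_; _-_; _/_)

⟦_⟧ : ℤ → ℚ
⟦ z ⟧ = z / 1

_^ℚ_ : ℚ → ℕ → ℚ
q ^ℚ zero  = 1ℚ
q ^ℚ suc k = q * (q ^ℚ k)

sumℚ : ∀ {k} → (Fin k → ℚ) → ℚ
sumℚ {zero}  f = 0ℚ
sumℚ {suc k} f = f zero + sumℚ (f ∘ suc)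

-- Arithmetic in ℚ(ζ_N), N = suc M, ζ_N = exp(2πi/N) ∈ ℂ.
-- An element is represented by coefficients c : Fin N → ℚ, standing for
-- the complex number Σ_k c_k ζ_N^k (i.e. an element of the group ring
-- ℚ[Z]/(Z^N - 1), mapped to ℂ by Z ↦ ζ_N, a ring homomorphism).

Cyc : ℕ → Set
Cyc M = Fin (suc M) → ℚ

ζ^ : ∀ M → ℕ → Cyc M
ζ^ M k i = if toℕ i ≡ᵇ toℕ (k mod suc M) then 1ℚ else 0ℚ

ι : ∀ M → ℚ → Cyc M
ι M r i = r * ζ^ M 0 i

_⊕_ : ∀ {M} → Cyc M → Cyc M → Cyc M
(a ⊕ b) i = a i + b i

_⊖_ : ∀ {M} → Cyc M → Cyc M → Cyc M
(a ⊖ b) i = a i - b i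

_·_ : ∀ {M} → ℚ → Cyc M → Cyc M
(r · a) i = r * a i

-- multiplication (cyclic convolution, as ζ^N = 1)
_⊗_ : ∀ {M} → Cyc M → Cyc M → Cyc M
_⊗_ {M} a b k = sumℚ λ i → a i * b ((toℕ k ℕ.+ (suc M ∸ toℕ i)) mod suc M)

_^ᶜ_ : ∀ {M} → Cyc M → ℕ → Cyc M
_^ᶜ_ {M} a zero    = ζ^ M 0
_^ᶜ_ {M} a (suc k) = a ⊗ (a ^ᶜ k)

sumᶜ : ∀ {M k} → (Fin k → Cyc M) → Cyc M
sumᶜ {M} {zero}  f = ι M 0ℚ
sumᶜ {M} {suc k} f = f zero ⊕ sumᶜ (f ∘ suc)

prodᶜ : ∀ {M k} → (Fin k → Cyc M) → Cyc M
prodᶜ {M} {zero}  f = ζ^ M 0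
prodᶜ {M} {suc k} f = f zero ⊗ prodᶜ (f ∘ suc)

-- Equality of the represented complex numbers Σ a_k ζ^k = Σ b_k ζ^k.
-- For N prime the kernel of Z ↦ ζ_N on ℚ[Z]/(Z^N-1) is spanned by
-- 1 + Z + … + Z^{N-1}, so equality holds iff a - b is a constant vector.
_≈ᶜ_ : ∀ {M} → Cyc M → Cyc M → Set
a ≈ᶜ b = Σ ℚ λ c → ∀ i → (a i - b i) ≡ c

θ : ∀ n → ℕ → Cyc (2 ℕ.* n)
θ n m = ζ^ (2 ℕ.* n) 0 ⊖ ζ^ (2 ℕ.* n) m

-- ∏_{m=1}^{2n} ( x + Σ_{j=1}^{2n-1} θ_m^j y_j ),  y (j-1) = y_j
normForm : ∀ n → ℚ → (Fin (2 ℕ.* n ∸ 1) → ℚ) → Cyc (2 ℕ.* n)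
normForm n x y =
  prodᶜ {2 ℕ.* n} {2 ℕ.* n} λ m →
    ι (2 ℕ.* n) x ⊕ sumᶜ λ j → y j · (θ n (suc (toℕ m)) ^ᶜ suc (toℕ j))

-- F_a(t,x) = a t^{n-1} + Σ_{j=1}^{n-2} α̃_j t^{n-1-j} x^j + N^β x^{n-1},
-- α̃ (j-1) = α̃_j
formF : ∀ n → ℤ → (Fin (n ∸ 2) → ℤ) → ℕ → ℚ → ℚ → ℚ
formF n a α̃ β t x =
  ⟦ a ⟧ * (t ^ℚ (n ∸ 1))
  + (sumℚ (λ j → ⟦ α̃ j ⟧ * ((t ^ℚ (n ∸ 1 ∸ suc (toℕ j))) * (x ^ℚ suc (toℕ j))))
  + ⟦ ℤ.+ (suc (2 ℕ.* n) ℕ.^ β) ⟧ * (x ^ℚ (n ∸ 1)))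

formLHS : ∀ n → ℤ → (Fin (n ∸ 2) → ℤ) → ℕ → ℚ → ℚ → ℚ
formLHS n α₀ α̃ β t x =
  (t ^ℚ 2) * (formF n α₀ α̃ β t x * formF n (α₀ ℤ.+ ℤ.+ 1) α̃ β t x)

{-# OPTIONS --safe #-}
module Submission where

-- Let ζ = exp (2πi/N), θ = 1 - ζ and M = N - 1 = 2n, so that the product in the polynomial is the
-- norm of A = x + Σ θ^j y_j from ℚ(ζ) to ℚ.
--
-- Prime to N.  Let b be integral with norm u w, where u > 0 is coprime to w and to N.  The classes v
-- modulo u with b v ≡ 0 form a finite group K.  The analogous groups of the M conjugates of b all
-- have ∣K∣ elements, and by multiplicativity ∣K∣^M = u^M.  Multiplication by ζ permutes K with orbits
-- of length N, except for the fixed point 0, so u = ∣K∣ ≡ 1 (mod N).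
--
-- At N.  θ^M is N times a unit at N, so the coefficients of A can be compared with powers of θ: if
-- they are integral and N^M divides the norm of A, then N divides all of them.  By descent the norm
-- vanishes only for A = 0, and it is not divisible by N when x is an N-adic unit and the norm is
-- integral, even if the y_j have denominators.
--
-- If t = 0 the norm vanishes.  Otherwise scale t and x to coprime integers, and let F and F′ = F + τ
-- with τ = t^(n-1) be the two bracketed factors.  If N ∣ x then F ≡ α₀ τ and F′ ≡ (α₀+1) τ; so
-- N ∤ t² F F′ in all cases.  Now t², F and F′ are pairwise coprime, so that t² ≡ 1, F ≡ ±1 and
-- F′ ≡ ±1 modulo N.  Then F′² = F² + 2Fτ + τ² becomes 2Fτ ≡ -1, whose square is 4 ≡ 1: but
-- N = 2n + 1 ≥ 5.

open import Level using (0ℓ)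
open import Function using (_∘_; id)
open import Algebra.Bundles using (CommutativeRing)
import Algebra.Properties.CommutativeMonoid.Sum
import Algebra.Properties.Semiring.Sum
open import Data.Bool using (true; false; if_then_else_)
import Data.Empty as Empty
open import Data.Fin as Fin using (Fin; toℕ; zero; suc; inject₁; fromℕ)
open import Data.Fin.Permutation using (Permutation; permutation)
open import Data.Fin.Properties using (_≟_; toℕ<n; toℕ-fromℕ<; toℕ-fromℕ; toℕ-inject₁; toℕ-injective;
  suc-injective; all?; combine-remQuot; remQuot-combine; funToFin-finToFin; finToFun-funToFin; injective⇒≤)
open import Data.Integer using (ℤ; +_; -[1+_]; _+_; _*_; _-_; -_; _^_; 0ℤ; 1ℤ; ∣_∣)
open import Data.Integer.Divisibility.Signed using (_∣_; divides; _∣?_; ∣⇒∣ᵤ)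
import Data.Integer.DivMod as ℤ
import Data.Integer.Properties as ℤ
open import Data.Integer.Tactic.RingSolver using (solve-∀)
open import Data.Nat as ℕ using (ℕ; zero; suc; _≤_; _<_; _≡ᵇ_)
open import Data.Nat.Coprimality using (Coprime; coprime-Bézout; prime⇒coprime; gcd≡1⇒coprime)
import Data.Nat.Coprimality as Coprimality
import Data.Nat.Divisibility as ℕ
import Data.Nat.DivMod as ℕ
open import Data.Nat.GCD using (module Bézout; gcd; gcd[m,n]∣m; gcd[m,n]∣n; gcd[m,n]≢0)
open import Data.Nat.Induction using (<-wellFounded; Acc; acc)
open import Data.Nat.Primality using (Prime; prime⇒nonZero; ¬prime[1])
import Data.Nat.Properties as ℕ
import Data.Nat.Tactic.RingSolver as ℕSolver
open import Data.Product using (∃; ∃₂; Σ; uncurry; _×_; _,_; proj₁; proj₂)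
open import Data.Rational as ℚ using (ℚ; 0ℚ; 1ℚ; toℚᵘ)
import Data.Rational.Properties as ℚ
import Data.Rational.Solver
import Data.Rational.Unnormalised as ℚᵘ
import Data.Rational.Unnormalised.Properties as ℚᵘ
open import Data.Sum using (inj₁; inj₂)
open import Data.Unit using (⊤)
open import Relation.Binary.Bundles using (Setoid)
open import Relation.Binary.Definitions using (tri<; tri≈; tri>)
open import Relation.Binary.PropositionalEquality
  using (_≡_; _≢_; refl; sym; trans; cong; cong₂; subst; subst₂; setoid; _≗_; module ≡-Reasoning)
import Relation.Binary.Reasoning.Setoid
open import Relation.Nullary using (¬_; Dec; yes; no; contradiction; map′; ¬?; _×-dec_)
open import Relation.Unary using (Decidable)
open import Defs hiding (θ)

-- Congruence and coprimality in ℤ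

-- Classically, the congruence to 1 modulo N holds because every residue field of ℤ[ζ] away from N
-- contains N distinct N-th roots of unity. No ideals or residue fields are used here: K plays the
-- part of the ideal generated by b and u, and counting that of its norm. K is formed inside the
-- group ring elements of coefficient sum zero. On these the multiples of 1 + Z + ... + Z^(N-1) act
-- as zero, so relations valid in ℤ[ζ] become equalities of integer vectors, and M free coordinates
-- remain, which gives u^M classes. Coprimality of u and w makes the kernel sizes multiply: w is
-- invertible modulo u, so every class killed by one factor is a multiple of the product of the
-- others.
--
-- Denominators are the recurring obstacle. Only t and x can be made coprime integers; clearing the
-- y_j multiplies the norm by d^M, and d may share primes with u and with N. Away from N this is
-- repaired by Fermat's d^M ≡ 1, at N by dividing all coefficients by N.

infix 4 _≋_[_]

-- The quotient is kept as data because later constructions use it as a value: kernel elements are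
-- divided by u, coefficients by N.
record _≋_[_] (a b m : ℤ) : Set where
  constructor _,_
  field
    quotient : ℤ
    equality : a ≡ b + quotient * m

module _ {m : ℤ} where

  ≡⇒≋ : ∀ {a b} → a ≡ b → a ≋ b [ m ]
  ≡⇒≋ {a} refl = 0ℤ , lem a m
    where
    lem : ∀ a m → a ≡ a + 0ℤ * m
    lem = solve-∀

  ≋-refl : ∀ a → a ≋ a [ m ]
  ≋-refl _ = ≡⇒≋ refl

  ≋-sym : ∀ {a b} → a ≋ b [ m ] → b ≋ a [ m ]
  ≋-sym {b = b} (q , refl) = - q , lem b q m
    where
    lem : ∀ b q m → b ≡ b + q * m + - q * m
    lem = solve-∀

  ≋-trans : ∀ {a b c} → a ≋ b [ m ] → b ≋ c [ m ] → a ≋ c [ m ]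
  ≋-trans {c = c} (q , refl) (r , refl) = q + r , lem c q r m
    where
    lem : ∀ c q r m → c + r * m + q * m ≡ c + (q + r) * m
    lem = solve-∀

  +-≋ : ∀ {a b c d} → a ≋ b [ m ] → c ≋ d [ m ] → a + c ≋ b + d [ m ]
  +-≋ {b = b} {d = d} (q , refl) (r , refl) = q + r , lem b d q r m
    where
    lem : ∀ b d q r m → b + q * m + (d + r * m) ≡ b + d + (q + r) * m
    lem = solve-∀

  *-≋ : ∀ {a b c d} → a ≋ b [ m ] → c ≋ d [ m ] → a * c ≋ b * d [ m ]
  *-≋ {b = b} {d = d} (q , refl) (r , refl) = q * d + b * r + q * r * m , lem b d q r m
    where
    lem : ∀ b d q r m → (b + q * m) * (d + r * m) ≡ b * d + (q * d + b * r + q * r * m) * m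
    lem = solve-∀

  neg-≋ : ∀ {a b} → a ≋ b [ m ] → - a ≋ - b [ m ]
  neg-≋ {b = b} (q , refl) = - q , lem b q m
    where
    lem : ∀ b q m → - (b + q * m) ≡ - b + - q * m
    lem = solve-∀

  −≋ : ∀ {a b c d} → a ≋ b [ m ] → c ≋ d [ m ] → a - c ≋ b - d [ m ]
  −≋ p q = +-≋ p (neg-≋ q)

  ≋0⇒∣ : ∀ {a} → a ≋ 0ℤ [ m ] → m ∣ a
  ≋0⇒∣ (q , eq) = divides q (trans eq (ℤ.+-identityˡ _))

  ∣⇒≋0 : ∀ {a} → m ∣ a → a ≋ 0ℤ [ m ]
  ∣⇒≋0 (divides q eq) = q , trans eq (sym (ℤ.+-identityˡ _))

-- Residue classes modulo N as indices

module Index (M : ℕ) where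

  N : ℕ
  N = suc M

  opaque

    -- Indices are compared through congruences of `int`, so an identity between them reduces to a
    -- ring identity in ℤ; opacity keeps `mod` from unfolding. `k ⊝ i` repeats the index expression
    -- of `_⊗_`.
    res : ℕ → Fin N
    res a = a ℕ.mod N

    int : Fin N → ℤ
    int i = + toℕ i

    _⊝_ : Fin N → Fin N → Fin N
    k ⊝ i = (toℕ k ℕ.+ (N ℕ.∸ toℕ i)) ℕ.mod N

    mul : ℕ → Fin N → Fin N
    mul c i = (c ℕ.* toℕ i) ℕ.mod N

    int-toℕ : ∀ i → int i ≡ + toℕ i
    int-toℕ i = refl

    res-mod : ∀ a → res a ≡ a ℕ.mod N
    res-mod a = refl

    ⊝-mod : ∀ k i → k ⊝ i ≡ (toℕ k ℕ.+ (N ℕ.∸ toℕ i)) ℕ.mod N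
    ⊝-mod k i = refl

  private
    natural-cong : ∀ (i j : Fin N) k → + toℕ i ≡ + toℕ j + + k * + N → i ≡ j
    natural-cong i j k eq = toℕ-injective (begin
      toℕ i                      ≡⟨ ℕ.m<n⇒m%n≡m (toℕ<n i) ⟨
      toℕ i ℕ.% N                ≡⟨ cong (ℕ._% N) (ℤ.+-injective (trans eq (cong (λ z → + toℕ j + z) (sym (ℤ.pos-* k N))))) ⟩
      (toℕ j ℕ.+ k ℕ.* N) ℕ.% N  ≡⟨ ℕ.[m+kn]%n≡m%n (toℕ j) k N ⟩
      toℕ j ℕ.% N                ≡⟨ ℕ.m<n⇒m%n≡m (toℕ<n j) ⟩
      toℕ j                      ∎)
      where open ≡-Reasoning

  opaque
    unfolding int

    int-injective : ∀ {i j} → int i ≋ int j [ + N ] → i ≡ j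
    int-injective {i} {j} (+ k , eq) = natural-cong i j k eq
    int-injective {i} {j} (-[1+ k ] , eq) = sym (natural-cong j i (suc k) (trans (lem (int j) -[1+ k ] (+ N)) (cong (_+ _) (sym eq))))
      where
      lem : ∀ b q m → b ≡ b + q * m + - q * m
      lem = solve-∀

    res-≋ : ∀ a → int (res a) ≋ + a [ + N ]
    res-≋ a = ≋-sym (+ (a ℕ./ N) , (begin
      + a                                         ≡⟨ cong +_ (ℕ.m≡m%n+[m/n]*n a N) ⟩
      + (a ℕ.% N) + + (a ℕ./ N ℕ.* N)             ≡⟨ cong₂ (λ x y → + x + y) (sym (toℕ-fromℕ< (ℕ.m%n<n a N))) (ℤ.pos-* (a ℕ./ N) N) ⟩
      int (res a) + + (a ℕ./ N) * + N             ∎))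
      where open ≡-Reasoning

    res-int : ∀ i → res (toℕ i) ≡ i
    res-int i = int-injective (res-≋ (toℕ i))

    ⊝-≋ : ∀ k i → int (k ⊝ i) ≋ int k - int i [ + N ]
    ⊝-≋ k i = ≋-trans (res-≋ _) (1ℤ , (begin
      + toℕ k + + (N ℕ.∸ toℕ i)       ≡⟨ cong (λ z → + toℕ k + z) (sym (ℤ.⊖-≥ (ℕ.<⇒≤ (toℕ<n i)))) ⟩
      + toℕ k + (N Data.Integer.⊖ toℕ i)           ≡⟨ cong (λ z → + toℕ k + z) (sym (ℤ.m-n≡m⊖n N (toℕ i))) ⟩
      int k + (+ N - int i)           ≡⟨ lem (int k) (int i) (+ N) ⟩
      int k - int i + 1ℤ * + N        ∎))
      where
      open ≡-Reasoning
      lem : ∀ k i m → k + (m - i) ≡ k - i + 1ℤ * m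
      lem = solve-∀

    mul-≋ : ∀ c i → int (mul c i) ≋ + c * int i [ + N ]
    mul-≋ c i = ≋-trans (res-≋ _) (≡⇒≋ (ℤ.pos-* c (toℕ i)))

-- Comaximal pairs of integers

infix 4 _⊥_

-- The Bézout form applies to signed integers and turns the closure properties below into polynomial
-- identities.
_⊥_ : ℤ → ℤ → Set
a ⊥ b = ∃₂ λ x y → x * a + y * b ≡ 1ℤ

⊥-sym : ∀ {a b} → a ⊥ b → b ⊥ a
⊥-sym (x , y , eq) = y , x , trans (ℤ.+-comm (y * _) (x * _)) eq

⊥-* : ∀ {a b c} → a ⊥ c → b ⊥ c → a * b ⊥ c
⊥-* {a} {b} {c} (x , y , p) (x′ , y′ , q) =
  x * x′ , y * (x′ * b + y′ * c) + x * a * y′ , trans (lem x y a b c x′ y′) (cong₂ _*_ p q)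
  where
  lem : ∀ x y a b c x′ y′ → x * x′ * (a * b) + (y * (x′ * b + y′ * c) + x * a * y′) * c ≡ (x * a + y * c) * (x′ * b + y′ * c)
  lem = solve-∀

⊥-*ʳ : ∀ {a b c} → c ⊥ a → c ⊥ b → c ⊥ a * b
⊥-*ʳ p q = ⊥-sym (⊥-* (⊥-sym p) (⊥-sym q))

⊥-1 : ∀ c → 1ℤ ⊥ c
⊥-1 c = 1ℤ , 0ℤ , lem c
  where
  lem : ∀ c → 1ℤ * 1ℤ + 0ℤ * c ≡ 1ℤ
  lem = solve-∀

⊥-neg : ∀ {a b} → a ⊥ b → - a ⊥ b
⊥-neg {a} {b} (x , y , p) = - x , y , trans (lem x y a b) p
  where
  lem : ∀ x y a b → - x * (- a) + y * b ≡ x * a + y * b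
  lem = solve-∀

⊥-≋ : ∀ {a b m} → a ≋ b [ m ] → b ⊥ m → a ⊥ m
⊥-≋ {b = b} {m} (q , refl) (x , y , p) = x , y - x * q , trans (lem b q m x y) p
  where
  lem : ∀ b q m x y → x * (b + q * m) + (y - x * q) * m ≡ x * b + y * m
  lem = solve-∀

⊥-divisor : ∀ {a b c} → a ⊥ b → b * c ≋ 0ℤ [ a ] → c ≋ 0ℤ [ a ]
⊥-divisor {a} {b} {c} (x , y , p) h = ≋-trans (≡⇒≋ (trans (sym (ℤ.*-identityˡ c)) (trans (cong (_* c) (sym p)) (lem x y a b c))))
  (≋-trans (+-≋ (≋-refl (x * c * a)) (*-≋ (≋-refl y) h)) (x * c , lem′ x y a c))
  where
  lem : ∀ x y a b c → (x * a + y * b) * c ≡ x * c * a + y * (b * c)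
  lem = solve-∀
  lem′ : ∀ x y a c → x * c * a + y * 0ℤ ≡ 0ℤ + x * c * a
  lem′ = solve-∀

⊥-inverse : ∀ {a m} → a ⊥ m → ∃ λ a′ → a′ * a ≋ 1ℤ [ m ]
⊥-inverse {a} {m} (x , y , p) = x , - y , trans (lem (x * a) y m) (cong (_+ - y * m) p)
  where
  lem : ∀ z y m → z ≡ z + y * m + - y * m
  lem = solve-∀

private
  bézout : ∀ x y m n → 1 ℕ.+ y ℕ.* n ≡ x ℕ.* m → + x * + m ≡ 1ℤ + + y * + n
  bézout x y m n eq = begin
    + x * + m          ≡⟨ ℤ.pos-* x m ⟨
    + (x ℕ.* m)        ≡⟨ cong +_ eq ⟨
    1ℤ + + (y ℕ.* n)   ≡⟨ cong (λ z → 1ℤ + z) (ℤ.pos-* y n) ⟩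
    1ℤ + + y * + n     ∎
    where open ≡-Reasoning

coprime⇒⊥ : ∀ {m n} → Coprime m n → + m ⊥ + n
coprime⇒⊥ {m} {n} c with coprime-Bézout c
... | Bézout.+- x y eq = + x , - + y , trans (cong (_+ - + y * + n) (bézout x y m n eq)) (lem (+ y) (+ n))
  where
  lem : ∀ y n → 1ℤ + y * n + - y * n ≡ 1ℤ
  lem = solve-∀
... | Bézout.-+ x y eq = - + x , + y , trans (cong (λ z → - + x * + m + z) (bézout y x n m eq)) (lem (+ x) (+ m))
  where
  lem : ∀ x m → - x * m + (1ℤ + x * m) ≡ 1ℤ
  lem = solve-∀

-- Finite sums and the Kronecker delta

open Algebra.Properties.Semiring.Sum ℤ.+-*-semiring
  using (sum; ∑-distrib-+; ∑-comm; sum-permute; *-distribˡ-sum; *-distribʳ-sum; sum-cong-≗; sum-replicate-zero)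

-- The Boolean test is that of `ζ^`, so the comparison with ℚ is a case split on one Boolean.
δ : ∀ {n} → Fin n → Fin n → ℤ
δ k i = if toℕ i ≡ᵇ toℕ k then 1ℤ else 0ℤ

sum-zero : ∀ {n} {f : Fin n → ℤ} → (∀ i → f i ≡ 0ℤ) → sum f ≡ 0ℤ
sum-zero {n} h = trans (sum-cong-≗ h) (sum-replicate-zero n)

sum-δ : ∀ {n} (k : Fin n) (f : Fin n → ℤ) → sum (λ i → δ k i * f i) ≡ f k
sum-δ zero f = trans (cong (λ z → 1ℤ * f zero + z) (sum-zero λ i → ℤ.*-zeroˡ (f (suc i))))
                     (trans (ℤ.+-identityʳ (1ℤ * f zero)) (ℤ.*-identityˡ (f zero)))
sum-δ (suc k) f = trans (cong (_+ sum (λ i → δ k i * f (suc i))) (ℤ.*-zeroˡ (f zero)))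
                        (trans (ℤ.+-identityˡ _) (sum-δ k (f ∘ suc)))

δ-diagonal : ∀ {n} (k : Fin n) → δ k k ≡ 1ℤ
δ-diagonal zero = refl
δ-diagonal (suc k) = δ-diagonal k

δ-off : ∀ {n} (k i : Fin n) → i ≢ k → δ k i ≡ 0ℤ
δ-off zero    zero    i≢k = contradiction refl i≢k
δ-off zero    (suc i) i≢k = refl
δ-off (suc k) zero    i≢k = refl
δ-off (suc k) (suc i) i≢k = δ-off k i (i≢k ∘ cong suc)

δ-cong : ∀ {m n} (k i : Fin m) (l j : Fin n) → (i ≡ k → j ≡ l) → (j ≡ l → i ≡ k) → δ k i ≡ δ l j
δ-cong k i l j p q with i ≟ k
... | yes refl = trans (δ-diagonal k) (sym (trans (cong (δ l) (p refl)) (δ-diagonal l)))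
... | no i≢k   = trans (δ-off k i i≢k) (sym (δ-off l j (i≢k ∘ q)))

-- The group ring of ℤ/N, N = M + 1

module GroupRing (M : ℕ) where
  open Index M public

  infixl 6 _⊞_
  infixl 7 _⊛_ _•_
  infix 8 ⊟_
  infix 4 _≈_

  ZG : Set
  ZG = Fin N → ℤ

  𝟘 : ZG
  𝟘 _ = 0ℤ

  Z^ : ℕ → ZG
  Z^ k = δ (res k)

  𝟙 : ZG
  𝟙 = Z^ 0

  _⊞_ : ZG → ZG → ZG
  (a ⊞ b) i = a i + b i

  opaque

    _⊛_ : ZG → ZG → ZG
    (a ⊛ b) k = sum λ i → a i * b (k ⊝ i)

    ⊛-def : ∀ a b k → (a ⊛ b) k ≡ sum λ i → a i * b (k ⊝ i)
    ⊛-def a b k = refl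

    -- The augmentation Z ↦ 1, multiplicative by `ε-⊛`.
    ε : ZG → ℤ
    ε = sum

    ε-def : ∀ a → ε a ≡ sum a
    ε-def a = refl

  ⊟_ : ZG → ZG
  (⊟ a) i = - a i

  _•_ : ℤ → ZG → ZG
  (c • a) i = c * a i

  -- Reindexing a convolution by this involution exchanges its factors; `translate` plays the same
  -- role for associativity.
  reflect : Fin N → Permutation N N
  reflect k = permutation (k ⊝_) (k ⊝_) inv inv
    where
    lem : ∀ a b → a - (a - b) ≡ b
    lem = solve-∀
    inv : ∀ i → k ⊝ (k ⊝ i) ≡ i
    inv i = int-injective (≋-trans (⊝-≋ k (k ⊝ i)) (≋-trans (−≋ (≋-refl (int k)) (⊝-≋ k i)) (≡⇒≋ (lem (int k) (int i)))))

  translate : Fin N → Permutation N N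
  translate i = permutation (_⊝ i) (λ j → res (toℕ j ℕ.+ toℕ i))
    (λ j → int-injective (≋-trans (⊝-≋ (res (toℕ j ℕ.+ toℕ i)) i) (≋-trans (−≋ (sum-≋ j) (≋-refl (int i))) (≡⇒≋ (lem₁ (int j) (int i))))))
    (λ j → int-injective (≋-trans (sum-≋ (j ⊝ i)) (≋-trans (+-≋ (⊝-≋ j i) (≋-refl (int i))) (≡⇒≋ (lem₂ (int j) (int i))))))
    where
    lem₁ : ∀ a b → a + b - b ≡ a
    lem₁ = solve-∀
    lem₂ : ∀ a b → a - b + b ≡ a
    lem₂ = solve-∀
    sum-≋ : ∀ j → int (res (toℕ j ℕ.+ toℕ i)) ≋ int j + int i [ + N ]
    sum-≋ j = ≋-trans (res-≋ (toℕ j ℕ.+ toℕ i)) (≡⇒≋ (sym (cong₂ _+_ (int-toℕ j) (int-toℕ i))))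

  ⊝-cancel : ∀ k i j → (k ⊝ i) ⊝ (j ⊝ i) ≡ k ⊝ j
  ⊝-cancel k i j = int-injective (≋-trans (⊝-≋ (k ⊝ i) (j ⊝ i)) (≋-trans (−≋ (⊝-≋ k i) (⊝-≋ j i))
    (≋-trans (≡⇒≋ (lem (int k) (int i) (int j))) (≋-sym (⊝-≋ k j)))))
    where
    lem : ∀ k i j → (k - i) - (j - i) ≡ k - j
    lem = solve-∀

  opaque
    unfolding _⊛_ ε

    ⊛-cong : ∀ {a b c d} → a ≗ b → c ≗ d → a ⊛ c ≗ b ⊛ d
    ⊛-cong p q k = sum-cong-≗ λ i → cong₂ _*_ (p i) (q (k ⊝ i))

    ⊛-comm : ∀ a b → a ⊛ b ≗ b ⊛ a
    ⊛-comm a b k = begin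
      sum (λ i → a i * b (k ⊝ i))                 ≡⟨ sum-permute (λ i → a i * b (k ⊝ i)) (reflect k) ⟩
      sum (λ i → a (k ⊝ i) * b (k ⊝ (k ⊝ i)))     ≡⟨ sum-cong-≗ (λ i → trans (cong (λ j → a (k ⊝ i) * b j) (Data.Fin.Permutation.inverseʳ (reflect k))) (ℤ.*-comm (a (k ⊝ i)) (b i))) ⟩
      sum (λ i → b i * a (k ⊝ i))                 ∎
      where open ≡-Reasoning

    ⊛-assoc : ∀ a b c → (a ⊛ b) ⊛ c ≗ a ⊛ (b ⊛ c)
    ⊛-assoc a b c k = begin
      sum (λ j → sum (λ i → a i * b (j ⊝ i)) * c (k ⊝ j))
        ≡⟨ sum-cong-≗ (λ j → *-distribʳ-sum (c (k ⊝ j)) (λ i → a i * b (j ⊝ i))) ⟩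
      sum (λ j → sum (λ i → a i * b (j ⊝ i) * c (k ⊝ j)))
        ≡⟨ ∑-comm (λ j i → a i * b (j ⊝ i) * c (k ⊝ j)) ⟩
      sum (λ i → sum (λ j → a i * b (j ⊝ i) * c (k ⊝ j)))
        ≡⟨ sum-cong-≗ (λ i → sum-cong-≗ (λ j → trans (ℤ.*-assoc (a i) (b (j ⊝ i)) (c (k ⊝ j)))
             (cong (λ l → a i * (b (j ⊝ i) * c l)) (sym (⊝-cancel k i j))))) ⟩
      sum (λ i → sum (λ j → a i * (b (j ⊝ i) * c ((k ⊝ i) ⊝ (j ⊝ i)))))
        ≡⟨ sum-cong-≗ (λ i → sym (*-distribˡ-sum (a i) (λ j → b (j ⊝ i) * c ((k ⊝ i) ⊝ (j ⊝ i))))) ⟩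
      sum (λ i → a i * sum (λ j → b (j ⊝ i) * c ((k ⊝ i) ⊝ (j ⊝ i))))
        ≡⟨ sum-cong-≗ (λ i → cong (a i *_) (sym (sum-permute (λ l → b l * c ((k ⊝ i) ⊝ l)) (translate i)))) ⟩
      sum (λ i → a i * sum (λ l → b l * c ((k ⊝ i) ⊝ l))) ∎
      where open ≡-Reasoning

    ⊛-distribˡ : ∀ a b c → a ⊛ (b ⊞ c) ≗ (a ⊛ b) ⊞ (a ⊛ c)
    ⊛-distribˡ a b c k = trans (sum-cong-≗ (λ i → ℤ.*-distribˡ-+ (a i) (b (k ⊝ i)) (c (k ⊝ i)))) (∑-distrib-+ (λ i → a i * b (k ⊝ i)) (λ i → a i * c (k ⊝ i)))

    Z^-⊛ : ∀ k b i → (Z^ k ⊛ b) i ≡ b (i ⊝ res k)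
    Z^-⊛ k b i = sum-δ (res k) (λ j → b (i ⊝ j))

    ⊛-identityˡ : ∀ a → 𝟙 ⊛ a ≗ a
    ⊛-identityˡ a i = trans (Z^-⊛ 0 a i) (cong a (int-injective (≋-trans (⊝-≋ i (res 0)) (≋-trans (−≋ (≋-refl (int i)) (res-≋ 0)) (≡⇒≋ (ℤ.+-identityʳ (int i)))))))

    ⊛-•ˡ : ∀ c a b → (c • a) ⊛ b ≗ c • (a ⊛ b)
    ⊛-•ˡ c a b k = trans (sum-cong-≗ (λ i → ℤ.*-assoc c (a i) (b (k ⊝ i)))) (sym (*-distribˡ-sum c (λ i → a i * b (k ⊝ i))))

    ε-⊛ : ∀ a b → ε (a ⊛ b) ≡ ε a * ε b
    ε-⊛ a b = begin
      sum (λ k → sum (λ i → a i * b (k ⊝ i)))  ≡⟨ ∑-comm (λ k i → a i * b (k ⊝ i)) ⟩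
      sum (λ i → sum (λ k → a i * b (k ⊝ i)))  ≡⟨ sum-cong-≗ (λ i → sym (*-distribˡ-sum (a i) (λ k → b (k ⊝ i)))) ⟩
      sum (λ i → a i * sum (λ k → b (k ⊝ i)))  ≡⟨ sum-cong-≗ (λ i → cong (a i *_) (sym (sum-permute b (translate i)))) ⟩
      sum (λ i → a i * sum b)                  ≡⟨ *-distribʳ-sum (sum b) a ⟨
      sum a * sum b                            ∎
      where open ≡-Reasoning

    ε-Z^ : ∀ k → ε (Z^ k) ≡ 1ℤ
    ε-Z^ k = trans (sum-cong-≗ (λ i → sym (ℤ.*-identityʳ (Z^ k i)))) (sum-δ (res k) (λ _ → 1ℤ))

  ⊛-•ʳ : ∀ c a b → a ⊛ (c • b) ≗ c • (a ⊛ b)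
  ⊛-•ʳ c a b k = trans (⊛-comm a (c • b) k) (trans (⊛-•ˡ c b a k) (cong (c *_) (⊛-comm b a k)))

  opaque
    unfolding _⊛_ ε

    ⊛-𝟘 : ∀ a → a ⊛ 𝟘 ≗ 𝟘
    ⊛-𝟘 a k = sum-zero λ i → ℤ.*-zeroʳ (a i)

    ε-⊞ : ∀ a b → ε (a ⊞ b) ≡ ε a + ε b
    ε-⊞ a b = ∑-distrib-+ a b

    ε-• : ∀ c a → ε (c • a) ≡ c * ε a
    ε-• c a = sym (*-distribˡ-sum c a)

    ε-𝟘 : ε 𝟘 ≡ 0ℤ
    ε-𝟘 = sum-zero {N} λ _ → refl

    ε-cong : ∀ {a b} → a ≗ b → ε a ≡ ε b
    ε-cong = sum-cong-≗

  -- The integral counterpart of `≈ᶜ`: constant vectors are the multiples of 1 + Z + ... + Z^(N-1),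
  -- which vanishes at ζ.
  record _≈_ (a b : ZG) : Set where
    constructor _,_
    field
      constant : ℤ
      equality : ∀ i → a i ≡ b i + constant

  ≗⇒≈ : ∀ {a b} → a ≗ b → a ≈ b
  ≗⇒≈ p = 0ℤ , λ i → trans (p i) (sym (ℤ.+-identityʳ _))

  ≈-refl : ∀ {a} → a ≈ a
  ≈-refl = ≗⇒≈ λ _ → refl

  ≈-sym : ∀ {a b} → a ≈ b → b ≈ a
  ≈-sym {a} {b} (c , p) = - c , λ i → trans (lem (b i) c) (cong (_+ - c) (sym (p i)))
    where
    lem : ∀ x c → x ≡ x + c + - c
    lem = solve-∀

  ≈-trans : ∀ {a b c} → a ≈ b → b ≈ c → a ≈ c
  ≈-trans {c = z} (c , p) (d , q) = d + c , λ i → trans (p i) (trans (cong (_+ c) (q i)) (ℤ.+-assoc (z i) d c))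

  ⊞-≈ : ∀ {a b c d} → a ≈ b → c ≈ d → a ⊞ c ≈ b ⊞ d
  ⊞-≈ {b = b} {d = d} (x , p) (y , q) = x + y , λ i → trans (cong₂ _+_ (p i) (q i)) (lem (b i) (d i) x y)
    where
    lem : ∀ b d x y → b + x + (d + y) ≡ b + d + (x + y)
    lem = solve-∀

  ⊟-≈ : ∀ {a b} → a ≈ b → ⊟ a ≈ ⊟ b
  ⊟-≈ {b = b} (x , p) = - x , λ i → trans (cong -_ (p i)) (ℤ.neg-distrib-+ (b i) x)

  opaque
    unfolding _⊛_ ε

    -- Multiplication by Z fixes 1 + Z + ... + Z^(N-1), so c acts on this sum as the scalar `ε c`.
    ⊛-constant : ∀ {a b x} c → (∀ i → a i ≡ b i + x) → ∀ k → (a ⊛ c) k ≡ (b ⊛ c) k + x * ε c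
    ⊛-constant {a} {b} {x} c p k = begin
      sum (λ i → a i * c (k ⊝ i))                        ≡⟨ sum-cong-≗ (λ i → trans (cong (_* c (k ⊝ i)) (p i)) (ℤ.*-distribʳ-+ (c (k ⊝ i)) (b i) x)) ⟩
      sum (λ i → b i * c (k ⊝ i) + x * c (k ⊝ i))        ≡⟨ ∑-distrib-+ (λ i → b i * c (k ⊝ i)) (λ i → x * c (k ⊝ i)) ⟩
      (b ⊛ c) k + sum (λ i → x * c (k ⊝ i))              ≡⟨ cong (λ z → (b ⊛ c) k + z) (sym (*-distribˡ-sum x (λ i → c (k ⊝ i)))) ⟩
      (b ⊛ c) k + x * sum (λ i → c (k ⊝ i))              ≡⟨ cong (λ z → (b ⊛ c) k + x * z) (sym (sum-permute c (reflect k))) ⟩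
      (b ⊛ c) k + x * ε c                                ∎
      where open ≡-Reasoning

  ⊛-≈ˡ : ∀ {a b} c → a ≈ b → a ⊛ c ≈ b ⊛ c
  ⊛-≈ˡ c (x , p) = x * ε c , ⊛-constant c p

  -- The sum 1 + Z + ... + Z^(N-1) kills v when `ε v` is 0. Hence ℤ[ζ] acts on such vectors with
  -- honest equality, and this is why kernels are formed among them.
  ≈-⊛-traceless : ∀ {a b v} → a ≈ b → ε v ≡ 0ℤ → a ⊛ v ≗ b ⊛ v
  ≈-⊛-traceless {a} {b} {v} (x , p) h k = trans (⊛-constant v p k)
    (trans (cong (λ z → (b ⊛ v) k + x * z) h) (trans (cong (λ z → (b ⊛ v) k + z) (ℤ.*-zeroʳ x)) (ℤ.+-identityʳ _)))

  ⊛-≈ : ∀ {a b c d} → a ≈ b → c ≈ d → a ⊛ c ≈ b ⊛ d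
  ⊛-≈ {a} {b} {c} {d} p q = ≈-trans (⊛-≈ˡ c p)
    (≈-trans (≗⇒≈ (⊛-comm b c)) (≈-trans (⊛-≈ˡ b q) (≗⇒≈ (⊛-comm d b))))

  -- ℤ[ζ_N] for N prime: the group ring modulo the multiples of 1 + Z + … + Z^(N-1).
  cyclotomicRing : CommutativeRing 0ℓ 0ℓ
  cyclotomicRing = record
    { Carrier = ZG ; _≈_ = _≈_ ; _+_ = _⊞_ ; _*_ = _⊛_ ; -_ = ⊟_ ; 0# = 𝟘 ; 1# = 𝟙
    ; isCommutativeRing = record
      { isRing = record
        { +-isAbelianGroup = record
          { isGroup = record
            { isMonoid = record
              { isSemigroup = record
                { isMagma = record
                  { isEquivalence = record { refl = ≈-refl ; sym = ≈-sym ; trans = ≈-trans }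
                  ; ∙-cong = ⊞-≈
                  }
                ; assoc = λ a b c → ≗⇒≈ λ i → ℤ.+-assoc (a i) (b i) (c i)
                }
              ; identity = (λ a → ≗⇒≈ λ i → ℤ.+-identityˡ (a i)) , (λ a → ≗⇒≈ λ i → ℤ.+-identityʳ (a i))
              }
            ; inverse = (λ a → ≗⇒≈ λ i → ℤ.+-inverseˡ (a i)) , (λ a → ≗⇒≈ λ i → ℤ.+-inverseʳ (a i))
            ; ⁻¹-cong = ⊟-≈
            }
          ; comm = λ a b → ≗⇒≈ λ i → ℤ.+-comm (a i) (b i)
          }
        ; *-cong = ⊛-≈
        ; *-assoc = λ a b c → ≗⇒≈ (⊛-assoc a b c)
        ; *-identity = (λ a → ≗⇒≈ (⊛-identityˡ a)) , λ a → ≗⇒≈ λ i → trans (⊛-comm a 𝟙 i) (⊛-identityˡ a i)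
        ; distrib = (λ a b c → ≗⇒≈ (⊛-distribˡ a b c)) , λ a b c → ≗⇒≈ λ i →
            trans (⊛-comm (b ⊞ c) a i) (trans (⊛-distribˡ a b c i) (cong₂ _+_ (⊛-comm a b i) (⊛-comm a c i)))
        }
      ; *-comm = λ a b → ≗⇒≈ (⊛-comm a b)
      }
    }

  -- τ c is the automorphism induced by Z ↦ Z^(1/c).
  τ : ℕ → ZG → ZG
  τ c a i = a (mul c i)

  module Galois {c c′ : ℕ} (inverse : + c * + c′ ≋ 1ℤ [ + N ]) where

    private
      mul-mul : ∀ {c c′} → + c * + c′ ≋ 1ℤ [ + N ] → ∀ i → mul c (mul c′ i) ≡ i
      mul-mul {c} {c′} h i = int-injective (≋-trans (mul-≋ c (mul c′ i)) (≋-trans (*-≋ (≋-refl (+ c)) (mul-≋ c′ i))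
        (≋-trans (≡⇒≋ (sym (ℤ.*-assoc (+ c) (+ c′) (int i)))) (≋-trans (*-≋ h (≋-refl (int i))) (≡⇒≋ (ℤ.*-identityˡ (int i)))))))

    inverse′ : + c′ * + c ≋ 1ℤ [ + N ]
    inverse′ = ≋-trans (≡⇒≋ (ℤ.*-comm (+ c′) (+ c))) inverse

    mul-inverse : ∀ i → mul c (mul c′ i) ≡ i
    mul-inverse = mul-mul {c} {c′} inverse

    dilate : Permutation N N
    dilate = permutation (mul c) (mul c′) mul-inverse (mul-mul {c′} {c} inverse′)

    opaque
      unfolding _⊛_ ε

      τ-⊛ : ∀ a b → τ c (a ⊛ b) ≗ τ c a ⊛ τ c b
      τ-⊛ a b i = trans (sum-permute (λ j → a j * b (mul c i ⊝ j)) dilate)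
        (sum-cong-≗ λ j → cong (λ l → a (mul c j) * b l) (int-injective (lem j)))
        where
        lem₁ : ∀ c i j → c * i - c * j ≡ c * (i - j)
        lem₁ = solve-∀
        lem : ∀ j → int (mul c i ⊝ mul c j) ≋ int (mul c (i ⊝ j)) [ + N ]
        lem j = ≋-trans (⊝-≋ (mul c i) (mul c j)) (≋-trans (−≋ (mul-≋ c i) (mul-≋ c j)) (≋-trans (≡⇒≋ (lem₁ (+ c) (int i) (int j)))
          (≋-sym (≋-trans (mul-≋ c (i ⊝ j)) (*-≋ (≋-refl (+ c)) (⊝-≋ i j))))))

      ε-τ : ∀ a → ε (τ c a) ≡ ε a
      ε-τ a = sym (sum-permute a dilate)

    τ-τ : ∀ a → τ c′ (τ c a) ≗ a
    τ-τ a i = cong a (mul-inverse i)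

    -- The coefficient of `τ c a` at i is that of a at c i, so the basis vector at k moves to the
    -- solution i = c′ k of c i = k.
    τ-Z^ : ∀ k → τ c (Z^ k) ≗ Z^ (c′ ℕ.* k)
    τ-Z^ k i = δ-cong (res k) (mul c i) (res (c′ ℕ.* k)) i
      (λ p → int-injective (≋-trans (≋-sym (i≋ p)) (≋-sym (≋-trans (res-≋ (c′ ℕ.* k)) (≡⇒≋ (ℤ.pos-* c′ k))))))
      (λ { refl → int-injective (≋-trans (mul-≋ c (res (c′ ℕ.* k))) (≋-trans (*-≋ (≋-refl (+ c)) (≋-trans (res-≋ (c′ ℕ.* k)) (≡⇒≋ (ℤ.pos-* c′ k))))
         (≋-trans (≡⇒≋ (sym (ℤ.*-assoc (+ c) (+ c′) (+ k)))) (≋-trans (*-≋ inverse (≋-refl (+ k)))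
         (≋-trans (≡⇒≋ (ℤ.*-identityˡ (+ k))) (≋-sym (res-≋ k))))))) })
      where
      i≋ : mul c i ≡ res k → + c′ * + k ≋ int i [ + N ]
      i≋ p = ≋-trans (*-≋ (≋-refl (+ c′)) (≋-trans (≋-sym (res-≋ k)) (≋-trans (≡⇒≋ (cong int (sym p))) (mul-≋ c i))))
        (≋-trans (≡⇒≋ (sym (ℤ.*-assoc (+ c′) (+ c) (int i)))) (≋-trans (*-≋ inverse′ (≋-refl (int i))) (≡⇒≋ (ℤ.*-identityˡ (int i)))))

  τ-≈ : ∀ c {a b} → a ≈ b → τ c a ≈ τ c b
  τ-≈ c (x , p) = x , λ i → p (mul c i)

  τ-𝟙 : ∀ {c c′} → + c * + c′ ≋ 1ℤ [ + N ] → τ c 𝟙 ≗ 𝟙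
  τ-𝟙 {c} {c′} h i = trans (Galois.τ-Z^ {c} {c′} h 0 i) (cong (λ k → Z^ k i) (ℕ.*-zeroʳ c′))

-- Counting finite sets

filter : ∀ k {Q : Fin k → Set} → Decidable Q → ∃ λ l → Σ (Fin l → Fin k) λ g →
  (∀ {i j} → g i ≡ g j → i ≡ j) × (∀ i → Q (g i)) × (∀ i → Q i → ∃ λ j → g j ≡ i)
filter zero Q? = 0 , (λ ()) , (λ {}) , (λ ()) , (λ ())
filter (suc k) {Q} Q? with filter k (Q? ∘ suc) | Q? zero
... | l , g , inj , g∈ , surj | no ¬q = l , suc ∘ g , inj ∘ suc-injective , g∈ , onto
  where
  onto : ∀ i → Q i → ∃ λ j → suc (g j) ≡ i
  onto zero    q = contradiction q ¬q
  onto (suc i) q with surj i q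
  ... | j , refl = j , refl
... | l , g , inj , g∈ , surj | yes q₀ = suc l , g′ , inj′ , g′∈ , onto
  where
  g′ : Fin (suc l) → Fin (suc k)
  g′ zero    = zero
  g′ (suc i) = suc (g i)
  inj′ : ∀ {i j} → g′ i ≡ g′ j → i ≡ j
  inj′ {zero}  {zero}  _  = refl
  inj′ {suc i} {suc j} eq = cong suc (inj (suc-injective eq))
  g′∈ : ∀ i → Q (g′ i)
  g′∈ zero    = q₀
  g′∈ (suc i) = g∈ i
  onto : ∀ i → Q i → ∃ λ j → g′ j ≡ i
  onto zero    _ = zero , refl
  onto (suc i) q with surj i q
  ... | j , refl = suc j , refl

module _ (S : Setoid 0ℓ 0ℓ) where
  open Setoid S using () renaming (Carrier to X; _≈_ to _~_; sym to ~-sym; trans to ~-trans)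

  -- Classes are counted by representatives: in the application X consists of integer vectors and
  -- `~` is congruence modulo u, so no quotient type is formed.
  record Enumeration (P : X → Set) (k : ℕ) : Set where
    field
      enum       : Fin k → X
      enum∈      : ∀ i → P (enum i)
      injective  : ∀ {i j} → enum i ~ enum j → i ≡ j
      index      : ∀ x → P x → Fin k
      enum-index : ∀ x px → enum (index x px) ~ x

  open Enumeration

  module _ {P : X → Set} where

    private
      size-≤ : ∀ {k l} → Enumeration P k → Enumeration P l → k ≤ l
      size-≤ E F = injective⇒≤ {f = λ i → index F (enum E i) (enum∈ E i)} λ {i} {j} eq →
        injective E (~-trans (~-sym (enum-index F _ _)) (subst (λ z → enum F z ~ enum E j) (sym eq) (enum-index F _ _)))

    size-unique : ∀ {k l} → Enumeration P k → Enumeration P l → k ≡ l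
    size-unique E F = ℕ.≤-antisym (size-≤ E F) (size-≤ F E)

    enumerate-subset : ∀ {k} {Q : X → Set} → Decidable Q → (∀ {x y} → x ~ y → Q x → Q y) →
      Enumeration P k → ∃ (Enumeration λ x → P x × Q x)
    enumerate-subset {k} Q? resp E with filter k (Q? ∘ enum E)
    ... | l , g , inj , g∈ , surj = l , record
      { enum       = enum E ∘ g
      ; enum∈      = λ i → enum∈ E (g i) , g∈ i
      ; injective  = inj ∘ injective E
      ; index      = λ x (px , qx) → proj₁ (onto x px qx)
      ; enum-index = λ x (px , qx) → subst (λ i → enum E i ~ x) (sym (proj₂ (onto x px qx))) (enum-index E x px)
      }
      where
      onto : ∀ x px → _ → ∃ λ j → g j ≡ index E x px
      onto x px qx = surj (index E x px) (resp (~-sym (enum-index E x px)) qx)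

argmin : ∀ {n} (h : Fin (suc n) → ℕ) → ∃ λ m → ∀ i → h m ≤ h i
argmin {zero}  h = zero , λ { zero → ℕ.≤-refl }
argmin {suc n} h with argmin (h ∘ suc)
... | m , min with ℕ.≤-total (h zero) (h (suc m))
...   | inj₁ h₀≤ = zero , λ { zero → ℕ.≤-refl ; (suc i) → ℕ.≤-trans h₀≤ (min i) }
...   | inj₂ ≤h₀ = suc m , λ { zero → ≤h₀ ; (suc i) → min i }

module _ {A : Set} (f : A → A) where

  iter : ℕ → A → A
  iter zero    x = x
  iter (suc n) x = f (iter n x)

  iter-+ : ∀ m n x → iter (m ℕ.+ n) x ≡ iter m (iter n x)
  iter-+ zero    n x = refl
  iter-+ (suc m) n x = cong f (iter-+ m n x)

  iter-fixed : ∀ {x} → f x ≡ x → ∀ n → iter n x ≡ x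
  iter-fixed fx zero    = refl
  iter-fixed fx (suc n) = trans (cong f (iter-fixed fx n)) fx

  iter-* : ∀ {d x} → iter d x ≡ x → ∀ k → iter (k ℕ.* d) x ≡ x
  iter-* {d} {x} fx zero    = refl
  iter-* {d} {x} fx (suc k) = trans (iter-+ d (k ℕ.* d) x) (trans (cong (iter d) (iter-* fx k)) fx)

  -- By Bézout some multiple of one period is 1 plus a multiple of the other; iterating that often
  -- gives both x and f x.
  coprime-periods : ∀ {m n x} → Coprime m n → iter m x ≡ x → iter n x ≡ x → f x ≡ x
  coprime-periods {m} {n} {x} c fm fn with coprime-Bézout c
  ... | Bézout.+- a b eq = trans (cong f (sym (iter-* fn b))) (trans (cong (λ k → iter k x) eq) (iter-* fm a))
  ... | Bézout.-+ a b eq = trans (cong f (sym (iter-* fm a))) (trans (cong (λ k → iter k x) eq) (iter-* fn b))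

module _ {k p′ : ℕ} (f : Fin k → Fin k) where

  private
    p = suc p′

  -- Every other orbit has p points and is represented by its least point.
  unique-fixed-point⇒≡1 : Prime p → (∀ x → iter f p x ≡ x) →
    (x₀ : Fin k) → f x₀ ≡ x₀ → (∀ x → f x ≡ x → x ≡ x₀) → ∃ λ c → k ≡ suc (c ℕ.* p)
  unique-fixed-point⇒≡1 p-prime period x₀ fx₀ unique
    with filter k {λ x → x ≢ x₀ × ∀ (i : Fin p) → toℕ x ≤ toℕ (iter f (toℕ i) x)}
           (λ x → ¬? (x ≟ x₀) ×-dec all? (λ i → toℕ x ℕ.≤? toℕ (iter f (toℕ i) x)))
  ... | l , g , g-inj , g∈ , g-surj = l , size-unique (setoid (Fin k)) identity orbits
    where
    iter-% : ∀ n x → iter f n x ≡ iter f (n ℕ.% p) x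
    iter-% n x = begin
      iter f n x                                   ≡⟨ cong (λ m → iter f m x) (ℕ.m≡m%n+[m/n]*n n p) ⟩
      iter f (n ℕ.% p ℕ.+ n ℕ./ p ℕ.* p) x         ≡⟨ iter-+ f (n ℕ.% p) (n ℕ./ p ℕ.* p) x ⟩
      iter f (n ℕ.% p) (iter f (n ℕ./ p ℕ.* p) x)  ≡⟨ cong (iter f (n ℕ.% p)) (iter-* f (period x) (n ℕ./ p)) ⟩
      iter f (n ℕ.% p) x                           ∎
      where open ≡-Reasoning

    rewind : ∀ (i : Fin p) x → iter f (p ℕ.∸ toℕ i) (iter f (toℕ i) x) ≡ x
    rewind i x = trans (sym (iter-+ f (p ℕ.∸ toℕ i) (toℕ i) x))
      (trans (cong (λ m → iter f m x) (ℕ.m∸n+n≡m (ℕ.<⇒≤ (toℕ<n i)))) (period x))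

    least : ∀ j n → toℕ (g j) ≤ toℕ (iter f n (g j))
    least j n = subst (λ z → toℕ (g j) ≤ toℕ z)
      (trans (cong (λ m → iter f m (g j)) (toℕ-fromℕ< (ℕ.m%n<n n p))) (sym (iter-% n (g j))))
      (proj₂ (g∈ j) (Fin.fromℕ< (ℕ.m%n<n n p)))

    -- Rewinding shows that `g j′` is an iterate of `g j`, which is least among its iterates. By
    -- symmetry, orbits that meet have the same representative.
    same-orbit : ∀ j j′ (i i′ : Fin p) → iter f (toℕ i) (g j) ≡ iter f (toℕ i′) (g j′) → toℕ (g j) ≤ toℕ (g j′)
    same-orbit j j′ i i′ eq = subst (λ z → toℕ (g j) ≤ toℕ z)
      (trans (iter-+ f (p ℕ.∸ toℕ i′) (toℕ i) (g j)) (trans (cong (iter f (p ℕ.∸ toℕ i′)) eq) (rewind i′ (g j′))))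
      (least j (p ℕ.∸ toℕ i′ ℕ.+ toℕ i))

    -- A coincidence gives `g j` the period d = p - i′ + i with 0 < d < p. Being coprime to the
    -- period p, it makes `g j` a fixed point, hence x₀, which was excluded from the
    -- representatives.
    aperiodic : ∀ j (i i′ : Fin p) → toℕ i < toℕ i′ → iter f (toℕ i) (g j) ≢ iter f (toℕ i′) (g j)
    aperiodic j i i′ i<i′ eq = proj₁ (g∈ j) (unique (g j)
      (coprime-periods f (prime⇒coprime p-prime {{ℕ.>-nonZero 0<d}} d<p) (period (g j)) fixed))
      where
      d = p ℕ.∸ toℕ i′ ℕ.+ toℕ i
      0<d : 0 < d
      0<d = ℕ.≤-trans (ℕ.m<n⇒0<n∸m (toℕ<n i′)) (ℕ.m≤m+n _ (toℕ i))
      d<p : d < p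
      d<p = subst (d <_) (ℕ.m∸n+n≡m (ℕ.<⇒≤ (toℕ<n i′))) (ℕ.+-monoʳ-< (p ℕ.∸ toℕ i′) i<i′)
      fixed : iter f d (g j) ≡ g j
      fixed = trans (iter-+ f (p ℕ.∸ toℕ i′) (toℕ i) (g j)) (trans (cong (iter f (p ℕ.∸ toℕ i′)) eq) (rewind i′ (g j)))

    identity : Enumeration (setoid (Fin k)) (λ _ → ⊤) k
    identity = record
      { enum = id ; enum∈ = _ ; injective = id ; index = λ x _ → x ; enum-index = λ _ _ → refl }

    orbit-point : Fin l → Fin p → Fin k
    orbit-point j i = iter f (toℕ i) (g j)

    enumeration : Fin (suc (l ℕ.* p)) → Fin k
    enumeration zero    = x₀
    enumeration (suc m) = orbit-point (proj₁ (Fin.remQuot {l} p m)) (proj₂ (Fin.remQuot {l} p m))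

    x₀≢ : ∀ j i → x₀ ≢ orbit-point j i
    x₀≢ j i eq = proj₁ (g∈ j) (trans (sym (rewind i (g j)))
      (trans (cong (iter f (p ℕ.∸ toℕ i)) (sym eq)) (iter-fixed f fx₀ (p ℕ.∸ toℕ i))))

    orbit-point-injective : ∀ j i j′ i′ → orbit-point j i ≡ orbit-point j′ i′ → (j , i) ≡ (j′ , i′)
    orbit-point-injective j i j′ i′ eq
      with refl ← g-inj {j} {j′} (toℕ-injective (ℕ.≤-antisym (same-orbit j j′ i i′ eq) (same-orbit j′ j i′ i (sym eq))))
      with ℕ.<-cmp (toℕ i) (toℕ i′)
    ... | tri< i<i′ _ _ = contradiction eq (aperiodic j i i′ i<i′)
    ... | tri≈ _ i≡i′ _ = cong (j ,_) (toℕ-injective i≡i′)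
    ... | tri> _ _ i′<i = contradiction (sym eq) (aperiodic j i′ i i′<i)

    enumeration-injective : ∀ {m n} → enumeration m ≡ enumeration n → m ≡ n
    enumeration-injective {zero}  {zero}  _  = refl
    enumeration-injective {zero}  {suc n} eq = contradiction eq (x₀≢ (proj₁ (Fin.remQuot {l} p n)) (proj₂ (Fin.remQuot {l} p n)))
    enumeration-injective {suc m} {zero}  eq = contradiction (sym eq) (x₀≢ (proj₁ (Fin.remQuot {l} p m)) (proj₂ (Fin.remQuot {l} p m)))
    enumeration-injective {suc m} {suc n} eq = cong suc (begin
      m                                            ≡⟨ combine-remQuot {l} p m ⟨
      uncurry Fin.combine (Fin.remQuot {l} p m)    ≡⟨ cong (uncurry Fin.combine) (orbit-point-injective _ _ _ _ eq) ⟩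
      uncurry Fin.combine (Fin.remQuot {l} p n)    ≡⟨ combine-remQuot {l} p n ⟩
      n                                            ∎)
      where open ≡-Reasoning

    enumeration-surjective : ∀ y → ∃ λ m → enumeration m ≡ y
    enumeration-surjective y with y ≟ x₀
    ... | yes refl = zero , refl
    ... | no y≢x₀ with argmin (λ (i : Fin p) → toℕ (iter f (toℕ i) y))
    ...   | m , min with g-surj (iter f (toℕ m) y) (x≢x₀ , minimal)
      where
      x≢x₀ : iter f (toℕ m) y ≢ x₀
      x≢x₀ eq = y≢x₀ (trans (sym (rewind m y)) (trans (cong (iter f (p ℕ.∸ toℕ m)) eq) (iter-fixed f fx₀ (p ℕ.∸ toℕ m))))
      minimal : ∀ (i : Fin p) → toℕ (iter f (toℕ m) y) ≤ toℕ (iter f (toℕ i) (iter f (toℕ m) y))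
      minimal i = subst (λ z → toℕ (iter f (toℕ m) y) ≤ toℕ z)
        (trans (cong (λ n → iter f n y) (toℕ-fromℕ< (ℕ.m%n<n (toℕ i ℕ.+ toℕ m) p)))
          (trans (sym (iter-% (toℕ i ℕ.+ toℕ m) y)) (iter-+ f (toℕ i) (toℕ m) y)))
        (min (Fin.fromℕ< (ℕ.m%n<n (toℕ i ℕ.+ toℕ m) p)))
    ...     | j , gj≡ = suc (Fin.combine j i) , (begin
      orbit-point (proj₁ (Fin.remQuot {l} p (Fin.combine j i))) (proj₂ (Fin.remQuot {l} p (Fin.combine j i)))
        ≡⟨ cong₂ orbit-point (cong proj₁ (remQuot-combine {l} j i)) (cong proj₂ (remQuot-combine {l} j i)) ⟩
      iter f (toℕ i) (g j)                             ≡⟨ cong₂ (iter f) (toℕ-fromℕ< (ℕ.m%n<n (p ℕ.∸ toℕ m) p)) gj≡ ⟩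
      iter f ((p ℕ.∸ toℕ m) ℕ.% p) (iter f (toℕ m) y)  ≡⟨ iter-% (p ℕ.∸ toℕ m) _ ⟨
      iter f (p ℕ.∸ toℕ m) (iter f (toℕ m) y)          ≡⟨ rewind m y ⟩
      y                                                ∎)
      where
      open ≡-Reasoning
      i : Fin p
      i = Fin.fromℕ< (ℕ.m%n<n (p ℕ.∸ toℕ m) p)

    orbits : Enumeration (setoid (Fin k)) (λ _ → ⊤) (suc (l ℕ.* p))
    orbits = record
      { enum       = enumeration
      ; enum∈      = _
      ; injective  = enumeration-injective
      ; index      = λ y _ → proj₁ (enumeration-surjective y)
      ; enum-index = λ y _ → proj₂ (enumeration-surjective y)
      }

-- Kernels of multiplication on the trace zero part of the group ring modulo u

≋0? : ∀ m a → Dec (a ≋ 0ℤ [ m ])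
≋0? m a = map′ ∣⇒≋0 ≋0⇒∣ (m ∣? a)

sum-≋ : ∀ {m n} {f g : Fin n → ℤ} → (∀ i → f i ≋ g i [ m ]) → sum f ≋ sum g [ m ]
sum-≋ {n = zero}  p = ≋-refl 0ℤ
sum-≋ {n = suc n} p = +-≋ (p zero) (sum-≋ (p ∘ suc))

^-injectiveˡ : ∀ m {a b} .{{_ : ℕ.NonZero m}} → a ℕ.^ m ≡ b ℕ.^ m → a ≡ b
^-injectiveˡ m {a} {b} eq with ℕ.<-cmp a b
... | tri< a<b _ _ = contradiction eq (ℕ.<⇒≢ (ℕ.^-monoˡ-< m a<b))
... | tri≈ _ a≡b _ = a≡b
... | tri> _ _ b<a = contradiction (sym eq) (ℕ.<⇒≢ (ℕ.^-monoˡ-< m b<a))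

sum-const : ∀ n c → sum {n} (λ _ → c) ≡ + n * c
sum-const zero    c = sym (ℤ.*-zeroˡ c)
sum-const (suc n) c = trans (cong (λ z → c + z) (sum-const n c)) (sym (ℤ.suc-* (+ n) c))

module Kernel (M u′ : ℕ) where
  open GroupRing M
  open Enumeration

  u : ℕ
  u = suc u′

  infix 4 _~_

  record _~_ (a b : ZG) : Set where
    constructor pointwise
    field
      at : ∀ i → a i ≋ b i [ + u ]
  open _~_ public

  congruence : Setoid 0ℓ 0ℓ
  congruence = record
    { Carrier = ZG ; _≈_ = _~_
    ; isEquivalence = record
      { refl  = λ {a} → pointwise λ i → ≋-refl (a i)
      ; sym   = λ p → pointwise λ i → ≋-sym (at p i)
      ; trans = λ p q → pointwise λ i → ≋-trans (at p i) (at q i) } }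

  open Setoid congruence public using () renaming (refl to ~-refl; sym to ~-sym; trans to ~-trans)

  ≗⇒~ : ∀ {a b} → a ≗ b → a ~ b
  ≗⇒~ p = pointwise λ i → ≡⇒≋ (p i)

  ⊞-~ : ∀ {a b c d} → a ~ b → c ~ d → a ⊞ c ~ b ⊞ d
  ⊞-~ p q = pointwise λ i → +-≋ (at p i) (at q i)

  opaque
    unfolding _⊛_ ε

    ⊛-~ : ∀ a {b c} → b ~ c → a ⊛ b ~ a ⊛ c
    ⊛-~ a p = pointwise λ k → sum-≋ λ i → *-≋ (≋-refl (a i)) (at p (k ⊝ i))

  Enum : (ZG → Set) → ℕ → Set
  Enum = Enumeration congruence

  Traceless : ZG → Set
  Traceless v = ε v ≡ 0ℤ

  -- Trace zero is an exact equation and only `b ⊛ v` is reduced modulo u: exactness lets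
  -- `≈-⊛-traceless` apply to the representatives themselves.
  Ker : ZG → ZG → Set
  Ker b v = Traceless v × (b ⊛ v ~ 𝟘)

  traceless-⊛ : ∀ a {v} → Traceless v → Traceless (a ⊛ v)
  traceless-⊛ a {v} h = trans (ε-⊛ a v) (trans (cong (ε a *_) h) (ℤ.*-zeroʳ (ε a)))

  _⊟′_ : ZG → ZG → ZG
  a ⊟′ b = a ⊞ (- 1ℤ) • b

  private
    u-cancel : ∀ {x y} → + u * x ≡ + u * y → x ≡ y
    u-cancel {x} {y} = ℤ.*-cancelˡ-≡ (+ u) x y

  -- In the application C D E is the norm u w: C is the current conjugate, D the product of those
  -- still to come, E the product of those already treated, and g = w.
  module _ (C D E : ZG) (g g′ : ℤ) (unit : g′ * g ≋ 1ℤ [ + u ])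
           (factor : ∀ v → Traceless v → C ⊛ (D ⊛ (E ⊛ v)) ≗ (+ u * g) • v) where

    private
      quotient : ∀ {y} → Ker C y → ZG
      quotient (_ , p) i = _≋_[_].quotient (at p i)

      u•quotient : ∀ {y} (h : Ker C y) → C ⊛ y ≗ + u • quotient h
      u•quotient (_ , p) i = trans (_≋_[_].equality (at p i)) (trans (ℤ.+-identityˡ _) (ℤ.*-comm (_≋_[_].quotient (at p i)) (+ u)))

      quotient-traceless : ∀ {y} (h : Ker C y) → Traceless (quotient h)
      quotient-traceless {y} h@(t , _) = u-cancel (begin
        + u * ε (quotient h)    ≡⟨ ε-• (+ u) (quotient h) ⟨
        ε (+ u • quotient h)    ≡⟨ ε-cong (u•quotient h) ⟨
        ε (C ⊛ y)               ≡⟨ traceless-⊛ C {y} t ⟩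
        0ℤ                      ≡⟨ ℤ.*-zeroʳ (+ u) ⟨
        + u * 0ℤ                ∎)
        where open ≡-Reasoning

      -- A preimage of y under multiplication by D.
      lift : ∀ {y} → Ker C y → ZG
      lift h = g′ • (E ⊛ quotient h)

      swap₃ : ∀ v → D ⊛ (E ⊛ (C ⊛ v)) ≗ C ⊛ (D ⊛ (E ⊛ v))
      swap₃ v i = begin
        (D ⊛ (E ⊛ (C ⊛ v))) i    ≡⟨ ⊛-assoc D E (C ⊛ v) i ⟨
        (D ⊛ E ⊛ (C ⊛ v)) i      ≡⟨ ⊛-assoc (D ⊛ E) C v i ⟨
        (D ⊛ E ⊛ C ⊛ v) i        ≡⟨ ⊛-cong {D ⊛ E ⊛ C} {C ⊛ (D ⊛ E)} {v} {v} (⊛-comm (D ⊛ E) C) (λ _ → refl) i ⟩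
        (C ⊛ (D ⊛ E) ⊛ v) i      ≡⟨ ⊛-assoc C (D ⊛ E) v i ⟩
        (C ⊛ (D ⊛ E ⊛ v)) i      ≡⟨ ⊛-cong {C} {C} {D ⊛ E ⊛ v} {D ⊛ (E ⊛ v)} (λ _ → refl) (⊛-assoc D E v) i ⟩
        (C ⊛ (D ⊛ (E ⊛ v))) i    ∎
        where open ≡-Reasoning

      -- With C y = u q one has u D E q = D E C y = u g y. These are equalities of integer vectors,
      -- so u cancels.
      D-quotient : ∀ {y} (h : Ker C y) → D ⊛ (E ⊛ quotient h) ≗ g • y
      D-quotient {y} h i = u-cancel (begin
        + u * (D ⊛ (E ⊛ quotient h)) i    ≡⟨ ⊛-•ʳ (+ u) D (E ⊛ quotient h) i ⟨
        (D ⊛ (+ u • (E ⊛ quotient h))) i  ≡⟨ ⊛-cong {D} {D} (λ _ → refl) (λ j → sym (⊛-•ʳ (+ u) E (quotient h) j)) i ⟩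
        (D ⊛ (E ⊛ (+ u • quotient h))) i  ≡⟨ ⊛-cong {D} {D} (λ _ → refl) (⊛-cong {E} {E} (λ _ → refl) (λ j → sym (u•quotient h j))) i ⟩
        (D ⊛ (E ⊛ (C ⊛ y))) i             ≡⟨ swap₃ y i ⟩
        (C ⊛ (D ⊛ (E ⊛ y))) i             ≡⟨ factor y (proj₁ h) i ⟩
        + u * g * y i                     ≡⟨ ℤ.*-assoc (+ u) g (y i) ⟩
        + u * (g * y i)                   ∎)
        where open ≡-Reasoning

      D-lift : ∀ {y} (h : Ker C y) → D ⊛ lift h ~ y
      D-lift {y} h = pointwise λ i → ≋-trans
        (≡⇒≋ (trans (⊛-•ʳ g′ D (E ⊛ quotient h) i) (trans (cong (g′ *_) (D-quotient h i)) (sym (ℤ.*-assoc g′ g (y i))))))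
        (≋-trans (*-≋ unit (≋-refl (y i))) (≡⇒≋ (ℤ.*-identityˡ (y i))))

      lift-traceless : ∀ {y} (h : Ker C y) → Traceless (lift h)
      lift-traceless h = trans (ε-• g′ (E ⊛ quotient h))
        (trans (cong (g′ *_) (traceless-⊛ E {quotient h} (quotient-traceless h))) (ℤ.*-zeroʳ g′))

    -- Multiplication by D maps Ker (C ⊛ D) onto Ker C, with kernel Ker D.
    kernel-* : ∀ {k l} → Enum (Ker C) k → Enum (Ker D) l → Enum (Ker (C ⊛ D)) (k ℕ.* l)
    kernel-* {k} {l} F G = record
      { enum       = λ m → point (Fin.remQuot {k} l m)
      ; enum∈      = λ m → point∈ (Fin.remQuot {k} l m)
      ; injective  = λ {m} {n} eq → trans (sym (combine-remQuot {k} l m))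
          (trans (cong (uncurry Fin.combine) (point-injective _ _ eq)) (combine-remQuot {k} l n))
      ; index      = λ x h → uncurry Fin.combine (coordinates x h)
      ; enum-index = λ x h → subst (λ p → point p ~ x) (sym (uncurry (remQuot-combine {k} {l}) (coordinates x h))) (point-coordinates x h)
      }
      where
      point : Fin k × Fin l → ZG
      point (i , j) = lift {enum F i} (enum∈ F i) ⊞ enum G j

      D-point : ∀ i j → D ⊛ point (i , j) ~ enum F i
      D-point i j = ~-trans (≗⇒~ (⊛-distribˡ D (lift {enum F i} (enum∈ F i)) (enum G j)))
        (~-trans (⊞-~ (D-lift {enum F i} (enum∈ F i)) (proj₂ (enum∈ G j))) (≗⇒~ λ _ → ℤ.+-identityʳ _))

      point∈ : ∀ p → Ker (C ⊛ D) (point p)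
      point∈ (i , j) = trans (ε-⊞ (lift {enum F i} (enum∈ F i)) (enum G j)) (cong₂ _+_ (lift-traceless {enum F i} (enum∈ F i)) (proj₁ (enum∈ G j)))
                     , ~-trans (≗⇒~ (⊛-assoc C D (point (i , j)))) (~-trans (⊛-~ C (D-point i j)) (proj₂ (enum∈ F i)))

      cancel : ∀ {a b c} → a ⊞ b ~ a ⊞ c → b ~ c
      cancel {a} {b} {c} p = pointwise λ i → ≋-trans (≡⇒≋ (lem (a i) (b i)))
        (≋-trans (+-≋ (≋-refl (- a i)) (at p i)) (≡⇒≋ (sym (lem (a i) (c i)))))
        where
        lem : ∀ a b → b ≡ - a + (a + b)
        lem = solve-∀

      point-injective : ∀ p q → point p ~ point q → p ≡ q
      point-injective (i , j) (i′ , j′) eq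
        with refl ← injective F {i} {i′} (~-trans (~-sym (D-point i j)) (~-trans (⊛-~ D eq) (D-point i′ j′)))
        = cong (i ,_) (injective G (cancel {lift {enum F i} (enum∈ F i)} eq))

      module _ (x : ZG) (h : Ker (C ⊛ D) x) where

        row : Fin k
        row = index F (D ⊛ x) (traceless-⊛ D {x} (proj₁ h) , ~-trans (≗⇒~ λ i → sym (⊛-assoc C D x i)) (proj₂ h))

        base : ZG
        base = lift {enum F row} (enum∈ F row)

        remainder∈ : Ker D (x ⊟′ base)
        remainder∈ = trans (ε-⊞ x ((- 1ℤ) • base)) (cong₂ _+_ (proj₁ h) (trans (ε-• (- 1ℤ) base) (cong (- 1ℤ *_) (lift-traceless {enum F row} (enum∈ F row)))))
                   , pointwise λ i → ≋-trans (≡⇒≋ (trans (⊛-distribˡ D x ((- 1ℤ) • base) i) (cong (λ z → (D ⊛ x) i + z) (⊛-•ʳ (- 1ℤ) D base i))))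
                       (≋-trans (+-≋ (≋-refl ((D ⊛ x) i)) (*-≋ (≋-refl (- 1ℤ)) (at (~-trans (D-lift {enum F row} (enum∈ F row)) (enum-index F _ _)) i)))
                                (≡⇒≋ (lem ((D ⊛ x) i))))
          where
          lem : ∀ a → a + - 1ℤ * a ≡ 0ℤ
          lem = solve-∀

        coordinates : Fin k × Fin l
        coordinates = row , index G (x ⊟′ base) remainder∈

        point-coordinates : point coordinates ~ x
        point-coordinates = ~-trans (⊞-~ (~-refl {base}) (enum-index G _ remainder∈)) (≗⇒~ λ i → lem (base i) (x i))
          where
          lem : ∀ b x → b + (x + - 1ℤ * b) ≡ x
          lem = solve-∀

-- Sizes of the kernels

module KernelSize (M u′ : ℕ) where
  open GroupRing M
  open Kernel M u′
  open Enumeration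
  open Algebra.Properties.CommutativeMonoid.Sum (CommutativeRing.*-commutativeMonoid cyclotomicRing)
    using () renaming (sum to ∏)

  private

    residue : ℤ → Fin u
    residue z = Fin.fromℕ< (ℤ.n%ℕd<d z u)

    residue-≋ : ∀ z → + toℕ (residue z) ≋ z [ + u ]
    residue-≋ z = ≋-sym (z ℤ./ℕ u , trans (ℤ.a≡a%ℕn+[a/ℕn]*n z u)
      (cong (λ n → + n + z ℤ./ℕ u * + u) (sym (toℕ-fromℕ< (ℤ.n%ℕd<d z u)))))

    toℕ-≋-injective : ∀ {i j : Fin u} → + toℕ i ≋ + toℕ j [ + u ] → i ≡ j
    toℕ-≋-injective {i} {j} p = Index.int-injective u′
      (subst₂ _≋_[ + u ] (sym (Index.int-toℕ u′ i)) (sym (Index.int-toℕ u′ j)) p)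

    -- The coordinates after the first are free and determine the first, so the trace zero vectors
    -- form a free module of rank M.
    extend : (Fin M → ℤ) → ZG
    extend f zero    = - sum f
    extend f (suc i) = f i

    opaque
      unfolding ε

      extend-traceless : ∀ f → Traceless (extend f)
      extend-traceless f = ℤ.+-inverseˡ (sum f)

      traceless-head : ∀ {v} → Traceless v → v zero ≡ - sum (v ∘ suc)
      traceless-head {v} h = trans (lem (v zero) (sum (v ∘ suc))) (trans (cong (_+ - sum (v ∘ suc)) h) (ℤ.+-identityˡ _))
        where
        lem : ∀ a s → a ≡ a + s + - s
        lem = solve-∀

    funToFin-cong : ∀ {m n} {f g : Fin m → Fin n} → f ≗ g → Fin.funToFin f ≡ Fin.funToFin g
    funToFin-cong {zero}  p = refl
    funToFin-cong {suc m} p = cong₂ Fin.combine (p zero) (funToFin-cong (p ∘ suc))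

  enumerate-traceless : Enum Traceless (u ℕ.^ M)
  enumerate-traceless = record
    { enum       = λ m → extend (digits m)
    ; enum∈      = λ m → extend-traceless (digits m)
    ; injective  = λ {m} {n} p → trans (sym (funToFin-finToFin {M} {u} m))
        (trans (funToFin-cong (λ i → toℕ-≋-injective (at p (suc i)))) (funToFin-finToFin {M} {u} n))
    ; index      = λ v _ → Fin.funToFin (residue ∘ v ∘ suc)
    ; enum-index = λ v h → pointwise λ
        { zero    → ≋-trans (neg-≋ (sum-≋ (digits-≋ v))) (≡⇒≋ (sym (traceless-head h)))
        ; (suc i) → digits-≋ v i }
    }
    where
    digits : Fin (u ℕ.^ M) → Fin M → ℤ
    digits m i = + toℕ (Fin.finToFun {u} {M} m i)
    digits-≋ : ∀ v i → digits (Fin.funToFin (residue ∘ v ∘ suc)) i ≋ v (suc i) [ + u ]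
    digits-≋ v i = ≋-trans (≡⇒≋ (cong (+_ ∘ toℕ) (finToFun-funToFin (residue ∘ v ∘ suc) i))) (residue-≋ (v (suc i)))

  enumerate-kernel : ∀ b → ∃ (Enum (Ker b))
  enumerate-kernel b = enumerate-subset congruence
    (λ v → map′ pointwise at (all? λ i → ≋0? (+ u) ((b ⊛ v) i)))
    (λ p q → ~-trans (⊛-~ b (~-sym p)) q) enumerate-traceless

  kernel-𝟙 : Enum (Ker 𝟙) 1
  kernel-𝟙 = record
    { enum       = λ _ → 𝟘
    ; enum∈      = λ _ → ε-𝟘 , ≗⇒~ (⊛-𝟘 𝟙)
    ; injective  = λ { {zero} {zero} _ → refl }
    ; index      = λ _ _ → zero
    ; enum-index = λ v h → ~-trans (~-sym (proj₂ h)) (≗⇒~ (⊛-identityˡ v))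
    }

  -- Each induction step moves the first factor into `E`, so the whole product acts as the same
  -- scalar u g at every stage.
  kernel-∏ : ∀ {k s} (f : Fin k → ZG) (E : ZG) {g g′} → g′ * g ≋ 1ℤ [ + u ] → (∀ i → Enum (Ker (f i)) s) →
    (∀ v → Traceless v → ∏ f ⊛ (E ⊛ v) ≗ (+ u * g) • v) → Enum (Ker (∏ f)) (s ℕ.^ k)
  kernel-∏ {zero}  f E unit F factor = kernel-𝟙
  kernel-∏ {suc k} f E {g} {g′} unit F factor = kernel-* C D E g g′ unit
    (λ v h i → trans (sym (⊛-assoc C D (E ⊛ v) i)) (factor v h i)) (F zero)
    (kernel-∏ (f ∘ suc) (C ⊛ E) {g} {g′} unit (F ∘ suc) λ v h i → trans (rotate v i) (factor v h i))
    where
    C D : ZG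
    C = f zero
    D = ∏ (f ∘ suc)
    rotate : ∀ v → D ⊛ (C ⊛ E ⊛ v) ≗ C ⊛ D ⊛ (E ⊛ v)
    rotate v i = begin
      (D ⊛ (C ⊛ E ⊛ v)) i      ≡⟨ ⊛-cong {D} {D} (λ _ → refl) (⊛-assoc C E v) i ⟩
      (D ⊛ (C ⊛ (E ⊛ v))) i    ≡⟨ ⊛-assoc D C (E ⊛ v) i ⟨
      (D ⊛ C ⊛ (E ⊛ v)) i      ≡⟨ ⊛-cong {D ⊛ C} {C ⊛ D} {E ⊛ v} (⊛-comm D C) (λ _ → refl) i ⟩
      (C ⊛ D ⊛ (E ⊛ v)) i      ∎
      where open ≡-Reasoning

  -- An automorphism of the group ring that permutes coordinates preserves both the trace and
  -- congruence modulo u.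
  kernel-τ : ∀ {b s c c′} → + c * + c′ ≋ 1ℤ [ + N ] → Enum (Ker b) s → Enum (Ker (τ c b)) s
  kernel-τ {b} {s} {c} {c′} inverse F = record
    { enum       = τ c ∘ enum F
    ; enum∈      = λ i → trans (ε-τ (enum F i)) (proj₁ (enum∈ F i))
                       , ~-trans (≗⇒~ λ j → sym (τ-⊛ b (enum F i) j)) (τ-~ c (proj₂ (enum∈ F i)))
    ; injective  = λ {i} {j} p → injective F (~-trans (≗⇒~ λ k → sym (τ-τ (enum F i) k))
                       (~-trans (τ-~ c′ p) (≗⇒~ (τ-τ (enum F j)))))
    ; index      = λ v h → index F (τ c′ v) (back v h)
    ; enum-index = λ v h → ~-trans (τ-~ c (enum-index F _ (back v h))) (≗⇒~ (Back.τ-τ v))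
    }
    where
    open Galois {c} {c′} inverse
    module Back = Galois {c′} {c} inverse′
    τ-~ : ∀ c {a b} → a ~ b → τ c a ~ τ c b
    τ-~ c p = pointwise λ i → at p (mul c i)
    back : ∀ v → Ker (τ c b) v → Ker b (τ c′ v)
    back v (h , p) = trans (Back.ε-τ v) h
      , ~-trans (≗⇒~ λ i → trans (⊛-cong {b} {τ c′ (τ c b)} {τ c′ v} (λ j → sym (τ-τ b j)) (λ _ → refl) i) (sym (Back.τ-⊛ (τ c b) v i)))
                (τ-~ c′ p)

  private

    rotate-+ : ∀ n v → Z^ 1 ⊛ (Z^ n ⊛ v) ≗ Z^ (suc n) ⊛ v
    rotate-+ n v i = trans (Z^-⊛ 1 (Z^ n ⊛ v) i) (trans (Z^-⊛ n v (i ⊝ res 1))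
      (trans (cong v (int-injective (≋-trans (⊝-≋ (i ⊝ res 1) (res n)) (≋-trans (−≋ (≋-trans (⊝-≋ i (res 1)) (−≋ (≋-refl (int i)) (res-≋ 1))) (res-≋ n))
        (≋-trans (≡⇒≋ (lem (int i) (+ n))) (≋-sym (≋-trans (⊝-≋ i (res (suc n))) (−≋ (≋-refl (int i)) (res-≋ (suc n))))))))))
      (sym (Z^-⊛ (suc n) v i))))
      where
      lem : ∀ i n → i - 1ℤ - n ≡ i - (1ℤ + n)
      lem = solve-∀

    Z^N-⊛ : ∀ v → Z^ N ⊛ v ≗ v
    Z^N-⊛ v i = trans (Z^-⊛ N v i) (cong v (int-injective (≋-trans (⊝-≋ i (res N)) (≋-trans (−≋ (≋-refl (int i)) (res-≋ N))
      (- 1ℤ , lem (int i) (+ N))))))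
      where
      lem : ∀ i n → i - n ≡ i + - 1ℤ * n
      lem = solve-∀

    opaque
      unfolding ε

      -- A vector fixed by Z is constant modulo u. If c is its value, its trace is N c ≡ 0, and N is
      -- invertible modulo u.
      invariant⇒0 : + N ⊥ + u → ∀ {v} → Traceless v → Z^ 1 ⊛ v ~ v → v ~ 𝟘
      invariant⇒0 N⊥u {v} h p = pointwise λ i → ≋-trans (const i) (⊥-divisor (⊥-sym N⊥u)
        (≋-trans (≡⇒≋ (sym (sum-const N (v (res 0))))) (≋-trans (≋-sym (sum-≋ const)) (≡⇒≋ h))))
        where
        invariant : ∀ n → Z^ n ⊛ v ~ v
        invariant zero    = ≗⇒~ (⊛-identityˡ v)
        invariant (suc n) = ~-trans (≗⇒~ λ i → sym (rotate-+ n v i)) (~-trans (⊛-~ (Z^ 1) (invariant n)) p)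
        const : ∀ i → v i ≋ v (res 0) [ + u ]
        const i = ≋-trans (≋-sym (at (invariant (toℕ i)) i)) (≡⇒≋ (trans (Z^-⊛ (toℕ i) v i)
          (cong v (int-injective (≋-trans (⊝-≋ i (res (toℕ i))) (≋-trans (−≋ (≋-refl (int i)) (≡⇒≋ (cong int (res-int i))))
            (≋-trans (≡⇒≋ (ℤ.+-inverseʳ (int i))) (≋-sym (res-≋ 0)))))))))

  kernel-size-≋ : Prime N → + N ⊥ + u → ∀ {b s} → Enum (Ker b) s → + s ≋ 1ℤ [ + N ]
  kernel-size-≋ N-prime N⊥u {b} {s} F = + proj₁ orbits , trans (cong +_ (proj₂ orbits)) (cong (λ z → 1ℤ + z) (ℤ.pos-* (proj₁ orbits) N))
    where
    next∈ : ∀ i → Ker b (Z^ 1 ⊛ enum F i)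
    next∈ i = traceless-⊛ (Z^ 1) {enum F i} (proj₁ (enum∈ F i))
            , ~-trans (≗⇒~ λ j → commute j) (~-trans (⊛-~ (Z^ 1) (proj₂ (enum∈ F i))) (≗⇒~ (⊛-𝟘 (Z^ 1))))
      where
      commute : b ⊛ (Z^ 1 ⊛ enum F i) ≗ Z^ 1 ⊛ (b ⊛ enum F i)
      commute j = trans (sym (⊛-assoc b (Z^ 1) (enum F i) j))
        (trans (⊛-cong {b ⊛ Z^ 1} {Z^ 1 ⊛ b} {enum F i} (⊛-comm b (Z^ 1)) (λ _ → refl) j) (⊛-assoc (Z^ 1) b (enum F i) j))
    next : Fin s → Fin s
    next i = index F (Z^ 1 ⊛ enum F i) (next∈ i)
    enum-next : ∀ i → enum F (next i) ~ Z^ 1 ⊛ enum F i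
    enum-next i = enum-index F _ (next∈ i)
    enum-iter : ∀ n i → enum F (iter next n i) ~ Z^ n ⊛ enum F i
    enum-iter zero    i = ≗⇒~ λ j → sym (⊛-identityˡ (enum F i) j)
    enum-iter (suc n) i = ~-trans (enum-next (iter next n i))
      (~-trans (⊛-~ (Z^ 1) (enum-iter n i)) (≗⇒~ (rotate-+ n (enum F i))))
    period : ∀ i → iter next N i ≡ i
    period i = injective F (~-trans (enum-iter N i) (≗⇒~ (Z^N-⊛ (enum F i))))
    𝟘∈ : Ker b 𝟘
    𝟘∈ = ε-𝟘 , ≗⇒~ (⊛-𝟘 b)
    x₀ : Fin s
    x₀ = index F 𝟘 𝟘∈
    fixed : next x₀ ≡ x₀
    fixed = injective F (~-trans (enum-next x₀) (~-trans (⊛-~ (Z^ 1) (enum-index F 𝟘 𝟘∈))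
      (~-trans (≗⇒~ (⊛-𝟘 (Z^ 1))) (~-sym (enum-index F 𝟘 𝟘∈)))))
    unique : ∀ x → next x ≡ x → x ≡ x₀
    unique x eq = injective F (~-trans (invariant⇒0 N⊥u (proj₁ (enum∈ F x))
      (~-trans (~-sym (enum-next x)) (≗⇒~ λ j → cong (λ y → enum F y j) eq))) (~-sym (enum-index F 𝟘 𝟘∈)))
    orbits : ∃ λ c → s ≡ suc (c ℕ.* N)
    orbits = unique-fixed-point⇒≡1 {s} {M} next N-prime period x₀ fixed unique

-- Norms

natural-residue : ∀ n a .{{_ : ℕ.NonZero n}} → a ≋ + (a ℤ.%ℕ n) [ + n ]
natural-residue n a = a ℤ./ℕ n , ℤ.a≡a%ℕn+[a/ℕn]*n a n

prime-∤⇒⊥ : ∀ {p a} → Prime p → ¬ (a ≋ 0ℤ [ + p ]) → a ⊥ + p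
prime-∤⇒⊥ {p} {a} p-prime a≢0 = ⊥-≋ a≋r (⊥-sym (coprime⇒⊥ (prime⇒coprime p-prime {{ℕ.≢-nonZero r≢0}} (ℤ.n%ℕd<d a p))))
  where
  instance _ = prime⇒nonZero p-prime
  r : ℕ
  r = a ℤ.%ℕ p
  a≋r : a ≋ + r [ + p ]
  a≋r = natural-residue p a
  r≢0 : r ≢ 0
  r≢0 eq = a≢0 (≋-trans a≋r (≡⇒≋ (cong +_ eq)))

module Norm (M : ℕ) (N-prime : Prime (suc M)) where
  open GroupRing M
  open Algebra.Properties.CommutativeMonoid.Sum (CommutativeRing.*-commutativeMonoid cyclotomicRing) public
    using () renaming (sum to ∏; sum-cong-≋ to ∏-cong; ∑-distrib-+ to ∏-distrib)

  opaque

    inverse-exists : ∀ (m : Fin M) → ∃ λ a → + a * + suc (toℕ m) ≋ 1ℤ [ + N ]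
    inverse-exists m with ⊥-inverse (⊥-sym (coprime⇒⊥ (prime⇒coprime N-prime (ℕ.s≤s (toℕ<n m)))))
    ... | a , h = a ℤ.%ℕ N , ≋-trans (*-≋ (≋-sym (natural-residue N a)) (≋-refl (+ suc (toℕ m)))) h

  inv : Fin M → ℕ
  inv m = proj₁ (inverse-exists m)

  inv-inverse : ∀ m → + inv m * + suc (toℕ m) ≋ 1ℤ [ + N ]
  inv-inverse m = proj₂ (inverse-exists m)

  module Conjugation (m : Fin M) = Galois {inv m} {suc (toℕ m)} (inv-inverse m)

  -- The index m stands for the exponent m + 1. As `τ c` sends Z to Z^(1/c), taking c = `inv m`
  -- makes `conj m` send Z to Z^(m+1), and so 1 - Z to the θ with index m + 1 in the product.
  conj : Fin M → ZG → ZG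
  conj m = τ (inv m)

  Nm : ZG → ZG
  Nm b = ∏ λ m → conj m b

  -- On trace zero vectors `Nm b` acts as u w, hence as 0 modulo u, so its kernel consists of all
  -- u^M classes; `kernel-∏` counts the same kernel as s^M, where s is the size of `Ker b`.
  unitary-divisor : M ≢ 0 → ∀ {b u w} .{{_ : ℕ.NonZero u}} → + u ⊥ w → + u ⊥ + N → Nm b ≈ (+ u * w) • 𝟙 → + u ≋ 1ℤ [ + N ]
  unitary-divisor M≢0 {b} {u@(suc u′)} {w} u⊥w u⊥N Nm≈ = go (enumerate-kernel b)
    where
    open Kernel M u′ hiding (u)
    open KernelSize M u′
    open Enumeration

    inverse : ∃ λ w′ → w′ * w ≋ 1ℤ [ + u ]
    inverse = ⊥-inverse (⊥-sym u⊥w)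

    Nm-action : ∀ v → Traceless v → Nm b ⊛ v ≗ (+ u * w) • v
    Nm-action v h i = trans (≈-⊛-traceless Nm≈ h i) (trans (⊛-•ˡ (+ u * w) 𝟙 v i) (cong (+ u * w *_) (⊛-identityˡ v i)))

    all-traceless : Enum Traceless (u ℕ.^ M) → Enum (Ker (Nm b)) (u ℕ.^ M)
    all-traceless F = record
      { enum       = enum F
      ; enum∈      = λ i → enum∈ F i , pointwise λ j → ≋-trans (≡⇒≋ (Nm-action (enum F i) (enum∈ F i) j)) (w * enum F i j , lem (+ u) w (enum F i j))
      ; injective  = injective F
      ; index      = λ v h → index F v (proj₁ h)
      ; enum-index = λ v h → enum-index F v (proj₁ h)
      }
      where
      lem : ∀ u w x → u * w * x ≡ 0ℤ + w * x * u
      lem = solve-∀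

    go : ∃ (Enum (Ker b)) → + u ≋ 1ℤ [ + N ]
    go (s , F) = subst (λ k → + k ≋ 1ℤ [ + N ]) s≡u (kernel-size-≋ N-prime (⊥-sym u⊥N) F)
      where
      s≡u : s ≡ u
      s≡u = ^-injectiveˡ M {{ℕ.≢-nonZero M≢0}} (size-unique congruence
        (kernel-∏ (λ m → conj m b) 𝟙 {w} {proj₁ inverse} (proj₂ inverse) (λ m → kernel-τ {b} (inv-inverse m) F)
          λ v h i → trans (⊛-cong {Nm b} {Nm b} (λ _ → refl) (⊛-identityˡ v) i) (Nm-action v h i))
        (all-traceless enumerate-traceless))

-- The prime θ = 1 - ζ above N

-- signedBinomial k i = (-1)^i (k choose i)
signedBinomial : ℕ → ℕ → ℤ
signedBinomial k       zero    = 1ℤ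
signedBinomial zero    (suc i) = 0ℤ
signedBinomial (suc k) (suc i) = signedBinomial k (suc i) - signedBinomial k i

signedBinomial-vanish : ∀ k i → k ℕ.< i → signedBinomial k i ≡ 0ℤ
signedBinomial-vanish zero    (suc i) _           = refl
signedBinomial-vanish (suc k) (suc i) (ℕ.s≤s k<i) =
  cong₂ _-_ (signedBinomial-vanish k (suc i) (ℕ.m<n⇒m<1+n k<i)) (signedBinomial-vanish k i k<i)

signedBinomial-step : ∀ k i → + suc i * signedBinomial k (suc i) ≡ (+ i - + k) * signedBinomial k i
signedBinomial-step zero zero = refl
signedBinomial-step zero (suc i) = trans (ℤ.*-zeroʳ (+ suc (suc i))) (sym (ℤ.*-zeroʳ (+ suc i - 0ℤ)))
signedBinomial-step (suc k) zero = trans (lem₁ (signedBinomial k 1)) (trans (cong (_- 1ℤ) (signedBinomial-step k zero)) (lem₂ (+ k)))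
  where
  lem₁ : ∀ b → 1ℤ * (b - 1ℤ) ≡ 1ℤ * b - 1ℤ
  lem₁ = solve-∀
  lem₂ : ∀ k → (0ℤ - k) * 1ℤ - 1ℤ ≡ (0ℤ - (1ℤ + k)) * 1ℤ
  lem₂ = solve-∀
signedBinomial-step (suc k) (suc i) = begin
  (1ℤ + (1ℤ + + i)) * (b₂ - b₁)                         ≡⟨ lem₁ (+ i) b₂ b₁ ⟩
  (1ℤ + (1ℤ + + i)) * b₂ - (1ℤ + (1ℤ + + i)) * b₁       ≡⟨ cong (_- (1ℤ + (1ℤ + + i)) * b₁) (signedBinomial-step k (suc i)) ⟩
  (1ℤ + + i - + k) * b₁ - (1ℤ + (1ℤ + + i)) * b₁        ≡⟨ lem₂ (+ i) (+ k) b₁ ⟩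
  (+ i - + k) * b₁ - (1ℤ + + i) * b₁                    ≡⟨ cong (λ z → (+ i - + k) * b₁ - z) (signedBinomial-step k i) ⟩
  (+ i - + k) * b₁ - (+ i - + k) * b₀                   ≡⟨ lem₃ (+ i) (+ k) b₁ b₀ ⟩
  (1ℤ + + i - (1ℤ + + k)) * (b₁ - b₀)                   ∎
  where
  open ≡-Reasoning
  b₀ b₁ b₂ : ℤ
  b₀ = signedBinomial k i
  b₁ = signedBinomial k (suc i)
  b₂ = signedBinomial k (suc (suc i))
  lem₁ : ∀ i b₂ b₁ → (1ℤ + (1ℤ + i)) * (b₂ - b₁) ≡ (1ℤ + (1ℤ + i)) * b₂ - (1ℤ + (1ℤ + i)) * b₁
  lem₁ = solve-∀
  lem₂ : ∀ i k b → (1ℤ + i - k) * b - (1ℤ + (1ℤ + i)) * b ≡ (i - k) * b - (1ℤ + i) * b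
  lem₂ = solve-∀
  lem₃ : ∀ i k b₁ b₀ → (i - k) * b₁ - (i - k) * b₀ ≡ (1ℤ + i - (1ℤ + k)) * (b₁ - b₀)
  lem₃ = solve-∀

-- By `signedBinomial-step`, (i+1) b₁ = (i-M) b₀ ≡ (i+1) b₀ modulo M + 1, and i + 1 ≤ M can be
-- cancelled. So consecutive coefficients of (1 - X)^M agree modulo the prime, and the first is 1.
signedBinomial-prime : ∀ M → Prime (suc M) → ∀ i → i ℕ.≤ M → signedBinomial M i ≋ 1ℤ [ + suc M ]
signedBinomial-prime M p zero    _   = ≋-refl 1ℤ
signedBinomial-prime M p (suc i) i<M = ≋-trans difference (signedBinomial-prime M p i (ℕ.<⇒≤ i<M))
  where
  b₀ b₁ : ℤ
  b₀ = signedBinomial M i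
  b₁ = signedBinomial M (suc i)
  lem₁ : ∀ i b₁ b₀ → i * (b₁ - b₀) ≡ i * b₁ - i * b₀
  lem₁ = solve-∀
  lem₂ : ∀ i m b₀ → (i - m) * b₀ - (1ℤ + i) * b₀ ≡ 0ℤ + - b₀ * (1ℤ + m)
  lem₂ = solve-∀
  lem₃ : ∀ b₁ b₀ → b₁ ≡ b₀ + (b₁ - b₀)
  lem₃ = solve-∀
  difference : b₁ ≋ b₀ [ + suc M ]
  difference = ≋-trans (≡⇒≋ (lem₃ b₁ b₀)) (≋-trans (+-≋ (≋-refl b₀)
    (⊥-divisor {b = + suc i} (coprime⇒⊥ (prime⇒coprime p (ℕ.s≤s i<M)))
      (- b₀ , trans (lem₁ (+ suc i) b₁ b₀) (trans (cong (_- + suc i * b₀) (signedBinomial-step M i)) (lem₂ (+ i) (+ M) b₀)))))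
    (≡⇒≋ (ℤ.+-identityʳ b₀)))

^-⊥ : ∀ {a m} → a ⊥ m → ∀ k → a ^ k ⊥ m
^-⊥ {m = m} h zero    = ⊥-1 m
^-⊥         h (suc k) = ⊥-* h (^-⊥ h k)

^-≋ : ∀ {a b m} → a ≋ b [ m ] → ∀ k → a ^ k ≋ b ^ k [ m ]
^-≋ h zero    = ≋-refl 1ℤ
^-≋ h (suc k) = *-≋ h (^-≋ h k)

^-distrib-* : ∀ a b k → (a * b) ^ k ≡ a ^ k * b ^ k
^-distrib-* a b zero    = refl
^-distrib-* a b (suc k) = trans (cong (a * b *_) (^-distrib-* a b k)) (lem a b (a ^ k) (b ^ k))
  where
  lem : ∀ a b c d → a * b * (c * d) ≡ a * c * (b * d)
  lem = solve-∀

^-≢0 : ∀ a k → a ≢ 0ℤ → a ^ k ≢ 0ℤ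
^-≢0 a (suc k) a≢0 eq with ℤ.i*j≡0⇒i≡0∨j≡0 a eq
... | inj₁ a≡0 = a≢0 a≡0
... | inj₂ ak≡0 = ^-≢0 a k a≢0 ak≡0

*-cancelˡ : ∀ {a b c} → a ≢ 0ℤ → a * b ≡ a * c → b ≡ c
*-cancelˡ {a} {b} {c} a≢0 = ℤ.*-cancelˡ-≡ a b c {{Data.Integer.≢-nonZero a≢0}}

module _ {p : ℕ} (p-prime : Prime p) where

  ⊥⇒≢0 : ∀ {a} → a ⊥ + p → ¬ (a ≋ 0ℤ [ + p ])
  ⊥⇒≢0 {a} h a≋0 = ¬prime[1] (subst Prime (ℕ.∣1⇒≡1 (∣⇒∣ᵤ (≋0⇒∣ (⊥-divisor (⊥-sym h) (≋-trans (≡⇒≋ (ℤ.*-identityʳ a)) a≋0))))) p-prime)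

  ^-≋0 : ∀ {a} k → a ^ k ≋ 0ℤ [ + p ] → a ≋ 0ℤ [ + p ]
  ^-≋0 {a} k h with ≋0? (+ p) a
  ... | yes a≋0 = a≋0
  ... | no  a≢0 = contradiction h (⊥⇒≢0 (^-⊥ (prime-∤⇒⊥ p-prime a≢0) k))

module Uniformiser (M : ℕ) (N-prime : Prime (suc M)) where
  open GroupRing M
  open Norm M N-prime

  θ : ZG
  θ = 𝟙 ⊞ ⊟ Z^ 1

  infixr 8 _^ᴳ_

  _^ᴳ_ : ZG → ℕ → ZG
  a ^ᴳ zero  = 𝟙
  a ^ᴳ suc k = a ⊛ a ^ᴳ k

  ⊟-⊛ : ∀ a b → ⊟ a ⊛ b ≗ ⊟ (a ⊛ b)
  ⊟-⊛ a b i = trans (⊛-cong {⊟ a} {(- 1ℤ) • a} {b} (λ j → sym (ℤ.-1*i≡-i (a j))) (λ _ → refl) i)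
    (trans (⊛-•ˡ (- 1ℤ) a b i) (ℤ.-1*i≡-i _))

  ⊛-distribʳ : ∀ a b c → (b ⊞ c) ⊛ a ≗ b ⊛ a ⊞ c ⊛ a
  ⊛-distribʳ a b c i = trans (⊛-comm (b ⊞ c) a i) (trans (⊛-distribˡ a b c i) (cong₂ _+_ (⊛-comm a b i) (⊛-comm a c i)))

  θ-⊛ : ∀ a i → (θ ⊛ a) i ≡ a i - a (i ⊝ res 1)
  θ-⊛ a i = trans (⊛-distribʳ a 𝟙 (⊟ Z^ 1) i) (cong₂ _+_ (⊛-identityˡ a i) (trans (⊟-⊛ (Z^ 1) a i) (cong -_ (Z^-⊛ 1 a i))))

  private

    zero⊝1 : zero ⊝ res 1 ≡ fromℕ M
    zero⊝1 = int-injective (≋-trans (⊝-≋ zero (res 1)) (≋-trans (−≋ (≡⇒≋ (int-toℕ zero)) (res-≋ 1))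
      (≋-trans (- 1ℤ , lem (+ M)) (≡⇒≋ (sym (trans (int-toℕ (fromℕ M)) (cong +_ (toℕ-fromℕ M))))))))
      where
      lem : ∀ m → 0ℤ - 1ℤ ≡ m + - 1ℤ * (1ℤ + m)
      lem = solve-∀

    suc⊝1 : ∀ (i : Fin M) → suc i ⊝ res 1 ≡ inject₁ i
    suc⊝1 i = int-injective (≋-trans (⊝-≋ (suc i) (res 1)) (≋-trans (−≋ (≡⇒≋ (int-toℕ (suc i))) (res-≋ 1))
      (≋-trans (≡⇒≋ (lem (+ toℕ i))) (≡⇒≋ (sym (trans (int-toℕ (inject₁ i)) (cong +_ (toℕ-inject₁ i))))))))
      where
      lem : ∀ m → 1ℤ + m - 1ℤ ≡ m
      lem = solve-∀

  -- The polynomial (1 - Z)^k has degree at most M < N, so the relation Z^N = 1 does not interfere: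
  -- the coefficient at M that would wrap round to index 0 vanishes as long as the exponent is below
  -- M.
  θ^-coefficient : ∀ k → k ℕ.≤ M → ∀ i → (θ ^ᴳ k) i ≡ signedBinomial k (toℕ i)
  θ^-coefficient zero _ zero = trans (cong (λ j → δ j zero) (int-injective {res 0} {zero} (≋-trans (res-≋ 0) (≡⇒≋ (sym (int-toℕ zero)))))) refl
  θ^-coefficient zero _ (suc i) = cong (λ j → δ j (suc i)) (int-injective {res 0} {zero} (≋-trans (res-≋ 0) (≡⇒≋ (sym (int-toℕ zero)))))
  θ^-coefficient (suc k) k<M zero = trans (θ-⊛ (θ ^ᴳ k) zero) (cong₂ _-_ (θ^-coefficient k (ℕ.<⇒≤ k<M) zero)
    (trans (cong (θ ^ᴳ k) zero⊝1) (trans (θ^-coefficient k (ℕ.<⇒≤ k<M) (fromℕ M))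
      (trans (cong (signedBinomial k) (toℕ-fromℕ M)) (signedBinomial-vanish k M k<M)))))
  θ^-coefficient (suc k) k<M (suc i) = trans (θ-⊛ (θ ^ᴳ k) (suc i)) (cong₂ _-_ (θ^-coefficient k (ℕ.<⇒≤ k<M) (suc i))
    (trans (cong (θ ^ᴳ k) (suc⊝1 i)) (trans (θ^-coefficient k (ℕ.<⇒≤ k<M) (inject₁ i)) (cong (signedBinomial k) (toℕ-inject₁ i)))))

  ε-⊟ : ∀ a → ε (⊟ a) ≡ - ε a
  ε-⊟ a = trans (ε-cong (λ i → sym (ℤ.-1*i≡-i (a i)))) (trans (ε-• (- 1ℤ) a) (ℤ.-1*i≡-i (ε a)))

  ε-θ : ε θ ≡ 0ℤ
  ε-θ = trans (ε-⊞ 𝟙 (⊟ Z^ 1)) (cong₂ _+_ (ε-Z^ 0) (trans (ε-⊟ (Z^ 1)) (cong -_ (ε-Z^ 1))))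

  ε-θ^ : ∀ k → ε (θ ^ᴳ suc k) ≡ 0ℤ
  ε-θ^ k = trans (ε-⊛ θ (θ ^ᴳ k)) (trans (cong (_* ε (θ ^ᴳ k)) ε-θ) (ℤ.*-zeroˡ (ε (θ ^ᴳ k))))

  -- θ^(N-1) = N w up to a multiple of 1 + Z + … + Z^(N-1).
  w : ZG
  w i = _≋_[_].quotient (signedBinomial-prime M N-prime (toℕ i) (ℕ.s≤s⁻¹ (toℕ<n i)))

  θ^M≡ : ∀ i → (θ ^ᴳ M) i ≡ + N * w i + 1ℤ
  θ^M≡ i = trans (θ^-coefficient M ℕ.≤-refl i)
    (trans (_≋_[_].equality (signedBinomial-prime M N-prime (toℕ i) (ℕ.s≤s⁻¹ (toℕ<n i)))) (lem (w i) (+ N)))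
    where
    lem : ∀ w n → 1ℤ + w * n ≡ n * w + 1ℤ
    lem = solve-∀

  θ^M≈ : θ ^ᴳ M ≈ + N • w
  θ^M≈ = 1ℤ , θ^M≡

  ε-constant : ∀ c → ε (λ _ → c) ≡ + N * c
  ε-constant c = trans (ε-def _) (sum-const N c)

  -- The augmentation of θ^M = N w + (1 + Z + ... + Z^M) is 0 = N `ε w` + N. Thus w is a unit modulo
  -- θ; the value -1 is Wilson's theorem in disguise.
  ε-w : M ≢ 0 → ε w ≡ - 1ℤ
  ε-w M≢0 = *-cancelˡ {+ N} (λ ()) (begin
    + N * ε w                              ≡⟨ lem (+ N) (ε w) ⟩
    + N * ε w + + N * 1ℤ + + N * - 1ℤ      ≡⟨ cong (_+ + N * - 1ℤ) (cong₂ _+_ (ε-• (+ N) w) (ε-constant 1ℤ)) ⟨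
    ε (+ N • w) + ε (λ _ → 1ℤ) + + N * - 1ℤ  ≡⟨ cong (_+ + N * - 1ℤ) (ε-⊞ (+ N • w) (λ _ → 1ℤ)) ⟨
    ε (+ N • w ⊞ (λ _ → 1ℤ)) + + N * - 1ℤ  ≡⟨ cong (_+ + N * - 1ℤ) (ε-cong θ^M≡) ⟨
    ε (θ ^ᴳ M) + + N * - 1ℤ                ≡⟨ cong (_+ + N * - 1ℤ) (vanish M M≢0) ⟩
    0ℤ + + N * - 1ℤ                        ≡⟨ ℤ.+-identityˡ _ ⟩
    + N * - 1ℤ                             ∎)
    where
    open ≡-Reasoning
    lem : ∀ n e → n * e ≡ n * e + n * 1ℤ + n * - 1ℤ
    lem = solve-∀
    vanish : ∀ k → k ≢ 0 → ε (θ ^ᴳ k) ≡ 0ℤ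
    vanish zero    k≢0 = contradiction refl k≢0
    vanish (suc k) _   = ε-θ^ k

-- Comparison of coefficients with powers of θ

module Descent (M : ℕ) (M≢0 : M ≢ 0) (N-prime : Prime (suc M)) where
  open GroupRing M
  open Norm M N-prime
  open Uniformiser M N-prime

  module ≈-Reasoning = Relation.Binary.Reasoning.Setoid (CommutativeRing.setoid cyclotomicRing)

  •-≈ : ∀ c {a b} → a ≈ b → c • a ≈ c • b
  •-≈ c {a} {b} (x , p) = c * x , λ i → trans (cong (c *_) (p i)) (ℤ.*-distribˡ-+ c (b i) x)

  -- Read at index 0, the equation shows that the constant is itself a multiple of c; so ℤ[ζ] is
  -- torsion-free.
  •-cancel : ∀ {c a b} → c ≢ 0ℤ → c • a ≈ c • b → a ≈ b
  •-cancel {c} {a} {b} c≢0 (x , p) = a zero - b zero , λ i → *-cancelˡ c≢0 (begin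
    c * a i                              ≡⟨ p i ⟩
    c * b i + x                          ≡⟨ lem₁ (c * b i) x (c * b zero) ⟩
    c * b i + (c * b zero + x - c * b zero)    ≡⟨ cong (λ z → c * b i + (z - c * b zero)) (p zero) ⟨
    c * b i + (c * a zero - c * b zero)  ≡⟨ lem₂ c (b i) (a zero) (b zero) ⟩
    c * (b i + (a zero - b zero))        ∎)
    where
    open ≡-Reasoning
    lem₁ : ∀ y x z → y + x ≡ y + (z + x - z)
    lem₁ = solve-∀
    lem₂ : ∀ c y a b → c * y + (c * a - c * b) ≡ c * (y + (a - b))
    lem₂ = solve-∀

  -- The augmentation of 1 + Z + ... + Z^(N-1) is N. So ε is defined on ℤ[ζ] modulo N only, where it
  -- is reduction modulo θ.
  ε-≈ : ∀ {a b} → a ≈ b → ε a ≋ ε b [ + N ]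
  ε-≈ {a} {b} (x , p) = x , (begin
    ε a                      ≡⟨ ε-cong p ⟩
    ε (b ⊞ (λ _ → x))        ≡⟨ ε-⊞ b (λ _ → x) ⟩
    ε b + ε (λ _ → x)        ≡⟨ cong (λ z → ε b + z) (trans (ε-constant x) (ℤ.*-comm (+ N) x)) ⟩
    ε b + x * + N            ∎)
    where open ≡-Reasoning

  Nm-≈ : ∀ {a b} → a ≈ b → Nm a ≈ Nm b
  Nm-≈ p = ∏-cong λ m → τ-≈ (inv m) p

  Nm-⊛ : ∀ a b → Nm (a ⊛ b) ≈ Nm a ⊛ Nm b
  Nm-⊛ a b = ≈-trans (∏-cong λ m → ≗⇒≈ (Conjugation.τ-⊛ m a b)) (∏-distrib (λ m → conj m a) (λ m → conj m b))

  private

    ∏-• : ∀ c {k} (f : Fin k → ZG) → ∏ (λ i → c • f i) ≗ c ^ k • ∏ f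
    ∏-• c {zero}  f i = sym (ℤ.*-identityˡ (𝟙 i))
    ∏-• c {suc k} f i = begin
      ((c • f zero) ⊛ ∏ (λ j → c • f (suc j))) i   ≡⟨ ⊛-cong {c • f zero} {c • f zero} (λ _ → refl) (∏-• c (f ∘ suc)) i ⟩
      ((c • f zero) ⊛ (c ^ k • ∏ (f ∘ suc))) i     ≡⟨ ⊛-•ˡ c (f zero) (c ^ k • ∏ (f ∘ suc)) i ⟩
      c * (f zero ⊛ (c ^ k • ∏ (f ∘ suc))) i       ≡⟨ cong (c *_) (⊛-comm (f zero) (c ^ k • ∏ (f ∘ suc)) i) ⟩
      c * ((c ^ k • ∏ (f ∘ suc)) ⊛ f zero) i       ≡⟨ cong (c *_) (⊛-•ˡ (c ^ k) (∏ (f ∘ suc)) (f zero) i) ⟩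
      c * (c ^ k * (∏ (f ∘ suc) ⊛ f zero) i)       ≡⟨ cong (λ z → c * (c ^ k * z)) (⊛-comm (∏ (f ∘ suc)) (f zero) i) ⟩
      c * (c ^ k * (f zero ⊛ ∏ (f ∘ suc)) i)       ≡⟨ ℤ.*-assoc c (c ^ k) ((f zero ⊛ ∏ (f ∘ suc)) i) ⟨
      c * c ^ k * (f zero ⊛ ∏ (f ∘ suc)) i         ∎
      where open ≡-Reasoning

    ε-∏ : ∀ {k e} (f : Fin k → ZG) → (∀ i → ε (f i) ≡ e) → ε (∏ f) ≡ e ^ k
    ε-∏ {zero}  f h = ε-Z^ 0
    ε-∏ {suc k} f h = trans (ε-⊛ (f zero) (∏ (f ∘ suc))) (cong₂ _*_ (h zero) (ε-∏ (f ∘ suc) (h ∘ suc)))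

  Nm-• : ∀ c a → Nm (c • a) ≗ c ^ M • Nm a
  Nm-• c a = ∏-• c λ m → conj m a

  ε-Nm : ∀ a → ε (Nm a) ≡ ε a ^ M
  ε-Nm a = ε-∏ (λ m → conj m a) λ m → Conjugation.ε-τ m a

  Nm-cancel : ∀ {c a r} → c ≢ 0ℤ → Nm (c • a) ≈ (c ^ M * r) • 𝟙 → Nm a ≈ r • 𝟙
  Nm-cancel {c} {a} {r} c≢0 h = •-cancel (^-≢0 c M c≢0)
    (≈-trans (≈-sym (≗⇒≈ (Nm-• c a))) (≈-trans h (≗⇒≈ λ i → ℤ.*-assoc (c ^ M) r (𝟙 i))))

  -- Horner's form of the sum of the z_j a^j; splitting off z₀ is one step of the comparison of
  -- coefficients.
  ev : ZG → ∀ {k} → (Fin k → ℤ) → ZG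
  ev a {zero}  z = 𝟘
  ev a {suc k} z = z zero • 𝟙 ⊞ a ⊛ ev a (z ∘ suc)

  ev-cong : ∀ a {k} {z z′ : Fin k → ℤ} → z ≗ z′ → ev a z ≗ ev a z′
  ev-cong a {zero}  p i = refl
  ev-cong a {suc k} p i = cong₂ _+_ (cong (_* 𝟙 i) (p zero)) (⊛-cong {a} {a} (λ _ → refl) (ev-cong a (p ∘ suc)) i)

  ev-• : ∀ a c {k} (z : Fin k → ℤ) → ev a (λ i → c * z i) ≗ c • ev a z
  ev-• a c {zero}  z i = sym (ℤ.*-zeroʳ c)
  ev-• a c {suc k} z i = begin
    c * z zero * 𝟙 i + (a ⊛ ev a (λ j → c * z (suc j))) i   ≡⟨ cong (λ y → c * z zero * 𝟙 i + y) (⊛-cong {a} {a} (λ _ → refl) (ev-• a c (z ∘ suc)) i) ⟩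
    c * z zero * 𝟙 i + (a ⊛ (c • ev a (z ∘ suc))) i         ≡⟨ cong (λ y → c * z zero * 𝟙 i + y) (⊛-•ʳ c a (ev a (z ∘ suc)) i) ⟩
    c * z zero * 𝟙 i + c * (a ⊛ ev a (z ∘ suc)) i           ≡⟨ lem c (z zero) (𝟙 i) _ ⟩
    c * (z zero * 𝟙 i + (a ⊛ ev a (z ∘ suc)) i)             ∎
    where
    open ≡-Reasoning
    lem : ∀ c z o y → c * z * o + c * y ≡ c * (z * o + y)
    lem = solve-∀

  ε-ev : ∀ {k} (z : Fin (suc k) → ℤ) → ε (ev θ z) ≡ z zero
  ε-ev z = trans (ε-⊞ (z zero • 𝟙) (θ ⊛ ev θ (z ∘ suc))) (trans (cong₂ _+_
    (trans (ε-• (z zero) 𝟙) (trans (cong (z zero *_) (ε-Z^ 0)) (ℤ.*-identityʳ (z zero))))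
    (trans (ε-⊛ θ (ev θ (z ∘ suc))) (trans (cong (_* ε (ev θ (z ∘ suc))) ε-θ) (ℤ.*-zeroˡ (ε (ev θ (z ∘ suc)))))))
    (ℤ.+-identityʳ (z zero)))

  -- Applied with the variable M for k, where the first index cannot be written `zero`; the
  -- condition `toℕ i ≡ 0` singles it out.
  ε-evaluation : ∀ k → k ≢ 0 → (z : Fin k → ℤ) → ∀ {a} → (∀ i → toℕ i ≡ 0 → z i ≡ a) → ε (ev θ z) ≡ a
  ε-evaluation zero    k≢0 z h = contradiction refl k≢0
  ε-evaluation (suc k) _   z h = trans (ε-ev z) (h zero refl)

  ^ᴳ-+ : ∀ a m n → a ^ᴳ m ⊛ a ^ᴳ n ≈ a ^ᴳ (m ℕ.+ n)
  ^ᴳ-+ a zero    n = ≗⇒≈ (⊛-identityˡ (a ^ᴳ n))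
  ^ᴳ-+ a (suc m) n = ≈-trans (≗⇒≈ (⊛-assoc a (a ^ᴳ m) (a ^ᴳ n))) (⊛-≈ (≈-refl {a}) (^ᴳ-+ a m n))

  -- If A = θ^j (z₀ + z₁ θ + …) + N C, then θ^(M-j) A = N E with ε E ≡ - z₀, so Nm θ^(M-j) · r′ = Nm E forces N ∣ z₀.
  private
    step : ∀ {A r′} → Nm A ≈ ((+ N) ^ M * r′) • 𝟙 → ∀ k j → j ℕ.+ suc k ≡ M → (z : Fin (suc k) → ℤ) (C : ZG) →
      A ≈ θ ^ᴳ j ⊛ ev θ z ⊞ + N • C → z zero ≋ 0ℤ [ + N ]
    step {A} {r′} Nm-A k j j+e≡M z C A≈ = ≋-trans (≡⇒≋ (sym (ℤ.neg-involutive (z zero)))) (neg-≋ (^-≋0 N-prime M -z₀^M))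
      where
      e : ℕ
      e = suc k
      E : ZG
      E = w ⊛ ev θ z ⊞ θ ^ᴳ e ⊛ C

      θ^eA≈NE : θ ^ᴳ e ⊛ A ≈ + N • E
      θ^eA≈NE = begin
        θ ^ᴳ e ⊛ A                                          ≈⟨ ⊛-≈ (≈-refl {θ ^ᴳ e}) A≈ ⟩
        θ ^ᴳ e ⊛ (θ ^ᴳ j ⊛ ev θ z ⊞ + N • C)                ≈⟨ ≗⇒≈ (⊛-distribˡ (θ ^ᴳ e) (θ ^ᴳ j ⊛ ev θ z) (+ N • C)) ⟩
        θ ^ᴳ e ⊛ (θ ^ᴳ j ⊛ ev θ z) ⊞ θ ^ᴳ e ⊛ (+ N • C)     ≈⟨ ⊞-≈ {c = θ ^ᴳ e ⊛ (+ N • C)} head (≗⇒≈ (⊛-•ʳ (+ N) (θ ^ᴳ e) C)) ⟩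
        + N • (w ⊛ ev θ z) ⊞ + N • (θ ^ᴳ e ⊛ C)             ≈⟨ ≗⇒≈ (λ i → ℤ.*-distribˡ-+ (+ N) ((w ⊛ ev θ z) i) ((θ ^ᴳ e ⊛ C) i)) ⟨
        + N • E                                             ∎
        where
        open ≈-Reasoning
        head : θ ^ᴳ e ⊛ (θ ^ᴳ j ⊛ ev θ z) ≈ + N • (w ⊛ ev θ z)
        head = begin
          θ ^ᴳ e ⊛ (θ ^ᴳ j ⊛ ev θ z)    ≈⟨ ≗⇒≈ (⊛-assoc (θ ^ᴳ e) (θ ^ᴳ j) (ev θ z)) ⟨
          θ ^ᴳ e ⊛ θ ^ᴳ j ⊛ ev θ z      ≈⟨ ⊛-≈ˡ (ev θ z) (^ᴳ-+ θ e j) ⟩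
          θ ^ᴳ (e ℕ.+ j) ⊛ ev θ z       ≡⟨ cong (λ l → θ ^ᴳ l ⊛ ev θ z) (trans (ℕ.+-comm e j) j+e≡M) ⟩
          θ ^ᴳ M ⊛ ev θ z               ≈⟨ ⊛-≈ˡ (ev θ z) θ^M≈ ⟩
          (+ N • w) ⊛ ev θ z            ≈⟨ ≗⇒≈ (⊛-•ˡ (+ N) w (ev θ z)) ⟩
          + N • (w ⊛ ev θ z)            ∎

      ε-E : ε E ≡ - z zero
      ε-E = begin
        ε E                                    ≡⟨ ε-⊞ (w ⊛ ev θ z) (θ ^ᴳ e ⊛ C) ⟩
        ε (w ⊛ ev θ z) + ε (θ ^ᴳ e ⊛ C)        ≡⟨ cong₂ _+_ (ε-⊛ w (ev θ z)) (ε-⊛ (θ ^ᴳ e) C) ⟩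
        ε w * ε (ev θ z) + ε (θ ^ᴳ e) * ε C    ≡⟨ cong₂ _+_ (cong₂ _*_ (ε-w M≢0) (ε-ev z)) (cong (_* ε C) (ε-θ^ k)) ⟩
        - 1ℤ * z zero + 0ℤ * ε C               ≡⟨ lem (z zero) (ε C) ⟩
        - z zero                               ∎
        where
        open ≡-Reasoning
        lem : ∀ z c → - 1ℤ * z + 0ℤ * c ≡ - z
        lem = solve-∀

      Nm-E : r′ • Nm (θ ^ᴳ e) ≈ Nm E
      Nm-E = •-cancel (^-≢0 (+ N) M (λ ())) (begin
        (+ N) ^ M • (r′ • Nm (θ ^ᴳ e))           ≈⟨ ≗⇒≈ (λ i → ℤ.*-assoc ((+ N) ^ M) r′ (Nm (θ ^ᴳ e) i)) ⟨
        ((+ N) ^ M * r′) • Nm (θ ^ᴳ e)           ≈⟨ ≗⇒≈ (λ i → cong ((+ N) ^ M * r′ *_) (⊛-identityˡ (Nm (θ ^ᴳ e)) i)) ⟨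
        ((+ N) ^ M * r′) • (𝟙 ⊛ Nm (θ ^ᴳ e))     ≈⟨ ≗⇒≈ (⊛-•ˡ ((+ N) ^ M * r′) 𝟙 (Nm (θ ^ᴳ e))) ⟨
        (((+ N) ^ M * r′) • 𝟙) ⊛ Nm (θ ^ᴳ e)     ≈⟨ ⊛-≈ˡ (Nm (θ ^ᴳ e)) Nm-A ⟨
        Nm A ⊛ Nm (θ ^ᴳ e)                     ≈⟨ ≗⇒≈ (⊛-comm (Nm A) (Nm (θ ^ᴳ e))) ⟩
        Nm (θ ^ᴳ e) ⊛ Nm A                     ≈⟨ Nm-⊛ (θ ^ᴳ e) A ⟨
        Nm (θ ^ᴳ e ⊛ A)                        ≈⟨ Nm-≈ θ^eA≈NE ⟩
        Nm (+ N • E)                           ≈⟨ ≗⇒≈ (Nm-• (+ N) E) ⟩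
        (+ N) ^ M • Nm E                         ∎)
        where open ≈-Reasoning

      -z₀^M : (- z zero) ^ M ≋ 0ℤ [ + N ]
      -z₀^M = ≋-trans (≡⇒≋ (trans (cong (_^ M) (sym ε-E)) (sym (ε-Nm E)))) (≋-trans (≋-sym (ε-≈ Nm-E))
        (≡⇒≋ (trans (ε-• r′ (Nm (θ ^ᴳ e))) (trans (cong (r′ *_) (trans (ε-Nm (θ ^ᴳ e)) (trans (cong (_^ M) (ε-θ^ k)) (0^ M M≢0)))) (ℤ.*-zeroʳ r′)))))
        where
        0^ : ∀ m → m ≢ 0 → 0ℤ ^ m ≡ 0ℤ
        0^ zero    m≢0 = contradiction refl m≢0
        0^ (suc m) _   = ℤ.*-zeroˡ (0ℤ ^ m)

    -- Once z₀ = q N is known, z₀ θ^j joins the error term N C and j rises by one; j + k = M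
    -- supplies the complementary exponent that `step` needs.
    coefficients : ∀ {A r′} → Nm A ≈ ((+ N) ^ M * r′) • 𝟙 → ∀ k j → j ℕ.+ k ≡ M → (z : Fin k → ℤ) (C : ZG) →
      A ≈ θ ^ᴳ j ⊛ ev θ z ⊞ + N • C → ∀ i → z i ≋ 0ℤ [ + N ]
    coefficients Nm-A (suc k) j eq z C A≈ zero = step Nm-A k j eq z C A≈
    coefficients {A} {r′} Nm-A (suc k) j eq z C A≈ (suc i) =
      coefficients {A} {r′} Nm-A k (suc j) (trans (sym (ℕ.+-suc j k)) eq) (z ∘ suc) (q • θ ^ᴳ j ⊞ C)
        (≈-trans A≈ (≗⇒≈ shift)) i
      where
      z₀≋0 : z zero ≋ 0ℤ [ + N ]
      z₀≋0 = step {A} {r′} Nm-A k j eq z C A≈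
      q : ℤ
      q = _≋_[_].quotient z₀≋0
      T : ZG
      T = ev θ (z ∘ suc)
      shift : θ ^ᴳ j ⊛ ev θ z ⊞ + N • C ≗ θ ^ᴳ suc j ⊛ T ⊞ + N • (q • θ ^ᴳ j ⊞ C)
      shift l = begin
        (θ ^ᴳ j ⊛ (z zero • 𝟙 ⊞ θ ⊛ T)) l + + N * C l
          ≡⟨ cong (_+ + N * C l) (⊛-distribˡ (θ ^ᴳ j) (z zero • 𝟙) (θ ⊛ T) l) ⟩
        (θ ^ᴳ j ⊛ (z zero • 𝟙)) l + (θ ^ᴳ j ⊛ (θ ⊛ T)) l + + N * C l
          ≡⟨ cong₂ (λ x y → x + y + + N * C l) first second ⟩
        q * + N * (θ ^ᴳ j) l + (θ ^ᴳ suc j ⊛ T) l + + N * C l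
          ≡⟨ lem q (+ N) ((θ ^ᴳ j) l) ((θ ^ᴳ suc j ⊛ T) l) (C l) ⟩
        (θ ^ᴳ suc j ⊛ T) l + + N * (q * (θ ^ᴳ j) l + C l) ∎
        where
        open ≡-Reasoning
        lem : ∀ q n t s c → q * n * t + s + n * c ≡ s + n * (q * t + c)
        lem = solve-∀
        first : (θ ^ᴳ j ⊛ (z zero • 𝟙)) l ≡ q * + N * (θ ^ᴳ j) l
        first = trans (⊛-•ʳ (z zero) (θ ^ᴳ j) 𝟙 l) (cong₂ _*_ (trans (_≋_[_].equality z₀≋0) (ℤ.+-identityˡ (q * + N)))
          (trans (⊛-comm (θ ^ᴳ j) 𝟙 l) (⊛-identityˡ (θ ^ᴳ j) l)))
        second : (θ ^ᴳ j ⊛ (θ ⊛ T)) l ≡ (θ ^ᴳ suc j ⊛ T) l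
        second = trans (sym (⊛-assoc (θ ^ᴳ j) θ T l)) (⊛-cong {θ ^ᴳ j ⊛ θ} {θ ⊛ θ ^ᴳ j} {T} (⊛-comm (θ ^ᴳ j) θ) (λ _ → refl) l)

  N^M∣Nm⇒N∣coefficients : ∀ (z : Fin M → ℤ) {r′} → Nm (ev θ z) ≈ ((+ N) ^ M * r′) • 𝟙 → ∀ i → z i ≋ 0ℤ [ + N ]
  N^M∣Nm⇒N∣coefficients z {r′} Nm-A = coefficients {ev θ z} {r′} Nm-A M 0 refl z 𝟘
    (≗⇒≈ λ i → sym (trans (cong₂ _+_ (⊛-identityˡ (ev θ z) i) (ℤ.*-zeroʳ (+ N))) (ℤ.+-identityʳ _)))

  divide : ∀ (z : Fin M → ℤ) {r′} → Nm (ev θ z) ≈ ((+ N) ^ M * r′) • 𝟙 →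
    ∃ λ z′ → (∀ i → z i ≡ + N * z′ i) × (Nm (ev θ z′) ≈ r′ • 𝟙)
  divide z {r′} h = z′ , z≡ , Nm-cancel {+ N} {ev θ z′} (λ ()) (≈-trans (Nm-≈ (≗⇒≈ λ i → trans (sym (ev-• θ (+ N) z′ i)) (ev-cong θ (λ j → sym (z≡ j)) i))) h)
    where
    N∣z : ∀ i → z i ≋ 0ℤ [ + N ]
    N∣z = N^M∣Nm⇒N∣coefficients z {r′} h
    z′ : Fin M → ℤ
    z′ i = _≋_[_].quotient (N∣z i)
    z≡ : ∀ i → z i ≡ + N * z′ i
    z≡ i = trans (_≋_[_].equality (N∣z i)) (trans (ℤ.+-identityˡ _) (ℤ.*-comm (z′ i) (+ N)))

  -- Norm 0 survives every division by N, so N^n divides each coefficient a for all n. Taking n =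
  -- ∣a∣ leaves only a = 0, because N^∣a∣ > ∣a∣.
  Nm-zero : ∀ (z : Fin M → ℤ) → Nm (ev θ z) ≈ 0ℤ • 𝟙 → ∀ i → z i ≡ 0ℤ
  Nm-zero z h i = small (powers ∣ z i ∣ z h i)
    where
    powers : ∀ n (z : Fin M → ℤ) → Nm (ev θ z) ≈ 0ℤ • 𝟙 → ∀ i → ∃ λ q → z i ≡ q * + (N ℕ.^ n)
    powers zero    z h i = z i , sym (ℤ.*-identityʳ (z i))
    powers (suc n) z h i = q , (begin
      z i                          ≡⟨ proj₁ (proj₂ divided) i ⟩
      + N * z′ i                   ≡⟨ cong (+ N *_) (proj₂ rest) ⟩
      + N * (q * + (N ℕ.^ n))      ≡⟨ lem (+ N) q (+ (N ℕ.^ n)) ⟩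
      q * (+ N * + (N ℕ.^ n))      ≡⟨ cong (q *_) (ℤ.pos-* N (N ℕ.^ n)) ⟨
      q * + (N ℕ.* N ℕ.^ n)        ∎)
      where
      open ≡-Reasoning
      divided : ∃ λ z′ → (∀ i → z i ≡ + N * z′ i) × (Nm (ev θ z′) ≈ 0ℤ • 𝟙)
      divided = divide z {0ℤ} (≈-trans h (≗⇒≈ λ j → cong (_* 𝟙 j) (sym (ℤ.*-zeroʳ ((+ N) ^ M)))))
      z′ : Fin M → ℤ
      z′ = proj₁ divided
      rest : ∃ λ q → z′ i ≡ q * + (N ℕ.^ n)
      rest = powers n z′ (proj₂ (proj₂ divided)) i
      q : ℤ
      q = proj₁ rest
      lem : ∀ n q x → n * (q * x) ≡ q * (n * x)
      lem = solve-∀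
    n<N^n : ∀ n → n ℕ.< N ℕ.^ n
    n<N^n zero    = ℕ.s≤s ℕ.z≤n
    n<N^n (suc n) = ℕ.≤-trans (ℕ.s≤s (n<N^n n)) (ℕ.≤-trans (ℕ.+-monoˡ-≤ (N ℕ.^ n) (ℕ.≤-trans (ℕ.s≤s ℕ.z≤n) (n<N^n n)))
      (ℕ.≤-trans (ℕ.≤-reflexive (sym (cong (N ℕ.^ n ℕ.+_) (ℕ.+-identityʳ (N ℕ.^ n))))) (ℕ.*-monoˡ-≤ (N ℕ.^ n) 2≤N)))
      where
      2≤N : 2 ℕ.≤ N
      2≤N = ℕ.s≤s (ℕ.n≢0⇒n>0 M≢0)
    small : ∀ {a} → ∃ (λ q → a ≡ q * + (N ℕ.^ ∣ a ∣)) → a ≡ 0ℤ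
    small {a} (q , a≡) = by-size ∣ q ∣ refl
      where
      P : ℕ
      P = N ℕ.^ ∣ a ∣
      by-size : ∀ k → ∣ q ∣ ≡ k → a ≡ 0ℤ
      by-size zero    eq = trans a≡ (trans (cong (_* + P) (ℤ.∣i∣≡0⇒i≡0 {q} eq)) (ℤ.*-zeroˡ (+ P)))
      by-size (suc k) eq = contradiction (ℕ.≤-trans (n<N^n ∣ a ∣) (ℕ.≤-trans (ℕ.m≤m+n P (k ℕ.* P))
        (ℕ.≤-reflexive (sym (trans (cong ∣_∣ a≡) (trans (ℤ.abs-* q (+ P)) (cong (ℕ._* P) eq))))))) (ℕ.<-irrefl refl)

  -- If N ∤ d, reduction modulo θ gives (d X)^M ≡ d^M R, and the left side is nonzero. If N ∣ d, the
  -- norm is a multiple of N^M, so `divide` takes a factor N out of all coefficients, and d shrinks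
  -- to d / N.
  Nm-unit : ∀ {X R} → ¬ (X ≋ 0ℤ [ + N ]) → ∀ d .{{_ : ℕ.NonZero d}} (z : Fin M → ℤ) →
    (∀ i → toℕ i ≡ 0 → z i ≡ + d * X) → Nm (ev θ z) ≈ ((+ d) ^ M * R) • 𝟙 → ¬ (R ≋ 0ℤ [ + N ])
  Nm-unit {X} {R} X≢0 d = go d (<-wellFounded d)
    where
    go : ∀ d → Acc ℕ._<_ d → .{{_ : ℕ.NonZero d}} (z : Fin M → ℤ) →
      (∀ i → toℕ i ≡ 0 → z i ≡ + d * X) → Nm (ev θ z) ≈ ((+ d) ^ M * R) • 𝟙 → ¬ (R ≋ 0ℤ [ + N ])
    go d (acc rec) z z₀≡ h R≋0 = split (≋0? (+ N) (+ d))
      where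
      split : Dec (+ d ≋ 0ℤ [ + N ]) → Empty.⊥
      split (no d≢0) = ⊥⇒≢0 N-prime (⊥-* (prime-∤⇒⊥ N-prime d≢0) (prime-∤⇒⊥ N-prime X≢0)) (^-≋0 N-prime M
        (≋-trans (≡⇒≋ (trans (cong (_^ M) (sym (ε-evaluation M M≢0 z z₀≡))) (sym (ε-Nm (ev θ z)))))
        (≋-trans (ε-≈ h) (≋-trans (≡⇒≋ (trans (ε-• ((+ d) ^ M * R) 𝟙) (trans (cong ((+ d) ^ M * R *_) (ε-Z^ 0)) (ℤ.*-identityʳ _))))
        (≋-trans (*-≋ (≋-refl ((+ d) ^ M)) R≋0) (≡⇒≋ (ℤ.*-zeroʳ ((+ d) ^ M))))))))
      split (yes d≋0) = descend (∣⇒∣ᵤ (≋0⇒∣ d≋0))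
        where
        descend : N ℕ.∣ d → Empty.⊥
        descend (ℕ.divides k d≡) = go k (rec k<d) {{k-nonZero}} (proj₁ divided) z₀′≡ (proj₂ (proj₂ divided)) R≋0
          where
          k-nonZero : ℕ.NonZero k
          k-nonZero = ℕ.≢-nonZero λ { refl → ℕ.≢-nonZero⁻¹ d d≡ }
          k<d : k ℕ.< d
          k<d = subst (k ℕ.<_) (sym d≡) (ℕ.m<m*n k N {{k-nonZero}} (ℕ.s≤s (ℕ.n≢0⇒n>0 M≢0)))
          d≡Nk : + d ≡ + N * + k
          d≡Nk = trans (cong +_ d≡) (trans (ℤ.pos-* k N) (ℤ.*-comm (+ k) (+ N)))
          divided : ∃ λ z′ → (∀ i → z i ≡ + N * z′ i) × (Nm (ev θ z′) ≈ ((+ k) ^ M * R) • 𝟙)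
          divided = divide z {(+ k) ^ M * R} (≈-trans h (≗⇒≈ λ i → cong (_* 𝟙 i)
            (trans (cong (λ x → x ^ M * R) d≡Nk) (trans (cong (_* R) (^-distrib-* (+ N) (+ k) M)) (ℤ.*-assoc ((+ N) ^ M) ((+ k) ^ M) R)))))
          z₀′≡ : ∀ i → toℕ i ≡ 0 → proj₁ divided i ≡ + k * X
          z₀′≡ i i≡0 = *-cancelˡ {+ N} (λ ()) (trans (sym (proj₁ (proj₂ divided) i))
            (trans (z₀≡ i i≡0) (trans (cong (_* X) d≡Nk) (ℤ.*-assoc (+ N) (+ k) X))))

-- From ℚ to the integral group ring

module ℚSolver = Data.Rational.Solver.+-*-Solver

toℚᵘ-⟦⟧ : ∀ a → toℚᵘ ⟦ a ⟧ ℚᵘ.≃ ℚᵘ.mkℚᵘ a 0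
toℚᵘ-⟦⟧ a = ℚ.toℚᵘ-fromℚᵘ (ℚᵘ.mkℚᵘ a 0)

⟦⟧-+ : ∀ a b → ⟦ a + b ⟧ ≡ ⟦ a ⟧ ℚ.+ ⟦ b ⟧
⟦⟧-+ a b = ℚ.toℚᵘ-injective (ℚᵘ.≃-trans (toℚᵘ-⟦⟧ (a + b)) (ℚᵘ.≃-sym (ℚᵘ.≃-trans (ℚ.toℚᵘ-homo-+ ⟦ a ⟧ ⟦ b ⟧)
  (ℚᵘ.≃-trans (ℚᵘ.+-cong (toℚᵘ-⟦⟧ a) (toℚᵘ-⟦⟧ b)) (ℚᵘ.*≡* (lem a b))))))
  where
  lem : ∀ a b → (a * 1ℤ + b * 1ℤ) * 1ℤ ≡ (a + b) * 1ℤ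
  lem = solve-∀

⟦⟧-* : ∀ a b → ⟦ a * b ⟧ ≡ ⟦ a ⟧ ℚ.* ⟦ b ⟧
⟦⟧-* a b = ℚ.toℚᵘ-injective (ℚᵘ.≃-trans (toℚᵘ-⟦⟧ (a * b)) (ℚᵘ.≃-sym (ℚᵘ.≃-trans (ℚ.toℚᵘ-homo-* ⟦ a ⟧ ⟦ b ⟧)
  (ℚᵘ.≃-trans (ℚᵘ.*-cong (toℚᵘ-⟦⟧ a) (toℚᵘ-⟦⟧ b)) (ℚᵘ.*≡* refl)))))

⟦⟧-injective : ∀ {a b} → ⟦ a ⟧ ≡ ⟦ b ⟧ → a ≡ b
⟦⟧-injective {a} {b} eq with ℚᵘ.≃-trans (ℚᵘ.≃-sym (toℚᵘ-⟦⟧ a)) (ℚᵘ.≃-trans (ℚᵘ.≃-reflexive (cong toℚᵘ eq)) (toℚᵘ-⟦⟧ b))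
... | ℚᵘ.*≡* p = trans (sym (ℤ.*-identityʳ a)) (trans p (ℤ.*-identityʳ b))

⟦⟧-neg : ∀ a → ⟦ - a ⟧ ≡ ℚ.- ⟦ a ⟧
⟦⟧-neg a = begin
  ⟦ - a ⟧                                ≡⟨ solve 2 (λ x y → x := x :+ y :- y) refl ⟦ - a ⟧ ⟦ a ⟧ ⟩
  ⟦ - a ⟧ ℚ.+ ⟦ a ⟧ ℚ.- ⟦ a ⟧            ≡⟨ cong (ℚ._- ⟦ a ⟧) (⟦⟧-+ (- a) a) ⟨
  ⟦ - a + a ⟧ ℚ.- ⟦ a ⟧                  ≡⟨ cong (λ z → ⟦ z ⟧ ℚ.- ⟦ a ⟧) (ℤ.+-inverseˡ a) ⟩
  0ℚ ℚ.- ⟦ a ⟧                           ≡⟨ ℚ.+-identityˡ _ ⟩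
  ℚ.- ⟦ a ⟧                              ∎
  where
  open ≡-Reasoning
  open ℚSolver using (solve; _:=_; _:+_; _:*_; _:-_; :-_)

⟦⟧-− : ∀ a b → ⟦ a - b ⟧ ≡ ⟦ a ⟧ ℚ.- ⟦ b ⟧
⟦⟧-− a b = trans (⟦⟧-+ a (- b)) (cong (λ z → ⟦ a ⟧ ℚ.+ z) (⟦⟧-neg b))

sumℚ-cong : ∀ {k} {f g : Fin k → ℚ} → f ≗ g → sumℚ f ≡ sumℚ g
sumℚ-cong {zero}  p = refl
sumℚ-cong {suc k} p = cong₂ ℚ._+_ (p zero) (sumℚ-cong (p ∘ suc))

sumℚ-* : ∀ {k} c (f : Fin k → ℚ) → sumℚ (λ i → c ℚ.* f i) ≡ c ℚ.* sumℚ f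
sumℚ-* {zero}  c f = sym (ℚ.*-zeroʳ c)
sumℚ-* {suc k} c f = trans (cong (λ z → c ℚ.* f zero ℚ.+ z) (sumℚ-* c (f ∘ suc))) (sym (ℚ.*-distribˡ-+ c (f zero) (sumℚ (f ∘ suc))))

⟦⟧-sum : ∀ {k} (f : Fin k → ℤ) → ⟦ sum f ⟧ ≡ sumℚ (λ i → ⟦ f i ⟧)
⟦⟧-sum {zero}  f = refl
⟦⟧-sum {suc k} f = trans (⟦⟧-+ (f zero) (sum (f ∘ suc))) (cong (λ z → ⟦ f zero ⟧ ℚ.+ z) (⟦⟧-sum (f ∘ suc)))

⟦⟧-^ : ∀ a k → ⟦ a ^ k ⟧ ≡ ⟦ a ⟧ ^ℚ k
⟦⟧-^ a zero    = refl
⟦⟧-^ a (suc k) = trans (⟦⟧-* a (a ^ k)) (cong (λ z → ⟦ a ⟧ ℚ.* z) (⟦⟧-^ a k))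

⊗-cong-scale : ∀ {M} {a a′ b b′ : Cyc M} c d → (∀ i → a i ≡ c ℚ.* a′ i) → (∀ i → b i ≡ d ℚ.* b′ i) →
  ∀ i → (a ⊗ b) i ≡ c ℚ.* d ℚ.* (a′ ⊗ b′) i
⊗-cong-scale {M} {a} {a′} {b} {b′} c d p q k = trans
  (sumℚ-cong λ i → trans (cong₂ ℚ._*_ (p i) (q (index i))) (solve 4 (λ c x d y → (c :* x) :* (d :* y) := (c :* d) :* (x :* y)) refl c (a′ i) d (b′ (index i))))
  (sumℚ-* (c ℚ.* d) (λ i → a′ i ℚ.* b′ (index i)))
  where
  open ℚSolver using (solve; _:=_; _:*_)
  index : Fin (suc M) → Fin (suc M)
  index i = (toℕ k ℕ.+ (suc M ℕ.∸ toℕ i)) ℕ.mod suc M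

⊗-cong : ∀ {M} {a a′ b b′ : Cyc M} → a ≗ a′ → b ≗ b′ → a ⊗ b ≗ a′ ⊗ b′
⊗-cong {M} p q k = sumℚ-cong λ i → cong₂ ℚ._*_ (p i) (q ((toℕ k ℕ.+ (suc M ℕ.∸ toℕ i)) ℕ.mod suc M))

module Transfer (M : ℕ) (M≢0 : M ≢ 0) (N-prime : Prime (suc M)) where
  open GroupRing M
  open Norm M N-prime
  open Uniformiser M N-prime renaming (θ to ϑ)
  open Descent M M≢0 N-prime

  ⟦⟧-⊛ : ∀ a b k → ⟦ (a ⊛ b) k ⟧ ≡ (_⊗_ {M} (λ i → ⟦ a i ⟧) (λ i → ⟦ b i ⟧)) k
  ⟦⟧-⊛ a b k = trans (cong ⟦_⟧ (⊛-def a b k)) (trans (⟦⟧-sum (λ i → a i * b (k ⊝ i)))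
    (sumℚ-cong λ i → trans (⟦⟧-* (a i) (b (k ⊝ i))) (cong (λ l → ⟦ a i ⟧ ℚ.* ⟦ b l ⟧) (⊝-mod k i))))

  ⟦⟧-Z^ : ∀ k i → ⟦ Z^ k i ⟧ ≡ ζ^ M k i
  ⟦⟧-Z^ k i = trans (cong (λ l → ⟦ δ l i ⟧) (res-mod k)) (push (toℕ i ≡ᵇ toℕ (k ℕ.mod N)))
    where
    push : ∀ c → ⟦ (if c then 1ℤ else 0ℤ) ⟧ ≡ (if c then 1ℚ else 0ℚ)
    push true  = refl
    push false = refl

  ⟦⟧-^ᴳ : ∀ {a c} → (∀ i → ⟦ a i ⟧ ≡ c i) → ∀ k i → ⟦ (a ^ᴳ k) i ⟧ ≡ (_^ᶜ_ {M} c k) i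
  ⟦⟧-^ᴳ p zero    i = ⟦⟧-Z^ 0 i
  ⟦⟧-^ᴳ {a} {c} p (suc k) i = trans (⟦⟧-⊛ a (a ^ᴳ k) i) (⊗-cong {M} {λ j → ⟦ a j ⟧} {c} p (⟦⟧-^ᴳ p k) i)

  θ^ : ℕ → Cyc M
  θ^ m = ζ^ M 0 ⊖ ζ^ M m

  conj-ϑ : ∀ m i → ⟦ conj m ϑ i ⟧ ≡ θ^ (suc (toℕ m)) i
  conj-ϑ m i = trans (⟦⟧-+ (conj m 𝟙 i) (- conj m (Z^ 1) i)) (cong₂ ℚ._+_
    (trans (cong ⟦_⟧ (τ-𝟙 (inv-inverse m) i)) (⟦⟧-Z^ 0 i))
    (trans (⟦⟧-neg (conj m (Z^ 1) i)) (cong ℚ.-_ (trans (cong ⟦_⟧ (Conjugation.τ-Z^ m 1 i))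
      (trans (⟦⟧-Z^ (suc (toℕ m) ℕ.* 1) i) (cong (λ k → ζ^ M k i) (ℕ.*-identityʳ (suc (toℕ m)))))))))

  conj-ev : ∀ m a {k} (z : Fin k → ℤ) → conj m (ev a z) ≗ ev (conj m a) z
  conj-ev m a {zero}  z i = refl
  conj-ev m a {suc k} z i = cong₂ _+_ (cong (z zero *_) (τ-𝟙 (inv-inverse m) i))
    (trans (Conjugation.τ-⊛ m a (ev a (z ∘ suc)) i) (⊛-cong {conj m a} {conj m a} (λ _ → refl) (conj-ev m a (z ∘ suc)) i))

  private
    ⊛-sum : ∀ a {k} (c : Fin k → ℤ) (b : Fin k → ZG) → a ⊛ (λ i → sum (λ j → c j * b j i)) ≗ λ i → sum (λ j → c j * (a ⊛ b j) i)
    ⊛-sum a {zero}  c b i = ⊛-𝟘 a i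
    ⊛-sum a {suc k} c b i = trans (⊛-distribˡ a (c zero • b zero) (λ l → sum (λ j → c (suc j) * b (suc j) l)) i)
      (cong₂ _+_ (⊛-•ʳ (c zero) a (b zero) i) (⊛-sum a (c ∘ suc) (b ∘ suc) i))

  ev-sum : ∀ a {k} (z : Fin k → ℤ) → ev a z ≗ λ i → sum (λ j → z j * (a ^ᴳ toℕ j) i)
  ev-sum a {zero}  z i = refl
  ev-sum a {suc k} z i = cong (λ y → z zero * 𝟙 i + y)
    (trans (⊛-cong {a} {a} (λ _ → refl) (ev-sum a (z ∘ suc)) i) (⊛-sum a (z ∘ suc) (λ j → a ^ᴳ toℕ j) i))

  sumᶜ-at : ∀ {k} (f : Fin k → Cyc M) i → sumᶜ {M} f i ≡ sumℚ (λ j → f j i)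
  sumᶜ-at {zero}  f i = ℚ.*-zeroˡ (ζ^ M 0 i)
  sumᶜ-at {suc k} f i = cong (λ z → f zero i ℚ.+ z) (sumᶜ-at (f ∘ suc) i)

  factor : ∀ {k} → ℚ → (Fin k → ℚ) → ℕ → Cyc M
  factor x y m = ι M x ⊕ sumᶜ λ j → y j · (θ^ m ^ᶜ suc (toℕ j))

  conj-factor : ∀ {k} d x (y : Fin k → ℚ) (z : Fin (suc k) → ℤ) → ⟦ z zero ⟧ ≡ d ℚ.* x → (∀ j → ⟦ z (suc j) ⟧ ≡ d ℚ.* y j) →
    ∀ m i → ⟦ conj m (ev ϑ z) i ⟧ ≡ d ℚ.* factor x y (suc (toℕ m)) i
  conj-factor d x y z z₀≡ z≡ m i = begin
    ⟦ conj m (ev ϑ z) i ⟧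
      ≡⟨ cong ⟦_⟧ (trans (conj-ev m ϑ z i) (ev-sum ϑm z i)) ⟩
    ⟦ z zero * 𝟙 i + sum (λ j → z (suc j) * (ϑm ^ᴳ suc (toℕ j)) i) ⟧
      ≡⟨ ⟦⟧-+ (z zero * 𝟙 i) (sum (λ j → z (suc j) * (ϑm ^ᴳ suc (toℕ j)) i)) ⟩
    ⟦ z zero * 𝟙 i ⟧ ℚ.+ ⟦ sum (λ j → z (suc j) * (ϑm ^ᴳ suc (toℕ j)) i) ⟧
      ≡⟨ cong₂ ℚ._+_ head tail ⟩
    d ℚ.* ι M x i ℚ.+ d ℚ.* sumᶜ {M} (λ j → y j · (θ^ (suc (toℕ m)) ^ᶜ suc (toℕ j))) i
      ≡⟨ ℚ.*-distribˡ-+ d (ι M x i) _ ⟨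
    d ℚ.* factor x y (suc (toℕ m)) i ∎
    where
    open ≡-Reasoning
    ϑm : ZG
    ϑm = conj m ϑ
    head : ⟦ z zero * 𝟙 i ⟧ ≡ d ℚ.* ι M x i
    head = trans (⟦⟧-* (z zero) (𝟙 i)) (trans (cong₂ ℚ._*_ z₀≡ (⟦⟧-Z^ 0 i)) (ℚ.*-assoc d x (ζ^ M 0 i)))
    tail : ⟦ sum (λ j → z (suc j) * (ϑm ^ᴳ suc (toℕ j)) i) ⟧ ≡ d ℚ.* sumᶜ {M} (λ j → y j · (θ^ (suc (toℕ m)) ^ᶜ suc (toℕ j))) i
    tail = trans (⟦⟧-sum (λ j → z (suc j) * (ϑm ^ᴳ suc (toℕ j)) i)) (trans (sumℚ-cong λ j →
        trans (⟦⟧-* (z (suc j)) ((ϑm ^ᴳ suc (toℕ j)) i)) (trans (cong₂ ℚ._*_ (z≡ j) (⟦⟧-^ᴳ {ϑm} (conj-ϑ m) (suc (toℕ j)) i))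
          (ℚ.*-assoc d (y j) _)))
      (trans (sumℚ-* d (λ j → y j ℚ.* (θ^ (suc (toℕ m)) ^ᶜ suc (toℕ j)) i))
        (cong (λ z → d ℚ.* z) (sym (sumᶜ-at (λ j → y j · (θ^ (suc (toℕ m)) ^ᶜ suc (toℕ j))) i)))))

  ∏-prodᶜ : ∀ d {k} (f : Fin k → ZG) (g : Fin k → Cyc M) → (∀ m i → ⟦ f m i ⟧ ≡ d ℚ.* g m i) →
    ∀ i → ⟦ ∏ f i ⟧ ≡ d ^ℚ k ℚ.* prodᶜ {M} g i
  ∏-prodᶜ d {zero}  f g h i = trans (⟦⟧-Z^ 0 i) (sym (ℚ.*-identityˡ (ζ^ M 0 i)))
  ∏-prodᶜ d {suc k} f g h i = trans (⟦⟧-⊛ (f zero) (∏ (f ∘ suc)) i)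
    (⊗-cong-scale {M} {λ j → ⟦ f zero j ⟧} {g zero} d (d ^ℚ k) (h zero) (∏-prodᶜ d (f ∘ suc) (g ∘ suc) (h ∘ suc)) i)

  -- The constant c in `≈ᶜ` is only rational. After scaling, the difference of the two sides is -d^M
  -- c at every index; its entries are integers, so the entry at `zero` is the integral constant
  -- wanted.
  normForm-clear-denominators : ∀ {k} d x r R (y : Fin k → ℚ) (z : Fin (suc k) → ℤ) →
    ⟦ z zero ⟧ ≡ d ℚ.* x → (∀ j → ⟦ z (suc j) ⟧ ≡ d ℚ.* y j) → ⟦ R ⟧ ≡ d ^ℚ M ℚ.* r →
    ι M r ≈ᶜ prodᶜ {M} {M} (λ m → factor x y (suc (toℕ m))) → Nm (ev ϑ z) ≈ R • 𝟙
  normForm-clear-denominators d x r R y z z₀≡ z≡ R≡ (c , h) = difference zero , λ i →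
    trans (lem (Nm (ev ϑ z) i) (R * 𝟙 i)) (cong (λ e → R * 𝟙 i + e) (⟦⟧-injective (trans (difference-≡ i) (sym (difference-≡ zero)))))
    where
    difference : ZG
    difference i = Nm (ev ϑ z) i - R * 𝟙 i
    lem : ∀ a b → a ≡ b + (a - b)
    lem = solve-∀
    difference-≡ : ∀ i → ⟦ difference i ⟧ ≡ ℚ.- (d ^ℚ M ℚ.* c)
    difference-≡ i = begin
      ⟦ Nm (ev ϑ z) i - R * 𝟙 i ⟧
        ≡⟨ ⟦⟧-− (Nm (ev ϑ z) i) (R * 𝟙 i) ⟩
      ⟦ Nm (ev ϑ z) i ⟧ ℚ.- ⟦ R * 𝟙 i ⟧
        ≡⟨ cong₂ ℚ._-_ (∏-prodᶜ d (λ m → conj m (ev ϑ z)) (λ m → factor x y (suc (toℕ m))) (conj-factor d x y z z₀≡ z≡) i)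
                       (trans (⟦⟧-* R (𝟙 i)) (cong₂ ℚ._*_ R≡ (⟦⟧-Z^ 0 i))) ⟩
      D ℚ.* P ℚ.- D ℚ.* r ℚ.* ζ^ M 0 i
        ≡⟨ solve 4 (λ D P r e → D :* P :- D :* r :* e := :- (D :* (r :* e :- P))) refl D P r (ζ^ M 0 i) ⟩
      ℚ.- (D ℚ.* (ι M r i ℚ.- P))
        ≡⟨ cong (λ e → ℚ.- (D ℚ.* e)) (h i) ⟩
      ℚ.- (D ℚ.* c) ∎
      where
      open ≡-Reasoning
      open ℚSolver using (solve; _:=_; _:+_; _:*_; _:-_; :-_)
      D P : ℚ
      D = d ^ℚ M
      P = prodᶜ {M} {M} (λ m → factor x y (suc (toℕ m))) i

-- Unitary divisors of norms

⊥-factorˡ : ∀ {a b c} → a * b ⊥ c → a ⊥ c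
⊥-factorˡ {a} {b} {c} (x , y , p) = x * b , y , trans (lem x a b (y * c)) p
  where
  lem : ∀ x a b z → x * b * a + z ≡ x * (a * b) + z
  lem = solve-∀

⊥-factorʳ : ∀ {a b c} → a * b ⊥ c → b ⊥ c
⊥-factorʳ {a} {b} {c} h = ⊥-factorˡ {b} {a} (subst (_⊥ c) (ℤ.*-comm a b) h)

pos-^ : ∀ m k → + (m ℕ.^ k) ≡ (+ m) ^ k
pos-^ m zero    = refl
pos-^ m (suc k) = trans (ℤ.pos-* m (m ℕ.^ k)) (cong (+ m *_) (pos-^ m k))

∣∣-square : ∀ a → + ∣ a ∣ * + ∣ a ∣ ≡ a * a
∣∣-square (+ n)    = refl
∣∣-square -[1+ n ] = refl

sign-decomposition : ∀ a → ∃ λ s → (a ≡ s * + ∣ a ∣) × ∀ c → s ⊥ c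
sign-decomposition (+ n)    = 1ℤ , sym (ℤ.*-identityˡ (+ n)) , ⊥-1
sign-decomposition -[1+ n ] = - 1ℤ , sym (ℤ.-1*i≡-i (+ suc n)) , λ c → ⊥-neg (⊥-1 c)

-- `part` collects the prime powers of d at primes dividing u; `part-⊥` expresses this without
-- mentioning primes.
record Split (d u : ℕ) : Set where
  field
    part cofactor : ℕ
    split         : d ≡ part ℕ.* cofactor
    cofactor-⊥    : + u ⊥ + cofactor
    part-⊥        : ∀ c → + u ⊥ c → + part ⊥ c

-- While g = gcd(u, d) exceeds 1, g goes into `part` and d is replaced by the smaller d / g.
splitting : ∀ d u .{{_ : ℕ.NonZero d}} → Split d u
splitting d u = go d (<-wellFounded d)
  where
  module _ (d : ℕ) {{d≢0 : ℕ.NonZero d}} (rec : ∀ {e} → e ℕ.< d → .{{_ : ℕ.NonZero e}} → Split e u) where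
    by-gcd : ∀ g → gcd u d ≡ g → Split d u
    by-gcd 0 eq = contradiction eq (gcd[m,n]≢0 u d (inj₂ (ℕ.≢-nonZero⁻¹ d)))
    by-gcd 1 eq = record { part = 1 ; cofactor = d ; split = sym (ℕ.*-identityˡ d)
      ; cofactor-⊥ = coprime⇒⊥ (gcd≡1⇒coprime eq) ; part-⊥ = λ c _ → ⊥-1 c }
    by-gcd g@(suc (suc _)) eq with subst (ℕ._∣ d) eq (gcd[m,n]∣n u d) | subst (ℕ._∣ u) eq (gcd[m,n]∣m u d)
    ... | ℕ.divides e d≡ | ℕ.divides f u≡ = record
      { part = g ℕ.* part ; cofactor = cofactor
      ; split = trans d≡ (trans (cong (ℕ._* g) split) (trans (ℕ.*-comm (part ℕ.* cofactor) g) (sym (ℕ.*-assoc g part cofactor))))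
      ; cofactor-⊥ = cofactor-⊥
      ; part-⊥ = λ c h → subst (_⊥ c) (sym (ℤ.pos-* g part))
          (⊥-* (⊥-factorʳ {+ f} (subst (_⊥ c) (trans (cong +_ u≡) (ℤ.pos-* f g)) h)) (part-⊥ c h)) }
      where
      e≢0 : ℕ.NonZero e
      e≢0 = ℕ.≢-nonZero λ { refl → ℕ.≢-nonZero⁻¹ d d≡ }
      open Split (rec {e} (subst (e ℕ.<_) (sym d≡) (ℕ.m<m*n e g {{e≢0}} (ℕ.s≤s (ℕ.s≤s ℕ.z≤n)))) {{e≢0}})
  go : ∀ d → Acc ℕ._<_ d → .{{_ : ℕ.NonZero d}} → Split d u
  go d@(suc _) (acc rec) = by-gcd d (λ {e} e<d → go e (rec e<d)) (gcd u d) refl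

module Unitary (M : ℕ) (M≢0 : M ≢ 0) (N-prime : Prime (suc M)) where
  open GroupRing M
  open Norm M N-prime
  open Uniformiser M N-prime renaming (θ to ϑ)
  open Descent M M≢0 N-prime

  Nm-𝟙 : Nm 𝟙 ≈ 𝟙
  Nm-𝟙 = go M (λ m → conj m 𝟙) λ m → ≗⇒≈ (τ-𝟙 (inv-inverse m))
    where
    go : ∀ k (f : Fin k → ZG) → (∀ i → f i ≈ 𝟙) → ∏ f ≈ 𝟙
    go zero    f h = ≈-refl {𝟙}
    go (suc k) f h = ≈-trans (⊛-≈ (h zero) (go k (f ∘ suc) (h ∘ suc))) (≗⇒≈ (⊛-identityˡ 𝟙))

  -- The case of `unitary-divisor` in which b is the scalar d: its norm is d^M, and u = d^M, w = 1.
  fermat : ∀ d .{{_ : ℕ.NonZero d}} → + d ⊥ + N → (+ d) ^ M ≋ 1ℤ [ + N ]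
  fermat d d⊥N = subst (λ a → a ≋ 1ℤ [ + N ]) (pos-^ d M) (unitary-divisor M≢0 {(+ d) • 𝟙} {d ℕ.^ M} {1ℤ} {{ℕ.m^n≢0 d M}}
    (⊥-sym (⊥-1 (+ (d ℕ.^ M)))) (subst (_⊥ + N) (sym (pos-^ d M)) (^-⊥ d⊥N M))
    (≈-trans (≗⇒≈ (Nm-• (+ d) 𝟙)) (≈-trans (•-≈ ((+ d) ^ M) Nm-𝟙) (≗⇒≈ λ i →
      cong (_* 𝟙 i) (trans (sym (pos-^ d M)) (sym (ℤ.*-identityʳ (+ (d ℕ.^ M)))))))))

  -- The part of d ^ M supported at the primes of u is a norm, so it may be absorbed into u.
  unitary-factor : ∀ {b u w} d .{{_ : ℕ.NonZero d}} → u ≢ 0ℤ → u ⊥ w → u ⊥ + N →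
    Nm b ≈ ((+ d) ^ M * (u * w)) • 𝟙 → + ∣ u ∣ ≋ 1ℤ [ + N ]
  unitary-factor {b} {u} {w} d u≢0 u⊥w u⊥N h = ≋-trans (≡⇒≋ (sym (ℤ.*-identityʳ (+ v))))
    (≋-trans (*-≋ (≋-refl (+ v)) (≋-sym (fermat part {{part≢0}} part⊥N))) (≋-trans (≡⇒≋ (sym v′≡)) v′≋1))
    where
    v : ℕ
    v = ∣ u ∣
    s : ℤ
    s = proj₁ (sign-decomposition u)
    u≡sv : u ≡ s * + v
    u≡sv = proj₁ (proj₂ (sign-decomposition u))
    s⊥ : ∀ c → s ⊥ c
    s⊥ = proj₂ (proj₂ (sign-decomposition u))
    v⊥ : ∀ {c} → u ⊥ c → + v ⊥ c
    v⊥ {c} p = ⊥-factorʳ {s} (subst (_⊥ c) u≡sv p)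
    open Split (splitting d v)
    part≢0 : ℕ.NonZero part
    part≢0 = ℕ.≢-nonZero λ eq → ℕ.≢-nonZero⁻¹ d (trans split (cong (ℕ._* cofactor) eq))
    part⊥N : + part ⊥ + N
    part⊥N = part-⊥ (+ N) (v⊥ u⊥N)
    v′ : ℕ
    v′ = v ℕ.* part ℕ.^ M
    -- `unitary-divisor` expects a natural divisor, so the sign of u is moved into the cofactor.
    w′ : ℤ
    w′ = s * w * (+ cofactor) ^ M
    v′≡ : + v′ ≡ + v * (+ part) ^ M
    v′≡ = trans (ℤ.pos-* v (part ℕ.^ M)) (cong (+ v *_) (pos-^ part M))
    v′≢0 : ℕ.NonZero v′
    v′≢0 = ℕ.m*n≢0 v (part ℕ.^ M) {{ℕ.≢-nonZero (u≢0 ∘ ℤ.∣i∣≡0⇒i≡0)}} {{ℕ.m^n≢0 part M {{part≢0}}}}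
    v′⊥ : ∀ {c} → + v ⊥ c → + v′ ⊥ c
    v′⊥ {c} p = subst (_⊥ c) (sym v′≡) (⊥-* p (^-⊥ (part-⊥ c p) M))
    v′⊥w′ : + v′ ⊥ w′
    v′⊥w′ = v′⊥ (⊥-*ʳ {s * w} {(+ cofactor) ^ M} (⊥-*ʳ {s} {w} (⊥-sym (s⊥ (+ v))) (v⊥ u⊥w)) (⊥-sym (^-⊥ (⊥-sym cofactor-⊥) M)))
    regroup : (+ d) ^ M * (u * w) ≡ + v′ * w′
    regroup = begin
      (+ d) ^ M * (u * w)
        ≡⟨ cong₂ (λ x y → x ^ M * (y * w)) (trans (cong +_ split) (ℤ.pos-* part cofactor)) u≡sv ⟩
      (+ part * + cofactor) ^ M * (s * + v * w)
        ≡⟨ cong (_* (s * + v * w)) (^-distrib-* (+ part) (+ cofactor) M) ⟩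
      (+ part) ^ M * (+ cofactor) ^ M * (s * + v * w)
        ≡⟨ lem ((+ part) ^ M) ((+ cofactor) ^ M) s (+ v) w ⟩
      + v * (+ part) ^ M * w′
        ≡⟨ cong (_* w′) v′≡ ⟨
      + v′ * w′ ∎
      where
      open ≡-Reasoning
      lem : ∀ p c s v w → p * c * (s * v * w) ≡ v * p * (s * w * c)
      lem = solve-∀
    v′≋1 : + v′ ≋ 1ℤ [ + N ]
    v′≋1 = unitary-divisor M≢0 {b} {v′} {w′} {{v′≢0}} v′⊥w′ (v′⊥ (v⊥ u⊥N))
      (≈-trans h (≗⇒≈ λ i → cong (_* 𝟙 i) regroup))

  -- `F≡₁` reads F modulo T, for the coprimality of the factors; `F≡₂` reads it modulo X, for the
  -- case N ∣ X. `P⊥` expresses that P = N^β has no prime factor other than N.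
  module _ {T X F F′ τ α P G H R : ℤ} {k : ℕ} (3<N : 3 ℕ.< N)
    (τ≡ : τ ≡ T ^ suc k) (F′≡ : F′ ≡ F + τ) (F≡₁ : F ≡ T * G + P * X ^ suc k) (F≡₂ : F ≡ α * τ + X * H)
    (R≡ : R ≡ T * T * (F * F′)) (T⊥X : T ⊥ X) (α⊥N : α * (α + 1ℤ) ⊥ + N) (P⊥ : ∀ {c} → c ⊥ + N → c ⊥ P)
    (z : Fin M → ℤ) (d : ℕ) {{_ : ℕ.NonZero d}} (z₀≡ : ∀ i → toℕ i ≡ 0 → z i ≡ + d * X)
    (norm : Nm (ev ϑ z) ≈ ((+ d) ^ M * R) • 𝟙) where

    private

      R⊥N : R ⊥ + N
      R⊥N = by-cases (≋0? (+ N) X)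
        where
        by-cases : Dec (X ≋ 0ℤ [ + N ]) → R ⊥ + N
        by-cases (no X≢0)  = prime-∤⇒⊥ N-prime (Nm-unit X≢0 d z z₀≡ norm)
        by-cases (yes X≋0) = ⊥-≋ (≋-trans (≡⇒≋ R≡) (*-≋ (≋-refl (T * T)) (*-≋ F≋ F′≋)))
          (⊥-* (⊥-* T⊥N T⊥N) (⊥-* (⊥-* (⊥-factorˡ {α} α⊥N) τ⊥N) (⊥-* (⊥-factorʳ {α} α⊥N) τ⊥N)))
          where
          T⊥N : T ⊥ + N
          T⊥N = prime-∤⇒⊥ N-prime λ T≋0 → ⊥⇒≢0 N-prime (⊥-1 (+ N)) (combine T⊥X T≋0 X≋0)
            where
            combine : ∀ {m} → T ⊥ X → T ≋ 0ℤ [ m ] → X ≋ 0ℤ [ m ] → 1ℤ ≋ 0ℤ [ m ]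
            combine (x , y , p) T≋0 X≋0 = ≋-trans (≡⇒≋ (sym p)) (≋-trans (+-≋ (*-≋ (≋-refl x) T≋0) (*-≋ (≋-refl y) X≋0))
              (≡⇒≋ (cong₂ _+_ (ℤ.*-zeroʳ x) (ℤ.*-zeroʳ y))))
          τ⊥N : τ ⊥ + N
          τ⊥N = subst (_⊥ + N) (sym τ≡) (^-⊥ T⊥N (suc k))
          F≋ : F ≋ α * τ [ + N ]
          F≋ = ≋-trans (≡⇒≋ F≡₂) (≋-trans (+-≋ (≋-refl (α * τ)) (*-≋ X≋0 (≋-refl H)))
            (≡⇒≋ (trans (cong (λ e → α * τ + e) (ℤ.*-zeroˡ H)) (ℤ.+-identityʳ (α * τ)))))
          F′≋ : F′ ≋ (α + 1ℤ) * τ [ + N ]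
          F′≋ = ≋-trans (≡⇒≋ F′≡) (≋-trans (+-≋ F≋ (≋-refl τ)) (≡⇒≋ (lem α τ)))
            where
            lem : ∀ a t → a * t + t ≡ (a + 1ℤ) * t
            lem = solve-∀

      factors⊥N : T * T * (F * F′) ⊥ + N
      factors⊥N = subst (_⊥ + N) R≡ R⊥N
      TT⊥N : T * T ⊥ + N
      TT⊥N = ⊥-factorˡ {T * T} {F * F′} factors⊥N
      T⊥N : T ⊥ + N
      T⊥N = ⊥-factorˡ {T} {T} TT⊥N
      F⊥N : F ⊥ + N
      F⊥N = ⊥-factorˡ {F} {F′} (⊥-factorʳ {T * T} {F * F′} factors⊥N)
      F′⊥N : F′ ⊥ + N
      F′⊥N = ⊥-factorʳ {F} {F′} (⊥-factorʳ {T * T} {F * F′} factors⊥N)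

      -- Modulo T only P X^(k+1) is left of F. X is prime to T, and P is too because T is prime to
      -- N; so N ∤ R has to be settled before this.
      F⊥T : F ⊥ T
      F⊥T = ⊥-≋ (≋-trans (≡⇒≋ F≡₁) (G , lem T G (P * X ^ suc k))) (⊥-* (⊥-sym (P⊥ T⊥N)) (^-⊥ (⊥-sym T⊥X) (suc k)))
        where
        lem : ∀ t g e → t * g + e ≡ e + g * t
        lem = solve-∀
      τ⊥F : τ ⊥ F
      τ⊥F = subst (_⊥ F) (sym τ≡) (^-⊥ (⊥-sym F⊥T) (suc k))
      F′⊥F : F′ ⊥ F
      F′⊥F = ⊥-≋ (1ℤ , trans F′≡ (lem F τ)) τ⊥F
        where
        lem : ∀ f t → f + t ≡ t + 1ℤ * f
        lem = solve-∀
      F′⊥T : F′ ⊥ T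
      F′⊥T = ⊥-≋ (T ^ k , trans F′≡ (cong (λ e → F + e) (trans τ≡ (ℤ.*-comm T (T ^ k))))) F⊥T

      ⊥N⇒≢0 : ∀ {a} → a ⊥ + N → a ≢ 0ℤ
      ⊥N⇒≢0 h refl = ⊥⇒≢0 N-prime h (≋-refl 0ℤ)

      size≋1 : ∀ u w → R ≡ u * w → u ⊥ w → u ⊥ + N → + ∣ u ∣ ≋ 1ℤ [ + N ]
      size≋1 u w R≡uw u⊥w u⊥N = unitary-factor {ev ϑ z} {u} {w} d (⊥N⇒≢0 u⊥N) u⊥w u⊥N
        (≈-trans norm (≗⇒≈ λ i → cong (λ e → (+ d) ^ M * e * 𝟙 i) R≡uw))

      square≋1 : ∀ {u} → + ∣ u ∣ ≋ 1ℤ [ + N ] → u * u ≋ 1ℤ [ + N ]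
      square≋1 {u} h = ≋-trans (≡⇒≋ (sym (∣∣-square u))) (*-≋ h h)

      -- In R = T² F F′ it is T², not T, whose coprimality to its cofactor is available.
      T²≋1 : T * T ≋ 1ℤ [ + N ]
      T²≋1 = ≋-trans (≡⇒≋ (trans (sym (∣∣-square T)) (trans (sym (ℤ.pos-* ∣ T ∣ ∣ T ∣)) (cong +_ (sym (ℤ.abs-* T T))))))
        (size≋1 (T * T) (F * F′) R≡ (⊥-* T⊥FF′ T⊥FF′) TT⊥N)
        where
        T⊥FF′ : T ⊥ F * F′
        T⊥FF′ = ⊥-*ʳ {F} {F′} (⊥-sym F⊥T) (⊥-sym F′⊥T)

      F²≋1 : F * F ≋ 1ℤ [ + N ]
      F²≋1 = square≋1 {F} (size≋1 F (T * T * F′) (trans R≡ (lem (T * T) F F′))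
        (⊥-*ʳ {T * T} {F′} (⊥-*ʳ {T} {T} F⊥T F⊥T) (⊥-sym F′⊥F)) F⊥N)
        where
        lem : ∀ t f g → t * (f * g) ≡ f * (t * g)
        lem = solve-∀

      F′²≋1 : F′ * F′ ≋ 1ℤ [ + N ]
      F′²≋1 = square≋1 {F′} (size≋1 F′ (T * T * F) (trans R≡ (lem (T * T) F F′))
        (⊥-*ʳ {T * T} {F} (⊥-*ʳ {T} {T} F′⊥T F′⊥T) F′⊥F) F′⊥N)
        where
        lem : ∀ t f g → t * (f * g) ≡ g * (t * f)
        lem = solve-∀

      τ²≋1 : τ * τ ≋ 1ℤ [ + N ]
      τ²≋1 = ≋-trans (≡⇒≋ (trans (cong₂ _*_ τ≡ τ≡) (sym (^-distrib-* T T (suc k))))) (≋-trans (^-≋ T²≋1 (suc k)) (≡⇒≋ (ℤ.^-zeroˡ (suc k))))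

      -- 1 = F′² = (F + τ)² = 2 + 2 F τ, and (2 F τ)² = 4.
      3≋0 : + 3 ≋ 0ℤ [ + N ]
      3≋0 = ≋-trans (≡⇒≋ (lem₁ F τ)) (≋-trans (+-≋ (*-≋ cross≋ (≋-refl (+ 2 * F * τ - 1ℤ)))
        (*-≋ (≋-refl (- + 4)) (−≋ (*-≋ F²≋1 τ²≋1) (≋-refl 1ℤ)))) (≡⇒≋ (lem₂ F τ)))
        where
        lem₁ : ∀ f t → + 3 ≡ (+ 2 * f * t + 1ℤ) * (+ 2 * f * t - 1ℤ) + - + 4 * (f * f * (t * t) - 1ℤ)
        lem₁ = solve-∀
        lem₂ : ∀ f t → 0ℤ * (+ 2 * f * t - 1ℤ) + - + 4 * (1ℤ * 1ℤ - 1ℤ) ≡ 0ℤ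
        lem₂ = solve-∀
        lem₃ : ∀ f t → + 2 * f * t + 1ℤ ≡ (f + t) * (f + t) - f * f - t * t + 1ℤ
        lem₃ = solve-∀
        cross≋ : + 2 * F * τ + 1ℤ ≋ 0ℤ [ + N ]
        cross≋ = ≋-trans (≡⇒≋ (trans (lem₃ F τ) (cong (λ e → e * e - F * F - τ * τ + 1ℤ) (sym F′≡))))
          (+-≋ (−≋ (−≋ F′²≋1 F²≋1) τ²≋1) (≋-refl 1ℤ))

    no-primitive-solution : Empty.⊥
    no-primitive-solution = ℕ.<⇒≱ 3<N (ℕ.∣⇒≤ (∣⇒∣ᵤ (≋0⇒∣ 3≋0)))

-- The binary form

lowest-terms : ∀ q → Coprime ∣ ℚ.↥ q ∣ (ℚ.↧ₙ q)
lowest-terms (ℚ.mkℚ n d c) = Coprimality.recompute c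

numerator-≡ : ∀ q → ⟦ ℚ.↥ q ⟧ ≡ ⟦ ℚ.↧ q ⟧ ℚ.* q
numerator-≡ q@record{} = ℚ.toℚᵘ-injective (ℚᵘ.≃-trans (toℚᵘ-⟦⟧ (ℚ.↥ q)) (ℚᵘ.≃-sym (ℚᵘ.≃-trans (ℚ.toℚᵘ-homo-* ⟦ ℚ.↧ q ⟧ q)
  (ℚᵘ.≃-trans (ℚᵘ.*-congʳ {toℚᵘ q} (toℚᵘ-⟦⟧ (ℚ.↧ q))) (ℚᵘ.*≡* (lem (ℚ.↧ q) (ℚ.↥ q)))))))
  where
  lem : ∀ d n → d * n * 1ℤ ≡ n * (1ℤ * d)
  lem = solve-∀

common-denominator : ∀ {k} (v : Fin k → ℚ) → ∃ λ d → ℕ.NonZero d × ∃ λ (z : Fin k → ℤ) → ∀ i → ⟦ z i ⟧ ≡ ⟦ + d ⟧ ℚ.* v i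
common-denominator {zero}  v = 1 , _ , (λ ()) , λ ()
common-denominator {suc k} v = e ℕ.* d , ℕ.m*n≢0 e d {{_}} {{d≢0}} , cleared , cleared-≡
  where
  open ℚSolver using (solve; _:=_; _:*_)
  q : ℚ
  q = v zero
  e d : ℕ
  e = ℚ.↧ₙ q
  rest : ∃ λ d → ℕ.NonZero d × ∃ λ (z : Fin k → ℤ) → ∀ i → ⟦ z i ⟧ ≡ ⟦ + d ⟧ ℚ.* v (suc i)
  rest = common-denominator (v ∘ suc)
  d = proj₁ rest
  d≢0 : ℕ.NonZero d
  d≢0 = proj₁ (proj₂ rest)
  z : Fin k → ℤ
  z = proj₁ (proj₂ (proj₂ rest))
  z≡ : ∀ i → ⟦ z i ⟧ ≡ ⟦ + d ⟧ ℚ.* v (suc i)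
  z≡ = proj₂ (proj₂ (proj₂ rest))
  ed≡ : ⟦ + (e ℕ.* d) ⟧ ≡ ⟦ + e ⟧ ℚ.* ⟦ + d ⟧
  ed≡ = trans (cong ⟦_⟧ (ℤ.pos-* e d)) (⟦⟧-* (+ e) (+ d))
  cleared : Fin (suc k) → ℤ
  cleared zero    = + d * ℚ.↥ q
  cleared (suc i) = + e * z i
  cleared-≡ : ∀ i → ⟦ cleared i ⟧ ≡ ⟦ + (e ℕ.* d) ⟧ ℚ.* v i
  cleared-≡ zero = trans (⟦⟧-* (+ d) (ℚ.↥ q)) (trans (cong (λ x → ⟦ + d ⟧ ℚ.* x) (numerator-≡ q))
    (trans (solve 3 (λ x y q → x :* (y :* q) := (y :* x) :* q) refl ⟦ + d ⟧ ⟦ + e ⟧ q) (cong (ℚ._* q) (sym ed≡))))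
  cleared-≡ (suc i) = trans (⟦⟧-* (+ e) (z i)) (trans (cong (λ x → ⟦ + e ⟧ ℚ.* x) (z≡ i))
    (trans (sym (ℚ.*-assoc ⟦ + e ⟧ ⟦ + d ⟧ (v (suc i)))) (cong (ℚ._* v (suc i)) (sym ed≡))))

^ℚ-+ : ∀ q m n → q ^ℚ (m ℕ.+ n) ≡ q ^ℚ m ℚ.* q ^ℚ n
^ℚ-+ q zero    n = sym (ℚ.*-identityˡ (q ^ℚ n))
^ℚ-+ q (suc m) n = trans (cong (λ x → q ℚ.* x) (^ℚ-+ q m n)) (sym (ℚ.*-assoc q (q ^ℚ m) (q ^ℚ n)))

^ℚ-distrib-* : ∀ a b k → (a ℚ.* b) ^ℚ k ≡ a ^ℚ k ℚ.* b ^ℚ k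
^ℚ-distrib-* a b zero    = refl
^ℚ-distrib-* a b (suc k) = trans (cong (λ x → a ℚ.* b ℚ.* x) (^ℚ-distrib-* a b k))
  (solve 4 (λ a b c d → (a :* b) :* (c :* d) := (a :* c) :* (b :* d)) refl a b (a ^ℚ k) (b ^ℚ k))
  where open ℚSolver using (solve; _:=_; _:*_)

∣-sum : ∀ {m k} {f : Fin k → ℤ} → (∀ i → f i ≋ 0ℤ [ m ]) → sum f ≋ 0ℤ [ m ]
∣-sum {k = k} h = ≋-trans (sum-≋ h) (≡⇒≋ (sum-zero {k} λ _ → refl))

module Form (k : ℕ) (α̃ : Fin k → ℤ) (β : ℕ) where

  n : ℕ
  n = suc (suc k)

  P : ℤ
  P = + (suc (2 ℕ.* n) ℕ.^ β)

  -- With n = k + 2 and j counted from 0, the exponent n - 1 - (j + 1) of T is k - j. It is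
  -- positive, so each term is divisible by T as well as by X.
  term : ℤ → ℤ → Fin k → ℤ
  term T X j = α̃ j * (T ^ (k ℕ.∸ toℕ j) * X ^ suc (toℕ j))

  formℤ : ℤ → ℤ → ℤ → ℤ
  formℤ a T X = a * T ^ suc k + (sum (term T X) + P * X ^ suc k)

  formF-⟦⟧ : ∀ a T X → formF n a α̃ β ⟦ T ⟧ ⟦ X ⟧ ≡ ⟦ formℤ a T X ⟧
  formF-⟦⟧ a T X = sym (begin
    ⟦ a * T ^ suc k + (sum (term T X) + P * X ^ suc k) ⟧
      ≡⟨ ⟦⟧-+ (a * T ^ suc k) (sum (term T X) + P * X ^ suc k) ⟩
    ⟦ a * T ^ suc k ⟧ ℚ.+ ⟦ sum (term T X) + P * X ^ suc k ⟧
      ≡⟨ cong₂ ℚ._+_ (⟦⟧-monomial a T (suc k)) (⟦⟧-+ (sum (term T X)) (P * X ^ suc k)) ⟩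
    ⟦ a ⟧ ℚ.* ⟦ T ⟧ ^ℚ suc k ℚ.+ (⟦ sum (term T X) ⟧ ℚ.+ ⟦ P * X ^ suc k ⟧)
      ≡⟨ cong (λ e → ⟦ a ⟧ ℚ.* ⟦ T ⟧ ^ℚ suc k ℚ.+ e) (cong₂ ℚ._+_ (trans (⟦⟧-sum (term T X)) (sumℚ-cong ⟦⟧-term)) (⟦⟧-monomial P X (suc k))) ⟩
    formF n a α̃ β ⟦ T ⟧ ⟦ X ⟧ ∎)
    where
    open ≡-Reasoning
    ⟦⟧-monomial : ∀ a T k → ⟦ a * T ^ k ⟧ ≡ ⟦ a ⟧ ℚ.* ⟦ T ⟧ ^ℚ k
    ⟦⟧-monomial a T k = trans (⟦⟧-* a (T ^ k)) (cong (λ e → ⟦ a ⟧ ℚ.* e) (⟦⟧-^ T k))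
    ⟦⟧-term : ∀ j → ⟦ term T X j ⟧ ≡ ⟦ α̃ j ⟧ ℚ.* (⟦ T ⟧ ^ℚ (k ℕ.∸ toℕ j) ℚ.* ⟦ X ⟧ ^ℚ suc (toℕ j))
    ⟦⟧-term j = trans (⟦⟧-* (α̃ j) _) (cong (λ e → ⟦ α̃ j ⟧ ℚ.* e)
      (trans (⟦⟧-* (T ^ (k ℕ.∸ toℕ j)) (X ^ suc (toℕ j))) (cong₂ ℚ._*_ (⟦⟧-^ T (k ℕ.∸ toℕ j)) (⟦⟧-^ X (suc (toℕ j))))))

  formF-homogeneous : ∀ a l t x → formF n a α̃ β (l ℚ.* t) (l ℚ.* x) ≡ l ^ℚ suc k ℚ.* formF n a α̃ β t x
  formF-homogeneous a l t x = begin
    ⟦ a ⟧ ℚ.* (l ℚ.* t) ^ℚ suc k ℚ.+ (sumℚ (monomial (l ℚ.* t) (l ℚ.* x)) ℚ.+ ⟦ P ⟧ ℚ.* (l ℚ.* x) ^ℚ suc k)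
      ≡⟨ cong₂ ℚ._+_ (cong (λ e → ⟦ a ⟧ ℚ.* e) (^ℚ-distrib-* l t (suc k)))
           (cong₂ ℚ._+_ (trans (sumℚ-cong monomial-homogeneous) (sumℚ-* L (monomial t x)))
             (cong (λ e → ⟦ P ⟧ ℚ.* e) (^ℚ-distrib-* l x (suc k)))) ⟩
    ⟦ a ⟧ ℚ.* (L ℚ.* t ^ℚ suc k) ℚ.+ (L ℚ.* sumℚ (monomial t x) ℚ.+ ⟦ P ⟧ ℚ.* (L ℚ.* x ^ℚ suc k))
      ≡⟨ solve 6 (λ a L u s p v → a :* (L :* u) :+ (L :* s :+ p :* (L :* v)) := L :* (a :* u :+ (s :+ p :* v))) refl
           ⟦ a ⟧ L (t ^ℚ suc k) (sumℚ (monomial t x)) ⟦ P ⟧ (x ^ℚ suc k) ⟩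
    L ℚ.* formF n a α̃ β t x ∎
    where
    open ≡-Reasoning
    open ℚSolver using (solve; _:=_; _:*_; _:+_)
    L : ℚ
    L = l ^ℚ suc k
    monomial : ℚ → ℚ → Fin k → ℚ
    monomial t x j = ⟦ α̃ j ⟧ ℚ.* (t ^ℚ (k ℕ.∸ toℕ j) ℚ.* x ^ℚ suc (toℕ j))
    degree : ∀ j → k ℕ.∸ toℕ j ℕ.+ suc (toℕ j) ≡ suc k
    degree j = trans (ℕ.+-suc (k ℕ.∸ toℕ j) (toℕ j)) (cong suc (ℕ.m∸n+n≡m (ℕ.<⇒≤ (toℕ<n j))))
    monomial-homogeneous : ∀ j → monomial (l ℚ.* t) (l ℚ.* x) j ≡ L ℚ.* monomial t x j
    monomial-homogeneous j = trans
      (cong (λ e → ⟦ α̃ j ⟧ ℚ.* e) (cong₂ ℚ._*_ (^ℚ-distrib-* l t (k ℕ.∸ toℕ j)) (^ℚ-distrib-* l x (suc (toℕ j)))))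
      (trans (solve 5 (λ a p u q v → a :* ((p :* u) :* (q :* v)) := (p :* q) :* (a :* (u :* v))) refl
                ⟦ α̃ j ⟧ (l ^ℚ (k ℕ.∸ toℕ j)) (t ^ℚ (k ℕ.∸ toℕ j)) (l ^ℚ suc (toℕ j)) (x ^ℚ suc (toℕ j)))
             (cong (ℚ._* monomial t x j) (trans (sym (^ℚ-+ l (k ℕ.∸ toℕ j) (suc (toℕ j)))) (cong (l ^ℚ_) (degree j)))))

  lhsℤ : ℤ → ℤ → ℤ → ℤ
  lhsℤ a T X = T * T * (formℤ a T X * formℤ (a + 1ℤ) T X)

  -- The degree 2 + 2 (n - 1) = 2n equals the number of factors of the norm, so a zero may be
  -- rescaled by l.
  formLHS-scale : ∀ a {l t x T X} → l ℚ.* t ≡ ⟦ T ⟧ → l ℚ.* x ≡ ⟦ X ⟧ → ⟦ lhsℤ a T X ⟧ ≡ l ^ℚ (2 ℕ.* n) ℚ.* formLHS n a α̃ β t x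
  formLHS-scale a {l} {t} {x} {T} {X} lt≡ lx≡ = begin
    ⟦ T * T * (formℤ a T X * formℤ (a + 1ℤ) T X) ⟧
      ≡⟨ ⟦⟧-* (T * T) _ ⟩
    ⟦ T * T ⟧ ℚ.* ⟦ formℤ a T X * formℤ (a + 1ℤ) T X ⟧
      ≡⟨ cong₂ ℚ._*_ (⟦⟧-* T T) (trans (⟦⟧-* (formℤ a T X) (formℤ (a + 1ℤ) T X)) (cong₂ ℚ._*_ (scale a) (scale (a + 1ℤ)))) ⟩
    ⟦ T ⟧ ℚ.* ⟦ T ⟧ ℚ.* (L ℚ.* F a ℚ.* (L ℚ.* F (a + 1ℤ)))
      ≡⟨ cong (λ e → e ℚ.* e ℚ.* (L ℚ.* F a ℚ.* (L ℚ.* F (a + 1ℤ)))) lt≡ ⟨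
    l ℚ.* t ℚ.* (l ℚ.* t) ℚ.* (L ℚ.* F a ℚ.* (L ℚ.* F (a + 1ℤ)))
      ≡⟨ solve 5 (λ l t L f g → (l :* t) :* (l :* t) :* ((L :* f) :* (L :* g)) := (l :* L) :* (l :* L) :* ((t :* (t :* con 1ℚ)) :* (f :* g))) refl
           l t L (F a) (F (a + 1ℤ)) ⟩
    l ^ℚ n ℚ.* l ^ℚ n ℚ.* formLHS n a α̃ β t x
      ≡⟨ cong (ℚ._* formLHS n a α̃ β t x) (trans (sym (^ℚ-+ l n n)) (cong (λ e → l ^ℚ (n ℕ.+ e)) (sym (ℕ.+-identityʳ n)))) ⟩
    l ^ℚ (2 ℕ.* n) ℚ.* formLHS n a α̃ β t x ∎
    where
    open ≡-Reasoning
    open ℚSolver using (solve; _:=_; _:*_; con)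
    L : ℚ
    L = l ^ℚ suc k
    F : ℤ → ℚ
    F a = formF n a α̃ β t x
    scale : ∀ a → ⟦ formℤ a T X ⟧ ≡ L ℚ.* F a
    scale a = trans (sym (formF-⟦⟧ a T X)) (trans (cong₂ (formF n a α̃ β) (sym lt≡) (sym lx≡)) (formF-homogeneous a l t x))

  formℤ-mod-T : ∀ a T X → ∃ λ G → formℤ a T X ≡ T * G + P * X ^ suc k
  formℤ-mod-T a T X = a * T ^ k + q , (begin
    a * (T * T ^ k) + (sum (term T X) + P * X ^ suc k)    ≡⟨ cong (λ e → a * (T * T ^ k) + (e + P * X ^ suc k)) (trans (_≋_[_].equality divisible) (ℤ.+-identityˡ (q * T))) ⟩
    a * (T * T ^ k) + (q * T + P * X ^ suc k)             ≡⟨ lem a T (T ^ k) q (P * X ^ suc k) ⟩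
    T * (a * T ^ k + q) + P * X ^ suc k                   ∎)
    where
    open ≡-Reasoning
    T∣T^ : ∀ e → 0 ℕ.< e → T ^ e ≋ 0ℤ [ T ]
    T∣T^ (suc e) _ = T ^ e , trans (ℤ.*-comm T (T ^ e)) (sym (ℤ.+-identityˡ _))
    divisible : sum (term T X) ≋ 0ℤ [ T ]
    divisible = ∣-sum λ j → ≋-trans (*-≋ (≋-refl (α̃ j)) (*-≋ (T∣T^ (k ℕ.∸ toℕ j) (ℕ.m<n⇒0<n∸m (toℕ<n j))) (≋-refl (X ^ suc (toℕ j)))))
      (≡⇒≋ (lem₀ (α̃ j) (X ^ suc (toℕ j))))
      where
      lem₀ : ∀ a x → a * (0ℤ * x) ≡ 0ℤ
      lem₀ = solve-∀
    q : ℤ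
    q = _≋_[_].quotient divisible
    lem : ∀ a t s q p → a * (t * s) + (q * t + p) ≡ t * (a * s + q) + p
    lem = solve-∀

  formℤ-mod-X : ∀ a T X → ∃ λ H → formℤ a T X ≡ a * T ^ suc k + X * H
  formℤ-mod-X a T X = q , cong (λ e → a * T ^ suc k + e) (trans (_≋_[_].equality divisible) (trans (ℤ.+-identityˡ (q * X)) (ℤ.*-comm q X)))
    where
    X∣ : ∀ c e → c * X ^ suc e ≋ 0ℤ [ X ]
    X∣ c e = c * X ^ e , lem c X (X ^ e)
      where
      lem : ∀ c x y → c * (x * y) ≡ 0ℤ + c * y * x
      lem = solve-∀
    divisible : sum (term T X) + P * X ^ suc k ≋ 0ℤ [ X ]
    divisible = +-≋ (∣-sum λ j → ≋-trans (*-≋ (≋-refl (α̃ j)) (X∣ (T ^ (k ℕ.∸ toℕ j)) (toℕ j))) (≡⇒≋ (ℤ.*-zeroʳ (α̃ j)))) (X∣ P k)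
    q : ℤ
    q = _≋_[_].quotient divisible

  formℤ-suc : ∀ a T X → formℤ (a + 1ℤ) T X ≡ formℤ a T X + T ^ suc k
  formℤ-suc a T X = lem a (T ^ suc k) (sum (term T X) + P * X ^ suc k)
    where
    lem : ∀ a t r → (a + 1ℤ) * t + r ≡ a * t + r + t
    lem = solve-∀

∣∣-coprime⇒⊥ : ∀ {a} {m} → Coprime ∣ a ∣ m → a ⊥ + m
∣∣-coprime⇒⊥ {+ n}      c = coprime⇒⊥ c
∣∣-coprime⇒⊥ { -[1+ n ]} c = ⊥-neg (coprime⇒⊥ c)

*-≡0ʳ : ∀ {a b} → a ≢ 0ℚ → a ℚ.* b ≡ 0ℚ → b ≡ 0ℚ
*-≡0ʳ {a} {b} a≢0 eq = trans (sym (ℚ.*-identityˡ b)) (trans (cong (ℚ._* b) (sym (ℚ.*-inverseˡ a))) (trans (ℚ.*-assoc (ℚ.1/ a) a b)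
  (trans (cong (λ e → ℚ.1/ a ℚ.* e) eq) (ℚ.*-zeroʳ (ℚ.1/ a)))))
  where instance _ = ℚ.≢-nonZero a≢0

-- Rational zeros of the polynomial

module Main (k : ℕ) (N-prime : Prime (suc (2 ℕ.* suc (suc k)))) (α : ℤ) (α̃ : Fin k → ℤ) (β : ℕ)
  (α-coprime : Coprime ∣ α * (α + 1ℤ) ∣ (suc (2 ℕ.* suc (suc k)))) where

  open Form k α̃ β

  M : ℕ
  M = 2 ℕ.* n

  M≢0 : M ≢ 0
  M≢0 ()

  open GroupRing M using (N; _≈_; _•_; 𝟙)
  open Norm M N-prime using (Nm)
  open Uniformiser M N-prime renaming (θ to ϑ)
  open Descent M M≢0 N-prime using (ev; Nm-zero)

  module _ (t x : ℚ) (y : Fin (M ℕ.∸ 1) → ℚ) (root : ι M (formLHS n α α̃ β t x) ≈ᶜ normForm n x y) where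

    private

      coordinates : Fin M → ℚ
      coordinates zero    = x
      coordinates (suc j) = y j

      -- Two scalings with different roles: l normalises t and x and is absorbed into R, whereas d
      -- clears the denominators that remain and stays visible as d^M. For t = 0 the choice is l =
      -- 1.
      integral-norm : ∀ d l R (z : Fin M → ℤ) → (∀ i → ⟦ z i ⟧ ≡ ⟦ + d ⟧ ℚ.* (l ℚ.* coordinates i)) →
        ⟦ R ⟧ ≡ l ^ℚ M ℚ.* formLHS n α α̃ β t x → Nm (ev ϑ z) ≈ ((+ d) ^ M * R) • 𝟙
      integral-norm d l R z z≡ R≡ = Transfer.normForm-clear-denominators M M≢0 N-prime (⟦ + d ⟧ ℚ.* l) x (formLHS n α α̃ β t x)
        ((+ d) ^ M * R) y z (trans (z≡ zero) (sym (ℚ.*-assoc ⟦ + d ⟧ l x))) (λ j → trans (z≡ (suc j)) (sym (ℚ.*-assoc ⟦ + d ⟧ l (y j))))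
        (trans (⟦⟧-* ((+ d) ^ M) R) (trans (cong₂ ℚ._*_ (⟦⟧-^ (+ d) M) R≡) (trans (sym (ℚ.*-assoc (⟦ + d ⟧ ^ℚ M) (l ^ℚ M) (formLHS n α α̃ β t x)))
          (cong (ℚ._* formLHS n α α̃ β t x) (sym (^ℚ-distrib-* ⟦ + d ⟧ l M))))))
        root

    t≡0⇒coordinates≡0 : t ≡ 0ℚ → ∀ i → coordinates i ≡ 0ℚ
    t≡0⇒coordinates≡0 t≡0 i = *-≡0ʳ {⟦ + d ⟧} d≢0 (trans (sym (z≡ i)) (cong ⟦_⟧ (Nm-zero z norm i)))
      where
      cleared : ∃ λ d → ℕ.NonZero d × ∃ λ (z : Fin M → ℤ) → ∀ i → ⟦ z i ⟧ ≡ ⟦ + d ⟧ ℚ.* coordinates i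
      cleared = common-denominator coordinates
      d : ℕ
      d = proj₁ cleared
      z : Fin M → ℤ
      z = proj₁ (proj₂ (proj₂ cleared))
      z≡ : ∀ i → ⟦ z i ⟧ ≡ ⟦ + d ⟧ ℚ.* coordinates i
      z≡ = proj₂ (proj₂ (proj₂ cleared))
      d≢0 : ⟦ + d ⟧ ≢ 0ℚ
      d≢0 eq = ℕ.≢-nonZero⁻¹ d {{proj₁ (proj₂ cleared)}} (ℤ.+-injective (⟦⟧-injective {+ d} {0ℤ} eq))
      lhs≡0 : 0ℚ ≡ 1ℚ ^ℚ M ℚ.* formLHS n α α̃ β t x
      lhs≡0 = sym (trans (cong (λ s → 1ℚ ^ℚ M ℚ.* (s ^ℚ 2 ℚ.* (formF n α α̃ β t x ℚ.* formF n (α + 1ℤ) α̃ β t x))) t≡0)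
        (trans (cong (λ e → 1ℚ ^ℚ M ℚ.* e) (ℚ.*-zeroˡ (formF n α α̃ β t x ℚ.* formF n (α + 1ℤ) α̃ β t x))) (ℚ.*-zeroʳ (1ℚ ^ℚ M))))
      norm : Nm (ev ϑ z) ≈ 0ℤ • 𝟙
      norm = subst (λ r → Nm (ev ϑ z) ≈ r • 𝟙) (ℤ.*-zeroʳ ((+ d) ^ M))
        (integral-norm d 1ℚ 0ℤ z (λ i → trans (z≡ i) (cong (λ e → ⟦ + d ⟧ ℚ.* e) (sym (ℚ.*-identityˡ (coordinates i))))) lhs≡0)

    t≡0 : t ≡ 0ℚ
    t≡0 = by-cases (t ℚ.≟ 0ℚ)
      where
      by-cases : Dec (t ≡ 0ℚ) → t ≡ 0ℚ
      by-cases (yes t≡0) = t≡0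
      by-cases (no t≢0) = Empty.⊥-elim (Unitary.no-primitive-solution M M≢0 N-prime
        {T} {X} {formℤ α T X} {formℤ (α + 1ℤ) T X} {T ^ suc k} {α} {P} {proj₁ (formℤ-mod-T α T X)} {proj₁ (formℤ-mod-X α T X)} {lhsℤ α T X} {k}
        3<N refl (formℤ-suc α T X) (proj₂ (formℤ-mod-T α T X)) (proj₂ (formℤ-mod-X α T X)) refl
        T⊥X (∣∣-coprime⇒⊥ α-coprime) P⊥ z d {{d≢0}} z₀≡
        (integral-norm d l (lhsℤ α T X) z z≡ (formLHS-scale α {l} {t} {x} {T} {X} lt≡ lx≡)))
        where
        instance
          t-nonZero : ℚ.NonZero t
          t-nonZero = ℚ.≢-nonZero t≢0
        -- x / t = X / T in lowest terms.
        q l : ℚ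
        q = x ℚ.* ℚ.1/ t
        T X : ℤ
        T = ℚ.↧ q
        X = ℚ.↥ q
        l = ⟦ T ⟧ ℚ.* ℚ.1/ t
        lt≡ : l ℚ.* t ≡ ⟦ T ⟧
        lt≡ = trans (ℚ.*-assoc ⟦ T ⟧ (ℚ.1/ t) t) (trans (cong (λ e → ⟦ T ⟧ ℚ.* e) (ℚ.*-inverseˡ t)) (ℚ.*-identityʳ ⟦ T ⟧))
        lx≡ : l ℚ.* x ≡ ⟦ X ⟧
        lx≡ = trans (ℚ.*-assoc ⟦ T ⟧ (ℚ.1/ t) x) (trans (cong (λ e → ⟦ T ⟧ ℚ.* e) (ℚ.*-comm (ℚ.1/ t) x)) (sym (numerator-≡ q)))
        T⊥X : T ⊥ X
        T⊥X = ⊥-sym (∣∣-coprime⇒⊥ (lowest-terms q))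
        P⊥ : ∀ {c} → c ⊥ + N → c ⊥ P
        P⊥ {c} h = subst (c ⊥_) (sym (pos-^ N β)) (⊥-sym (^-⊥ (⊥-sym h) β))
        3<N : 3 ℕ.< N
        3<N = ℕ.s≤s (ℕ.≤-trans (ℕ.s≤s (ℕ.s≤s (ℕ.s≤s ℕ.z≤n))) (ℕ.≤-reflexive (sym (lem k))))
          where
          lem : ∀ k → 2 ℕ.* suc (suc k) ≡ 4 ℕ.+ (k ℕ.+ k)
          lem = ℕSolver.solve-∀
        cleared : ∃ λ d → ℕ.NonZero d × ∃ λ (z : Fin M → ℤ) → ∀ i → ⟦ z i ⟧ ≡ ⟦ + d ⟧ ℚ.* (l ℚ.* coordinates i)
        cleared = common-denominator (λ i → l ℚ.* coordinates i)
        d : ℕ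
        d = proj₁ cleared
        d≢0 : ℕ.NonZero d
        d≢0 = proj₁ (proj₂ cleared)
        z : Fin M → ℤ
        z = proj₁ (proj₂ (proj₂ cleared))
        z≡ : ∀ i → ⟦ z i ⟧ ≡ ⟦ + d ⟧ ℚ.* (l ℚ.* coordinates i)
        z≡ = proj₂ (proj₂ (proj₂ cleared))
        z₀≡ : ∀ i → toℕ i ≡ 0 → z i ≡ + d * X
        z₀≡ zero _ = ⟦⟧-injective (trans (z≡ zero) (trans (cong (λ e → ⟦ + d ⟧ ℚ.* e) lx≡) (sym (⟦⟧-* (+ d) X))))

theorem2p3 : (n : ℕ) → 2 ℕ.≤ n → Prime (suc (2 ℕ.* n)) →
    (α₀ : ℤ) (α̃ : Fin (n ℕ.∸ 2) → ℤ) (β : ℕ) →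
    Coprime ∣ α₀ * (α₀ + + 1) ∣ (suc (2 ℕ.* n)) →
    (t x : ℚ) (y : Fin (2 ℕ.* n ℕ.∸ 1) → ℚ) →
    ι (2 ℕ.* n) (formLHS n α₀ α̃ β t x) ≈ᶜ normForm n x y →
    (t ≡ 0ℚ) × (x ≡ 0ℚ) × (∀ j → y j ≡ 0ℚ)
theorem2p3 (suc (suc k)) (ℕ.s≤s (ℕ.s≤s _)) N-prime α₀ α̃ β coprime t x y root =
  t≡0′ , t≡0⇒coordinates≡0 t x y root t≡0′ zero , λ j → t≡0⇒coordinates≡0 t x y root t≡0′ (suc j)
  where
  open Main k N-prime α₀ α̃ β coprime
  t≡0′ : t ≡ 0ℚ
  t≡0′ = t≡0 t x y root
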